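{- For each integer $r \ge 2$, there exists $\delta = \delta(r) > 0$ such that $$R_r(k) \le e^{ -\delta k} r^{rk}$$ for all sufficiently large $k \in \mathbb{N}$.
   Context: For $r,k \in \mathbb{N}$, the $r$-colour Ramsey number $R_r(k)$ is the minimum $n \in \mathbb{N}$ such that every colouring of the edges of the complete graph $K_n$ with $r$ colours contains a monochromatic copy of $K_k$. -}

module Defs where

open import Data.Nat using (ℕ; _≤_)
open import Data.Fin using (Fin)
open import Data.Product using (Σ; _×_)
open import Function.Definitions using (Injective)
open import Relation.Binary.PropositionalEquality using (_≡_; _≢_)

-- An r-colouring of the edges of K_n: a colour for each pair of distinct
-- vertices, symmetric in its arguments (values on the diagonal are irrelevant).
record EdgeColouring (r n : ℕ) : Set where
  field
    colour : Fin n → Fin n → Fin r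
    symm   : ∀ i j → colour i j ≡ colour j i
open EdgeColouring public

MonoClique : ∀ {r n} → EdgeColouring r n → (k : ℕ) → Set
MonoClique {r} {n} c k =
  Σ (Fin r) λ χ → Σ (Fin k → Fin n) λ f →
    Injective _≡_ _≡_ f × (∀ i j → i ≢ j → colour c (f i) (f j) ≡ χ)

RamseyProperty : ℕ → ℕ → ℕ → Set
RamseyProperty r k n = (c : EdgeColouring r n) → MonoClique c k

-- "R_r(k) ≤ B": since R_r(k) is the least n with the Ramsey property,
-- R_r(k) ≤ B iff some n ≤ B has the Ramsey property.
RamseyAtMost : ℕ → ℕ → ℕ → Set
RamseyAtMost r k B = Σ ℕ λ n → n ≤ B × RamseyProperty r k n

-- Rational-bound version:  R_r(k) ≤ (p/q)^k · B,  i.e.  q^k · n ≤ p^k · B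
RamseyAtMostScaled : ℕ → ℕ → (p q B : ℕ) → Set
RamseyAtMostScaled r k p q B =
  Σ ℕ λ n → q Data.Nat.^ k Data.Nat.* n ≤ p Data.Nat.^ k Data.Nat.* B × RamseyProperty r k n

{-# OPTIONS --safe #-}
-- After a few Erdős–Szekeres steps the colouring may be assumed nearly regular: all colour degrees are about a
-- fraction 1/r.  A book algorithm then finds, for t = k/const, a clique of t vertices in some colour ℓ, joined in
-- colour ℓ to a set Y of about r^(-t)|W| vertices.  Inside Y the off-diagonal Erdős–Szekeres bound with weights
-- 1/w_ℓ slightly below and 1/w_i slightly above 1/r gains a factor exponential in t, which beats the losses.
--
-- The algorithm keeps a reservoir X and sets Y_i such that every vertex of X has density about 1/r into Y_i in
-- colour i.  It continues as long as there are u ∈ X and a large X′ ⊆ X whose codegrees with u either do not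
-- drop much in any Y_i (then u joins the clique of its majority colour), or are substantially above average in
-- some Y_i (then Y_i is replaced by a neighbourhood, and the density is boosted).  Such u, X′ exist because
-- the codegree deviations z_i(u, v) are Gram kernels: for a polynomial h with nonnegative coefficients the kernel
-- Σ_j z_j Π_{i≠j} (3 + h(z_i)) is again one, so its average is nonnegative.  For h(z) = T_{2^J}(1 + cz) - 1, with T
-- the Chebyshev polynomials, h is bounded on the negative range and grows like exp √z on the positive one; hence
-- the kernel is negative wherever some z_i is very negative, which must be compensated by positive correlation.
-- The polynomials h replace the function cosh √z, so that all estimates stay within integer arithmetic.

module Submission where

open import Defs
open import Data.Bool as Bool using (Bool; true; false; _∧_; _∨_; not; if_then_else_)
open import Data.Empty using (⊥-elim)
open import Data.Fin using (Fin; zero; suc; fromℕ<) renaming (_≟_ to _≟ᶠ_)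
import Data.Fin.Properties as Fin
open import Data.Product using (Σ; _×_; _,_; proj₁; proj₂; ∃)
open import Data.Sum as Sum using (_⊎_; inj₁; inj₂)
open import Data.Vec.Functional using (updateAt)
open import Data.Vec.Functional.Properties using (updateAt-updates; updateAt-minimal)
open import Function using (_∘_)
open import Relation.Nullary using (Dec; yes; no)
open import Relation.Nullary.Decidable using (does; _×-dec_)
open import Relation.Binary.PropositionalEquality

-- The saving in the theorem comes from the `τ` regularisation steps alone, each worth a factor
-- `1 + 1/E`; the book only shows that a nearly regular set of size `r^(r*k) / (2*r)^τ` is already
-- large enough. The constants form a circle. A step of the algorithm may shrink the reservoir by
-- `2^O(2^a′)`, so `k ≥ S*t` with `S` of order `2^a′`. The skewed weights lose `O(1/Θ²)` in each of
-- about `S*t` steps and gain about `r′/Θ` in `t` steps, so `Θ` is of order `S`. Boosts shrink `Y`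
-- without enlarging a clique, so only `τ = t / (Θ*D′)` units of them are affordable. These units,
-- worth `4^a′` of potential each, must suffice to push a density past `1`, which takes `t*(b + r)`.
-- Hence `Θ*D′*(b + r) ≤ 4^a′`, where the left side is of order `a′ * 2^a′`. The circle closes
-- because a correlation of order `4^a′` costs only about `2^a′` bits of reservoir: this is the
-- growth `exp √z`. A kernel growing like `exp z` would cost `4^a′` bits and leave no room.

-- Cliques inside neighbourhoods and the weighted off-diagonal Erdős-Szekeres bound.

module Cliques where

  open import Data.Nat
  open import Data.Nat.Properties
  open import Data.Nat.Tactic.RingSolver using (solve-∀)
  open import Algebra.Properties.Semiring.Sum +-*-semiring using (sum; ∑-distrib-+; ∑-comm; *-distribˡ-sum; *-distribʳ-sum)
  open import Algebra.Properties.CommutativeMonoid.Sum *-1-commutativeMonoid using () renaming (sum to prod)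

  sum-update : ∀ {r} (F : Fin r → ℕ → ℕ) (k : Fin r → ℕ) (f : ℕ → ℕ) (i : Fin r) x →
    F i (k i) ≡ x + F i (f (k i)) →
    sum (λ j → F j (k j)) ≡ x + sum (λ j → F j (updateAt k i f j))
  sum-update F k f zero x eq rewrite eq = +-assoc x _ _
  sum-update F k f (suc i) x eq
    rewrite sum-update (F ∘ suc) (k ∘ suc) f i x eq = lemma (F zero (k zero)) x _
    where
    lemma : ∀ a b c → a + (b + c) ≡ b + (a + c)
    lemma = solve-∀

  prod-update : ∀ {r} (F : Fin r → ℕ → ℕ) (k : Fin r → ℕ) (f : ℕ → ℕ) (i : Fin r) x →
    F i (k i) ≡ x * F i (f (k i)) →
    prod (λ j → F j (k j)) ≡ x * prod (λ j → F j (updateAt k i f j))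
  prod-update F k f zero x eq rewrite eq = *-assoc x _ _
  prod-update F k f (suc i) x eq
    rewrite prod-update (F ∘ suc) (k ∘ suc) f i x eq = lemma (F zero (k zero)) x _
    where
    lemma : ∀ a b c → a * (b * c) ≡ b * (a * c)
    lemma = solve-∀

  sum-mono : ∀ {n} {f g : Fin n → ℕ} → (∀ i → f i ≤ g i) → sum f ≤ sum g
  sum-mono {zero} h = z≤n
  sum-mono {suc n} h = +-mono-≤ (h zero) (sum-mono (h ∘ suc))

  prod-mono : ∀ {n} {f g : Fin n → ℕ} → (∀ i → f i ≤ g i) → prod f ≤ prod g
  prod-mono {zero} h = ≤-refl
  prod-mono {suc n} h = *-mono-≤ (h zero) (prod-mono (h ∘ suc))

  term≤sum : ∀ {n} (f : Fin n → ℕ) i → f i ≤ sum f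
  term≤sum f zero = m≤m+n _ _
  term≤sum f (suc i) = ≤-trans (term≤sum (f ∘ suc) i) (m≤n+m _ _)

  sum-const : ∀ n x → sum {n} (λ _ → x) ≡ n * x
  sum-const zero x = refl
  sum-const (suc n) x = cong (x +_) (sum-const n x)

  prod-^ : ∀ {n} Q (k : Fin n → ℕ) → prod (λ i → Q ^ k i) ≡ Q ^ sum k
  prod-^ {zero} Q k = refl
  prod-^ {suc n} Q k rewrite prod-^ Q (k ∘ suc) = sym (^-distribˡ-+-* Q (k zero) _)

  𝟙 : Bool → ℕ
  𝟙 true = 1
  𝟙 false = 0

  VSet : ℕ → Set
  VSet n = Fin n → Bool

  infixl 6 _∩_
  _∩_ : ∀ {n} → VSet n → VSet n → VSet n
  (S ∩ T) v = S v ∧ T v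

  _∈_ : ∀ {n} → Fin n → VSet n → Set
  v ∈ S = S v ≡ true

  _⊆_ : ∀ {n} → VSet n → VSet n → Set
  S ⊆ T = ∀ v → v ∈ S → v ∈ T

  card : ∀ {n} → VSet n → ℕ
  card S = sum (λ v → 𝟙 (S v))

  𝟙-mono : ∀ {a b} → (a ≡ true → b ≡ true) → 𝟙 a ≤ 𝟙 b
  𝟙-mono {false} h = z≤n
  𝟙-mono {true} h rewrite h refl = ≤-refl

  ∧-elim : ∀ {a b} → a ∧ b ≡ true → a ≡ true × b ≡ true
  ∧-elim {true} {true} _ = refl , refl

  ∧-intro : ∀ {a b} → a ≡ true → b ≡ true → a ∧ b ≡ true
  ∧-intro refl refl = refl

  card-mono : ∀ {n} {S T : VSet n} → S ⊆ T → card S ≤ card T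
  card-mono h = sum-mono (λ v → 𝟙-mono (h v))

  card>0⇒inhabited : ∀ {n} (S : VSet n) → 0 < card S → ∃ λ v → v ∈ S
  card>0⇒inhabited {suc n} S h with S zero in eq
  ... | true = zero , eq
  ... | false = let (v , p) = card>0⇒inhabited (S ∘ suc) h in suc v , p

  card-singleton : ∀ {n} (v : Fin n) → card (λ u → does (u ≟ᶠ v)) ≡ 1
  card-singleton {suc n} zero = cong suc (empty n)
    where
    empty : ∀ n → sum {n} (λ _ → 0) ≡ 0
    empty zero = refl
    empty (suc n) = empty n
  card-singleton {suc n} (suc v) = card-singleton v

  card-full : ∀ n → card {n} (λ _ → true) ≡ n
  card-full n = trans (sum-const n 1) (*-identityʳ n)

  does-true : ∀ {p} {P : Set p} (d : Dec P) → does d ≡ true → P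
  does-true (yes p) _ = p

  true-does : ∀ {p} {P : Set p} (d : Dec P) → P → does d ≡ true
  true-does (yes p) _ = refl
  true-does (no ¬p) p = ⊥-elim (¬p p)

  module Colouring {r n} (c : EdgeColouring r n) where

    nb : Fin r → Fin n → VSet n
    nb i v u = not (does (u ≟ᶠ v)) ∧ does (colour c v u ≟ᶠ i)

    nb-colour : ∀ {i v u} → u ∈ nb i v → colour c v u ≡ i
    nb-colour {i} {v} {u} h = does-true (colour c v u ≟ᶠ i) (proj₂ (∧-elim h))

    nb-≢ : ∀ {i v u} → u ∈ nb i v → u ≢ v
    nb-≢ {i} {v} {u} h e with u ≟ᶠ v
    nb-≢ () e | yes _
    ... | no ne = ne e

    card≤1+nbs : ∀ (S : VSet n) v → card S ≤ 1 + sum (λ i → card (S ∩ nb i v))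
    card≤1+nbs S v = begin
      card S
        ≤⟨ sum-mono pointwise ⟩
      sum (λ u → 𝟙 (does (u ≟ᶠ v)) + sum (λ i → 𝟙 ((S ∩ nb i v) u)))
        ≡⟨ ∑-distrib-+ (λ u → 𝟙 (does (u ≟ᶠ v))) _ ⟩
      card (λ u → does (u ≟ᶠ v)) + sum (λ u → sum (λ i → 𝟙 ((S ∩ nb i v) u)))
        ≡⟨ cong₂ _+_ (card-singleton v) (∑-comm (λ u i → 𝟙 ((S ∩ nb i v) u))) ⟩
      1 + sum (λ i → card (S ∩ nb i v)) ∎
      where
      open ≤-Reasoning
      pointwise : ∀ u → 𝟙 (S u) ≤ 𝟙 (does (u ≟ᶠ v)) + sum (λ i → 𝟙 ((S ∩ nb i v) u))
      pointwise u with S u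
      ... | false = z≤n
      ... | true with u ≟ᶠ v
      ...   | yes _ = s≤s z≤n
      ...   | no _ = ≤-trans
                (≤-reflexive (sym (cong 𝟙 (true-does (colour c v u ≟ᶠ colour c v u) refl))))
                (term≤sum (λ i → 𝟙 (does (colour c v u ≟ᶠ i))) (colour c v u))

    -- Built vertex by vertex inside the neighbourhoods of the earlier ones, so that passing from
    -- `S` to `S ∩ nb i v` is one constructor. Injectivity is automatic because `nb i v` excludes
    -- `v`.
    data Clique (i : Fin r) : ℕ → VSet n → Set where
      nil  : ∀ {S} → Clique i 0 S
      cons : ∀ {m S} v → v ∈ S → Clique i m (S ∩ nb i v) → Clique i (suc m) S

    Clique-mono : ∀ {i m S T} → S ⊆ T → Clique i m S → Clique i m T
    Clique-mono h nil = nil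
    Clique-mono {S = S} h (cons v p q) = cons v (h v p)
      (Clique-mono (λ u m → ∧-intro (h u (proj₁ (∧-elim {S u} m))) (proj₂ (∧-elim {S u} m))) q)

    Clique⇒embedding : ∀ {i m S} → Clique i m S → Σ (Fin m → Fin n) λ f →
      (∀ {x y} → f x ≡ f y → x ≡ y) × (∀ x y → x ≢ y → colour c (f x) (f y) ≡ i) × (∀ x → f x ∈ S)
    Clique⇒embedding nil = (λ ()) , (λ { {()} }) , (λ ()) , λ ()
    Clique⇒embedding {i} {suc m} {S} (cons v v∈S q) with Clique⇒embedding q
    ... | f , inj , col , mem = g , ginj , gcol , gmem
      where
      g : Fin (suc m) → Fin n
      g zero = v
      g (suc x) = f x
      v~ : ∀ x → f x ∈ nb i v
      v~ x = proj₂ (∧-elim {S (f x)} (mem x))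
      ginj : ∀ {x y} → g x ≡ g y → x ≡ y
      ginj {zero} {zero} e = refl
      ginj {zero} {suc y} e = ⊥-elim (nb-≢ (v~ y) (sym e))
      ginj {suc x} {zero} e = ⊥-elim (nb-≢ (v~ x) e)
      ginj {suc x} {suc y} e = cong suc (inj e)
      gcol : ∀ x y → x ≢ y → colour c (g x) (g y) ≡ i
      gcol zero zero ne = ⊥-elim (ne refl)
      gcol zero (suc y) ne = nb-colour (v~ y)
      gcol (suc x) zero ne = trans (symm c (f x) v) (nb-colour (v~ x))
      gcol (suc x) (suc y) ne = col x y (ne ∘ cong suc)
      gmem : ∀ x → g x ∈ S
      gmem zero = v∈S
      gmem (suc x) = proj₁ (∧-elim {S (f x)} (mem x))

    Good : VSet n → (Fin r → ℕ) → Set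
    Good W k = Σ (Fin r) λ i → Clique i (k i) W

    Good⇒MonoClique : ∀ {W} k → Good W (λ _ → k) → MonoClique c k
    Good⇒MonoClique k (i , q) with Clique⇒embedding q
    ... | f , inj , col , _ = i , f , inj , col

    Good-cons : ∀ {W} k i v → v ∈ W → 0 < k i → Good (W ∩ nb i v) (updateAt k i pred) → Good W k
    Good-cons {W} k i v v∈W ki (j , q) with j ≟ᶠ i
    ... | no j≢i = j , Clique-mono (λ u m → proj₁ (∧-elim m))
                         (subst (λ x → Clique j x _) (updateAt-minimal j i k j≢i) q)
    ... | yes refl = i , subst (λ x → Clique i x W) (suc-pred (k i) ⦃ >-nonZero ki ⦄)
                           (cons v v∈W (subst (λ x → Clique i x _) (updateAt-updates i k) q))

    zero-good : ∀ {W} k i → k i ≡ 0 → Good W k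
    zero-good {W} k i e = i , subst (λ x → Clique i x W) (sym e) nil

  module ErdősSzekeres {r n} (c : EdgeColouring (suc r) n)
    (a : Fin (suc r) → ℕ) (Q : ℕ) (Σa≤Q : sum a ≤ Q) where

    open Colouring c

    weight : (Fin (suc r) → ℕ) → ℕ
    weight k = prod (λ i → a i ^ k i)

    -- For r + 1 colours, the shift of |W| by 1/r absorbs the vertex lost at each step.
    weighted-bound : ∀ s k W → sum k ≡ s → Q ^ s < (r * card W + 1) * weight k → Good W k
    weighted-bound s k W Σk h with Fin.any? (λ i → k i ≟ 0)
    ... | yes (i , ki) = zero-good k i ki
    weighted-bound zero k W Σk h | no k≢0 =
      ⊥-elim (k≢0 (zero , n≤0⇒n≡0 (≤-trans (term≤sum k zero) (≤-reflexive Σk))))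
    weighted-bound (suc s) k W Σk h | no k≢0
      with card W in W≡
    -- The shift `+ 1` leaves a positive factor even for empty `W`; this case is excluded because
    -- every weight is at most `Q`.
    ... | zero = ⊥-elim (<⇒≱ h (begin
      (r * 0 + 1) * weight k ≡⟨ cong (λ x → (x + 1) * weight k) (*-zeroʳ r) ⟩
      1 * weight k ≡⟨ *-identityˡ _ ⟩
      weight k ≤⟨ prod-mono (λ i → ^-monoˡ-≤ (k i) (≤-trans (term≤sum a i) Σa≤Q)) ⟩
      prod (λ i → Q ^ k i) ≡⟨ prod-^ Q k ⟩
      Q ^ sum k ≡⟨ cong (Q ^_) Σk ⟩
      Q ^ suc s ∎))
      where open ≤-Reasoning
    ... | suc w
      with card>0⇒inhabited W (≤-trans (s≤s z≤n) (≤-reflexive (sym W≡)))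
    ...   | v , v∈W
      with Fin.any? (λ i → Q ^ s <? (r * card (W ∩ nb i v) + 1) * weight (updateAt k i pred))
    ...     | yes (i , hi) = Good-cons k i v v∈W (n≢0⇒n>0 (λ e → k≢0 (i , e)))
                (weighted-bound s (updateAt k i pred) (W ∩ nb i v) (Σk' i) hi)
      where
      Σk' : ∀ i → sum (updateAt k i pred) ≡ s
      Σk' i = suc-injective (trans
        (sym (sum-update (λ _ x → x) k pred i 1 (sym (suc-pred (k i) ⦃ ≢-nonZero (λ e → k≢0 (i , e)) ⦄))))
        Σk)
    ...     | no none = ⊥-elim (<⇒≱ h (begin
      (r * suc w + 1) * weight k
        ≡⟨ cong (λ x → (r * x + 1) * weight k) (sym W≡) ⟩
      (r * card W + 1) * weight k
        ≤⟨ *-monoˡ-≤ (weight k) (+-monoˡ-≤ 1 (*-monoʳ-≤ r (card≤1+nbs W v))) ⟩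
      -- The lost vertex and the shift make `r + 1` ones, one for each colour, so the shifted form
      -- is restored in every colour.
      (r * (1 + sum N) + 1) * weight k
        ≡⟨ cong (_* weight k) (shift r (sum N)) ⟩
      (r * sum N + suc r * 1) * weight k
        ≡⟨ cong₂ (λ x y → (x + y) * weight k) (*-distribˡ-sum r N) (sym (sum-const (suc r) 1)) ⟩
      (sum (λ i → r * N i) + sum {suc r} (λ i → 1)) * weight k
        ≡⟨ cong (_* weight k) (sym (∑-distrib-+ (λ i → r * N i) (λ i → 1))) ⟩
      sum (λ i → r * N i + 1) * weight k
        ≡⟨ *-distribʳ-sum (weight k) (λ i → r * N i + 1) ⟩
      sum (λ i → (r * N i + 1) * weight k)
        ≤⟨ sum-mono bound ⟩
      sum (λ i → a i * Q ^ s)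
        ≡⟨ sym (*-distribʳ-sum (Q ^ s) a) ⟩
      sum a * Q ^ s
        ≤⟨ *-monoˡ-≤ (Q ^ s) Σa≤Q ⟩
      Q ^ suc s ∎))
      where
      open ≤-Reasoning
      N : Fin (suc r) → ℕ
      N i = card (W ∩ nb i v)
      shift : ∀ r x → r * (1 + x) + 1 ≡ r * x + suc r * 1
      shift = solve-∀
      swap : ∀ x y z → x * (y * z) ≡ y * (x * z)
      swap = solve-∀
      bound : ∀ i → (r * N i + 1) * weight k ≤ a i * Q ^ s
      bound i = begin
        (r * N i + 1) * weight k
          ≡⟨ cong ((r * N i + 1) *_) (prod-update (λ i x → a i ^ x) k pred i (a i)
               (cong (a i ^_) (sym (suc-pred (k i) ⦃ ≢-nonZero (λ e → k≢0 (i , e)) ⦄)))) ⟩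
        (r * N i + 1) * (a i * weight (updateAt k i pred))
          ≡⟨ swap (r * N i + 1) (a i) (weight (updateAt k i pred)) ⟩
        a i * ((r * N i + 1) * weight (updateAt k i pred))
          ≤⟨ *-monoʳ-≤ (a i) (≮⇒≥ (λ lt → none (i , lt))) ⟩
        a i * Q ^ s ∎

-- Averaging over pairs of vertices and over dyadic levels.

module Pigeonhole where

  open Cliques
  open import Data.Nat
  open import Data.Nat.Properties
  open import Data.Nat.Tactic.RingSolver using (solve-∀)
  open import Algebra.Properties.Semiring.Sum +-*-semiring using (sum; sum-cong-≗; ∑-distrib-+; ∑-comm; *-distribˡ-sum; *-distribʳ-sum)

  sum-0 : ∀ n → sum {n} (λ _ → 0) ≡ 0
  sum-0 n = trans (sum-const n 0) (*-zeroʳ n)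

  exists-large : ∀ {n} (f : Fin n → ℕ) m → 0 < m → m ≤ sum f → ∃ λ i → m ≤ n * f i
  exists-large {n} f m m>0 h with Fin.any? (λ i → m ≤? n * f i)
  ... | yes p = p
  exists-large {zero} f m m>0 h | no none = ⊥-elim (<⇒≱ m>0 h)
  exists-large {suc n} f (suc m) m>0 h | no none = ⊥-elim (<⇒≱ (begin-strict
    suc n * sum f ≡⟨ *-distribˡ-sum (suc n) f ⟩
    sum (λ i → suc n * f i) ≤⟨ sum-mono {f = λ i → suc n * f i} {λ _ → m} (λ i → ≤-pred (≰⇒> (λ p → none (i , p)))) ⟩
    sum {suc n} (λ _ → m) ≡⟨ sum-const (suc n) m ⟩
    suc n * m <⟨ *-monoʳ-< (suc n) (n<1+n m) ⟩
    suc n * suc m ∎) (*-monoʳ-≤ (suc n) h))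
    where open ≤-Reasoning

  count² : ∀ {n} → (Fin n → Fin n → Bool) → ℕ
  count² E = sum (λ u → card (E u))

  exists-popular : ∀ {n} (X : VSet n) (E : Fin n → Fin n → Bool) C → (∀ u v → E u v ≡ true → u ∈ X) →
    0 < card X → card X * card X ≤ C * count² E → ∃ λ u → u ∈ X × card X ≤ C * card (E u)
  exists-popular {n} X E C E⇒X X>0 h with Fin.any? (λ u → (X u Bool.≟ true) ×-dec (card X ≤? C * card (E u)))
  ... | yes p = p
  ... | no none = ⊥-elim (<⇒≱ few h)
    where
    open ≤-Reasoning
    x = pred (card X)
    empty : ∀ u v → X u ≡ false → E u v ≡ false
    empty u v u∉X with E u v in eq
    ... | false = refl
    ... | true with trans (sym u∉X) (E⇒X u v eq)
    ...   | ()
    small : ∀ u → C * card (E u) ≤ 𝟙 (X u) * x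
    small u with X u in eq
    ... | true = subst (C * card (E u) ≤_) (sym (*-identityˡ x)) (<⇒≤pred (≰⇒> (λ p → none (u , eq , p))))
    ... | false = ≤-reflexive (trans (cong (C *_) (trans (sum-cong-≗ (λ v → cong 𝟙 (empty u v eq))) (sum-0 n))) (*-zeroʳ C))
    few : C * count² E < card X * card X
    few = begin-strict
      C * count² E ≡⟨ *-distribˡ-sum C (λ u → card (E u)) ⟩
      sum (λ u → C * card (E u)) ≤⟨ sum-mono small ⟩
      sum (λ u → 𝟙 (X u) * x) ≡⟨ sym (*-distribʳ-sum x (λ u → 𝟙 (X u))) ⟩
      card X * x <⟨ *-monoʳ-< (card X) ⦃ >-nonZero X>0 ⦄ (≤-reflexive (suc-pred (card X) ⦃ >-nonZero X>0 ⦄)) ⟩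
      card X * card X ∎

  module Levels {n r} (good : Fin n → Fin n → Bool) (exceeds : ℕ → Fin r → Fin n → Fin n → Bool) (β : ℕ → ℕ) where

    -- A majorant for a kernel at a good pair: the highest level exceeded in some colour already
    -- pays for the whole value, and the charges at the other levels are harmless surplus.
    dominant : ℕ → Fin n → Fin n → ℕ
    dominant zero u v = β 0 * 𝟙 (good u v)
    dominant (suc d) u v = β (suc d) * sum (λ i → 𝟙 (exceeds d i u v)) + dominant d u v

    total : ℕ → ℕ
    total d = sum (λ u → sum (λ v → dominant d u v))

    level-count : ℕ → ℕ
    level-count d = β (suc d) * sum (λ i → count² (exceeds d i))

    total-zero : total 0 ≡ β 0 * count² good
    total-zero = sym (trans (*-distribˡ-sum (β 0) (λ u → card (good u)))
      (sum-cong-≗ (λ u → *-distribˡ-sum (β 0) (λ v → 𝟙 (good u v)))))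

    total-suc : ∀ d → total (suc d) ≡ level-count d + total d
    total-suc d = begin
      total (suc d)
        ≡⟨ sum-cong-≗ (λ u → ∑-distrib-+ (λ v → β (suc d) * sum (λ i → 𝟙 (exceeds d i u v))) (dominant d u)) ⟩
      sum (λ u → sum (λ v → β (suc d) * sum (λ i → 𝟙 (exceeds d i u v))) + sum (dominant d u))
        ≡⟨ ∑-distrib-+ (λ u → sum (λ v → β (suc d) * sum (λ i → 𝟙 (exceeds d i u v)))) (λ u → sum (dominant d u)) ⟩
      sum (λ u → sum (λ v → β (suc d) * sum (λ i → 𝟙 (exceeds d i u v)))) + total d
        ≡⟨ cong (_+ total d) (sum-cong-≗ (λ u → sym (*-distribˡ-sum (β (suc d)) (λ v → sum (λ i → 𝟙 (exceeds d i u v)))))) ⟩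
      sum (λ u → β (suc d) * sum (λ v → sum (λ i → 𝟙 (exceeds d i u v)))) + total d
        ≡⟨ cong (_+ total d) (sym (*-distribˡ-sum (β (suc d)) (λ u → sum (λ v → sum (λ i → 𝟙 (exceeds d i u v)))))) ⟩
      β (suc d) * sum (λ u → sum (λ v → sum (λ i → 𝟙 (exceeds d i u v)))) + total d
        ≡⟨ cong (λ x → β (suc d) * x + total d) (trans
             (sum-cong-≗ (λ u → ∑-comm (λ v i → 𝟙 (exceeds d i u v))))
             (∑-comm (λ u i → card (exceeds d i u)))) ⟩
      level-count d + total d ∎
      where open ≡-Reasoning

    -- The shares `N / 2^(2+d)` of the levels add up to `N/2 - N/2^(1+D)`. The summand `N` on the
    -- left records the missing tail, which makes the induction exact.
    dyadic : ∀ N D → (∀ d → d < D → 2 ^ (2 + d) * level-count d ≤ N) →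
      2 ^ (1 + D) * total D + N ≤ 2 ^ (1 + D) * total 0 + 2 ^ D * N
    dyadic N zero h = ≤-reflexive (cong (2 * total 0 +_) (sym (*-identityˡ N)))
    dyadic N (suc d) h rewrite total-suc d = +-cancelʳ-≤ N _ _ (begin
      2 * (2 * p) * (level-count d + total d) + N + N
        ≡⟨ eq₁ p (level-count d) (total d) N ⟩
      2 * (2 * p) * level-count d + 2 * (2 * p * total d + N)
        ≤⟨ +-mono-≤ (h d ≤-refl) (*-monoʳ-≤ 2 (dyadic N d (λ e e<d → h e (<-trans e<d (n<1+n d))))) ⟩
      N + 2 * (2 * p * total 0 + p * N)
        ≡⟨ eq₂ p (total 0) N ⟩
      2 * (2 * p) * total 0 + 2 * p * N + N ∎)
      where
      open ≤-Reasoning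
      p = 2 ^ d
      eq₁ : ∀ p l t N → 2 * (2 * p) * (l + t) + N + N ≡ 2 * (2 * p) * l + 2 * (2 * p * t + N)
      eq₁ = solve-∀
      eq₂ : ∀ p t N → N + 2 * (2 * p * t + p * N) ≡ 2 * (2 * p) * t + 2 * p * N + N
      eq₂ = solve-∀

    -- If every level keeps within its share, the levels contribute less than `N / 2` beyond
    -- `total 0`, and the good pairs must carry the other half. The factor `2 ^ (2 + d)` is cheap in
    -- the application, where `β` grows doubly exponentially in `d`.
    pigeonhole : ∀ N D → 0 < N → N ≤ sum (λ u → sum (λ v → 𝟙 (good u v) + dominant D u v)) →
      N ≤ 2 * (1 + β 0) * count² good ⊎
      ∃ λ d → d < D × ∃ λ i → N ≤ 2 ^ (2 + d) * (β (suc d) * r) * count² (exceeds d i)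
    pigeonhole N D N>0 h with N ≤? 2 * (1 + β 0) * count² good
    ... | yes p = inj₁ p
    ... | no ¬p with anyUpTo? (λ d → N ≤? 2 ^ (2 + d) * level-count d) D
    ...   | no none = ⊥-elim (<⇒≱ (≰⇒> ¬p) (*-cancelˡ-≤ (2 ^ D) ⦃ m^n≢0 2 D ⦄ (+-cancelʳ-≤ (2 ^ D * N) _ _ (begin
        p * N + p * N
          ≡⟨ eq₁ p N ⟩
        2 * p * N
          ≤⟨ *-monoʳ-≤ (2 * p) N≤ ⟩
        2 * p * (count² good + total D)
          ≡⟨ *-distribˡ-+ (2 * p) (count² good) (total D) ⟩
        2 * p * count² good + 2 * p * total D
          ≤⟨ +-monoʳ-≤ (2 * p * count² good) (≤-trans (m≤m+n _ N)
               (dyadic N D (λ d d<D → <⇒≤ (≰⇒> (λ q → none (d , d<D , q)))))) ⟩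
        2 * p * count² good + (2 * p * total 0 + p * N)
          ≡⟨ cong (λ x → 2 * p * count² good + (2 * p * x + p * N)) total-zero ⟩
        2 * p * count² good + (2 * p * (β 0 * count² good) + p * N)
          ≡⟨ eq₂ p (β 0) (count² good) N ⟩
        p * (2 * (1 + β 0) * count² good) + p * N ∎))))
      where
      open ≤-Reasoning
      p = 2 ^ D
      eq₁ : ∀ p N → p * N + p * N ≡ 2 * p * N
      eq₁ = solve-∀
      eq₂ : ∀ p b c N → 2 * p * c + (2 * p * (b * c) + p * N) ≡ p * (2 * (1 + b) * c) + p * N
      eq₂ = solve-∀
      N≤ : N ≤ count² good + total D
      N≤ = ≤-trans h (≤-reflexive (trans
        (sum-cong-≗ (λ u → ∑-distrib-+ (λ v → 𝟙 (good u v)) (dominant D u)))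
        (∑-distrib-+ (λ u → card (good u)) (λ u → sum (dominant D u)))))
    ...   | yes (d , d<D , q) with exists-large (λ i → c * count² (exceeds d i)) N N>0 (begin
        N ≤⟨ q ⟩
        2 ^ (2 + d) * (β (suc d) * sum (λ i → count² (exceeds d i)))
          ≡⟨ sym (*-assoc (2 ^ (2 + d)) (β (suc d)) _) ⟩
        c * sum (λ i → count² (exceeds d i))
          ≡⟨ *-distribˡ-sum c (λ i → count² (exceeds d i)) ⟩
        sum (λ i → c * count² (exceeds d i)) ∎)
      where
      open ≤-Reasoning
      c = 2 ^ (2 + d) * β (suc d)
    ...     | i , hi = inj₂ (d , d<D , i , ≤-trans hi (≤-reflexive (eq r (2 ^ (2 + d)) (β (suc d)) (count² (exceeds d i)))))
      where
      eq : ∀ r a b x → r * (a * b * x) ≡ a * (b * r) * x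
      eq = solve-∀

-- Gram kernels over the integers and scaled Chebyshev polynomials.

module GramKernels where

  open import Data.Integer hiding (suc; pred)
  open import Data.Integer.Properties
  open import Data.Integer.Tactic.RingSolver using (solve-∀)
  open import Data.List using (List; []; _∷_; _++_; map)
  open import Data.Nat as ℕ using (ℕ; zero; suc; z≤n; s≤s)
  import Data.Nat.Properties as ℕ
  open import Algebra.Properties.Semiring.Sum +-*-semiring using (sum; sum-cong-≗; ∑-distrib-+; *-distribˡ-sum; *-distribʳ-sum)

  0≤+ : ∀ {a b} → 0ℤ ≤ a → 0ℤ ≤ b → 0ℤ ≤ a + b
  0≤+ = +-mono-≤

  0≤* : ∀ {a b} → 0ℤ ≤ a → 0ℤ ≤ b → 0ℤ ≤ a * b
  0≤* {+ m} {+ n} _ _ = subst (0ℤ ≤_) (pos-* m n) (+≤+ z≤n)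

  0<* : ∀ {a b} → 0ℤ < a → 0ℤ < b → 0ℤ < a * b
  0<* {+[1+ m ]} {+[1+ n ]} _ _ = +<+ (s≤s z≤n)
  0<* {+[1+ m ]} {+ zero} _ (+<+ ())
  0<* {+ zero} (+<+ ())

  0≤square : ∀ a → 0ℤ ≤ a * a
  0≤square (+ n) = 0≤* {+ n} {+ n} (+≤+ z≤n) (+≤+ z≤n)
  0≤square -[1+ n ] = +≤+ z≤n

  ≤-by : ∀ {a b} d → 0ℤ ≤ d → b - a ≡ d → a ≤ b
  ≤-by d h e = 0≤i-j⇒j≤i (subst (0ℤ ≤_) (sym e) h)

  diff : ∀ {a b} → a ≤ b → 0ℤ ≤ b - a
  diff = i≤j⇒0≤j-i

  *-monoˡ-≤-0≤ : ∀ {c a b} → 0ℤ ≤ c → a ≤ b → c * a ≤ c * b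
  *-monoˡ-≤-0≤ {c} {a} {b} hc h = ≤-by (c * (b - a)) (0≤* hc (diff h)) (eq c a b)
    where
    eq : ∀ c a b → c * b - c * a ≡ c * (b - a)
    eq = solve-∀

  *-mono-≤-0≤ : ∀ {a b c d} → 0ℤ ≤ b → 0ℤ ≤ c → a ≤ b → c ≤ d → a * c ≤ b * d
  *-mono-≤-0≤ {a} {b} {c} {d} hb hc h k =
    ≤-by (b * (d - c) + (b - a) * c) (0≤+ (0≤* hb (diff k)) (0≤* (diff h) hc)) (eq a b c d)
    where
    eq : ∀ a b c d → b * d - a * c ≡ b * (d - c) + (b - a) * c
    eq = solve-∀

  0≤-cancelˡ : ∀ {c x} → 0ℤ < c → 0ℤ ≤ c * x → 0ℤ ≤ x
  0≤-cancelˡ {c} {x} hc h = *-cancelˡ-≤-pos 0ℤ x c ⦃ positive hc ⦄ (subst (_≤ c * x) (sym (*-zeroʳ c)) h)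

  sum-monoℤ : ∀ {n} {f g : Fin n → ℤ} → (∀ i → f i ≤ g i) → sum f ≤ sum g
  sum-monoℤ {zero} h = ≤-refl
  sum-monoℤ {suc n} h = +-mono-≤ (h zero) (sum-monoℤ (h ∘ suc))

  module _ {n : ℕ} where

    Kernel : Set
    Kernel = Fin n → Fin n → ℤ

    gram : List (Fin n → ℤ) → Kernel
    gram [] u v = 0ℤ
    gram (φ ∷ φs) u v = φ u * φ v + gram φs u v

    -- Positive semidefiniteness is carried by explicit integer features, so closure under sums and
    -- products is a computation. A multiple by `m` repeats the features `m` times, as `√m` need not
    -- be an integer.
    record IsGram (K : Kernel) : Set where
      constructor mkGram
      field
        features       : List (Fin n → ℤ)
        representation : ∀ u v → K u v ≡ gram features u v

    gram-resp : ∀ {K} L → (∀ u v → K u v ≡ L u v) → IsGram L → IsGram K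
    gram-resp L e (mkGram φs p) = mkGram φs λ u v → trans (e u v) (p u v)

    gram-0 : IsGram (λ _ _ → 0ℤ)
    gram-0 = mkGram [] λ _ _ → refl

    gram-rank1 : ∀ (φ : Fin n → ℤ) → IsGram (λ u v → φ u * φ v)
    gram-rank1 φ = mkGram (φ ∷ []) λ u v → sym (+-identityʳ (φ u * φ v))

    gram-+ : ∀ {K L} → IsGram K → IsGram L → IsGram (λ u v → K u v + L u v)
    gram-+ (mkGram φs p) (mkGram ψs q) =
      mkGram (φs ++ ψs) λ u v → trans (cong₂ _+_ (p u v) (q u v)) (append φs u v)
      where
      append : ∀ (φs : List (Fin n → ℤ)) u v → gram φs u v + gram ψs u v ≡ gram (φs ++ ψs) u v
      append [] u v = +-identityˡ (gram ψs u v)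
      append (φ ∷ φs) u v =
        trans (+-assoc (φ u * φ v) (gram φs u v) (gram ψs u v)) (cong (_+_ (φ u * φ v)) (append φs u v))

    gram-rank1-* : ∀ (φ : Fin n → ℤ) {K} → IsGram K → IsGram (λ u v → φ u * φ v * K u v)
    gram-rank1-* φ (mkGram ψs q) =
      mkGram (map (λ ψ u → φ u * ψ u) ψs) λ u v → trans (cong (_*_ (φ u * φ v)) (q u v)) (distrib ψs u v)
      where
      regroup : ∀ a b c d e → a * b * (c * d + e) ≡ a * c * (b * d) + a * b * e
      regroup = solve-∀
      distrib : ∀ (ψs : List (Fin n → ℤ)) u v → φ u * φ v * gram ψs u v ≡ gram (map (λ ψ u → φ u * ψ u) ψs) u v
      distrib [] u v = *-zeroʳ (φ u * φ v)
      distrib (ψ ∷ ψs) u v =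
        trans (regroup (φ u) (φ v) (ψ u) (ψ v) (gram ψs u v))
              (cong (_+_ (φ u * ψ u * (φ v * ψ v))) (distrib ψs u v))

    -- The Schur product theorem, immediate for explicit Gram representations.
    gram-* : ∀ {K L} → IsGram K → IsGram L → IsGram (λ u v → K u v * L u v)
    gram-* {K} {L} (mkGram φs p) gL =
      gram-resp (λ u v → gram φs u v * L u v) (λ u v → cong (_* L u v) (p u v)) (go φs)
      where
      go : ∀ (φs : List (Fin n → ℤ)) → IsGram (λ u v → gram φs u v * L u v)
      go [] = gram-resp (λ _ _ → 0ℤ) (λ u v → *-zeroˡ (L u v)) gram-0
      go (φ ∷ φs) =
        gram-resp (λ u v → φ u * φ v * L u v + gram φs u v * L u v)
          (λ u v → *-distribʳ-+ (L u v) (φ u * φ v) (gram φs u v))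
          (gram-+ {λ u v → φ u * φ v * L u v} {λ u v → gram φs u v * L u v} (gram-rank1-* φ gL) (go φs))

    gram-scale-ℕ : ∀ m {K} → IsGram K → IsGram (λ u v → + m * K u v)
    gram-scale-ℕ zero {K} gK = gram-resp (λ _ _ → 0ℤ) (λ u v → *-zeroˡ (K u v)) gram-0
    gram-scale-ℕ (suc m) {K} gK =
      gram-resp (λ u v → K u v + + m * K u v) (λ u v → suc-* (+ m) (K u v))
        (gram-+ {K} {λ u v → + m * K u v} gK (gram-scale-ℕ m gK))

    gram-scale : ∀ {c} → 0ℤ ≤ c → ∀ {K} → IsGram K → IsGram (λ u v → c * K u v)
    gram-scale {+ m} _ = gram-scale-ℕ m

    gram-const : ∀ {c} → 0ℤ ≤ c → IsGram (λ _ _ → c)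
    gram-const {c} h = gram-resp (λ _ _ → c * 1ℤ) (λ _ _ → sym (*-identityʳ c))
      (gram-scale h {λ _ _ → 1ℤ} (gram-rank1 (λ _ → 1ℤ)))

    gram-sum : ∀ {m} (K : Fin m → Kernel) → (∀ i → IsGram (K i)) → IsGram (λ u v → sum (λ i → K i u v))
    gram-sum {zero} K g = gram-0
    gram-sum {suc m} K g =
      gram-+ {K zero} {λ u v → sum (λ i → K (suc i) u v)} (g zero) (gram-sum (K ∘ suc) (g ∘ suc))

    gram-sum≥0 : ∀ {K} → IsGram K → 0ℤ ≤ sum (λ u → sum (λ v → K u v))
    gram-sum≥0 {K} (mkGram φs p) =
      subst (0ℤ ≤_) (sym (sum-cong-≗ (λ u → sum-cong-≗ (p u)))) (go φs)
      where
      open ≡-Reasoning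
      zeros : ∀ m → sum {m} (λ _ → 0ℤ) ≡ 0ℤ
      zeros zero = refl
      zeros (suc m) = trans (+-identityˡ _) (zeros m)
      square : ∀ (φ : Fin n → ℤ) → sum (λ u → sum (λ v → φ u * φ v)) ≡ sum φ * sum φ
      square φ = begin
        sum (λ u → sum (λ v → φ u * φ v)) ≡⟨ sum-cong-≗ (λ u → sym (*-distribˡ-sum (φ u) φ)) ⟩
        sum (λ u → φ u * sum φ) ≡⟨ sym (*-distribʳ-sum (sum φ) φ) ⟩
        sum φ * sum φ ∎
      go : ∀ (φs : List (Fin n → ℤ)) → 0ℤ ≤ sum (λ u → sum (λ v → gram φs u v))
      go [] = ≤-reflexive (sym (trans (sum-cong-≗ {n} {λ _ → sum {n} (λ _ → 0ℤ)} {λ _ → 0ℤ} (λ u → zeros n)) (zeros n)))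
      go (φ ∷ φs) = subst (0ℤ ≤_) (sym (begin
          sum (λ u → sum (λ v → φ u * φ v + gram φs u v))
            ≡⟨ sum-cong-≗ (λ u → ∑-distrib-+ (λ v → φ u * φ v) (gram φs u)) ⟩
          sum (λ u → sum (λ v → φ u * φ v) + sum (gram φs u))
            ≡⟨ ∑-distrib-+ (λ u → sum (λ v → φ u * φ v)) (λ u → sum (gram φs u)) ⟩
          sum (λ u → sum (λ v → φ u * φ v)) + sum (λ u → sum (gram φs u))
            ≡⟨ cong (_+ sum (λ u → sum (gram φs u))) (square φ) ⟩
          sum φ * sum φ + sum (λ u → sum (gram φs u)) ∎))
        (0≤+ (0≤square (sum φ)) (go φs))

  -- cheb j W z / scale j W = T_{2^j}(1 + z/W) - 1 for the Chebyshev polynomials T.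
  scale : ℕ → ℤ → ℤ
  scale zero W = W
  scale (suc j) W = scale j W * scale j W

  cheb : ℕ → ℤ → ℤ → ℤ
  cheb zero W z = z
  -- The doubling rule `T_2n = 2 T_n² - 1` written for `T - 1`: its coefficients become nonnegative,
  -- so Gram kernels are preserved.
  cheb (suc j) W z = + 2 * (cheb j W z * cheb j W z) + + 4 * scale j W * cheb j W z

  scale>0 : ∀ j {W} → 0ℤ < W → 0ℤ < scale j W
  scale>0 zero h = h
  scale>0 (suc j) h = 0<* (scale>0 j h) (scale>0 j h)

  scale≥0 : ∀ j {W} → 0ℤ < W → 0ℤ ≤ scale j W
  scale≥0 j h = <⇒≤ (scale>0 j h)

  gram-cheb : ∀ {n} j {W} → 0ℤ < W → {K : Kernel {n}} → IsGram K → IsGram (λ u v → cheb j W (K u v))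
  gram-cheb zero hW g = g
  gram-cheb (suc j) {W} hW {K} g =
    gram-+ {K = λ u v → + 2 * (H u v * H u v)} {λ u v → + 4 * scale j W * H u v}
      (gram-scale {c = + 2} (+≤+ z≤n) {λ u v → H u v * H u v} (gram-* {K = H} {H} h h))
      (gram-scale {c = + 4 * scale j W} (0≤* {+ 4} (+≤+ z≤n) (scale≥0 j hW)) {H} h)
    where
    H = λ u v → cheb j W (K u v)
    h = gram-cheb j hW {K} g

  -- Here `1 + z / W` lies in `[-1, 1]`, where every Chebyshev polynomial has values in `[-1, 1]`.
  cheb-neg : ∀ j {W z} → 0ℤ < W → - (+ 2 * W) ≤ z → z ≤ 0ℤ →
    - (+ 2 * scale j W) ≤ cheb j W z × cheb j W z ≤ 0ℤ
  cheb-neg zero hW lo hi = lo , hi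
  cheb-neg (suc j) {W} {z} hW lo hi with cheb j W z | scale j W | cheb-neg j hW lo hi
  ... | h | s | lo' , hi' =
    ≤-by (+ 2 * ((h + s) * (h + s))) (0≤* {+ 2} (+≤+ z≤n) (0≤square (h + s))) (eq₁ h s) ,
    ≤-by (+ 2 * ((0ℤ - h) * (h - - (+ 2 * s)))) (0≤* {+ 2} (+≤+ z≤n) (0≤* (diff hi') (diff lo'))) (eq₂ h s)
    where
    eq₁ : ∀ h s → + 2 * (h * h) + + 4 * s * h - (- (+ 2 * (s * s))) ≡ + 2 * ((h + s) * (h + s))
    eq₁ = solve-∀
    eq₂ : ∀ h s → + 0 - (+ 2 * (h * h) + + 4 * s * h) ≡ + 2 * ((+ 0 - h) * (h - - (+ 2 * s)))
    eq₂ = solve-∀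

  cheb-nonneg : ∀ j {W z} → 0ℤ < W → 0ℤ ≤ z → 0ℤ ≤ cheb j W z
  cheb-nonneg zero hW hz = hz
  cheb-nonneg (suc j) hW hz =
    0≤+ (0≤* {+ 2} (+≤+ z≤n) (0≤* ih ih)) (0≤* (0≤* {+ 4} (+≤+ z≤n) (scale≥0 j hW)) ih)
    where ih = cheb-nonneg j hW hz

  4^ : ℕ → ℤ
  4^ zero = 1ℤ
  4^ (suc j) = + 4 * 4^ j

  4^≡ : ∀ j → 4^ j ≡ + (4 ℕ.^ j)
  4^≡ zero = refl
  4^≡ (suc j) = trans (cong (+ 4 *_) (4^≡ j)) (sym (pos-* 4 (4 ℕ.^ j)))

  0<4^ : ∀ j → 0ℤ < 4^ j
  0<4^ j rewrite 4^≡ j = +<+ (ℕ.m^n>0 4 j)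

  -- The slope `4^ j` is the derivative of `T_{2^j}` at `1`; the square in the recursion only helps.
  cheb-growth : ∀ j {W z} → 0ℤ < W → 0ℤ ≤ z → 4^ j * z * scale j W ≤ cheb j W z * W
  cheb-growth zero {W} {z} hW hz = ≤-reflexive (cong (_* W) (*-identityˡ z))
  cheb-growth (suc j) {W} {z} hW hz
    with cheb j W z | scale j W | cheb-nonneg j hW hz | scale≥0 j hW | cheb-growth j {W} {z} hW hz
  ... | h | s | h≥0 | s≥0 | ih =
    ≤-by (+ 2 * (h * h * W) + + 4 * s * (h * W - 4^ j * z * s))
      (0≤+ (0≤* {+ 2} (+≤+ z≤n) (0≤* (0≤* h≥0 h≥0) (<⇒≤ hW))) (0≤* (0≤* {+ 4} (+≤+ z≤n) s≥0) (diff ih)))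
      (eq h s W z (4^ j))
    where
    eq : ∀ h s W z p → (+ 2 * (h * h) + + 4 * s * h) * W - + 4 * p * z * (s * s)
       ≡ + 2 * (h * h * W) + + 4 * s * (h * W - p * z * s)
    eq = solve-∀

  -- 1 / chebRadius n is small enough that T_{2^n}(1 + y) ≤ 2 for y ≤ 1 / chebRadius n.
  chebRadius : ℕ → ℤ
  chebRadius zero = 1ℤ
  chebRadius (suc n) = + 4 * chebRadius n + + 2

  chebRadius≥0 : ∀ n → 0ℤ ≤ chebRadius n
  chebRadius≥0 zero = +≤+ z≤n
  chebRadius≥0 (suc n) = 0≤+ (0≤* {+ 4} (+≤+ z≤n) (chebRadius≥0 n)) (+≤+ z≤n)

  chebRadius≤ : ∀ n → chebRadius n ≤ + 2 * 4^ n
  chebRadius≤ n = ≤-by (+ 2 * 4^ n - (chebRadius n + 1ℤ) + 1ℤ) (0≤+ (diff (strong n)) (+≤+ z≤n)) (eq (+ 2 * 4^ n) (chebRadius n))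
    where
    eq : ∀ a b → a - b ≡ a - (b + + 1) + + 1
    eq = solve-∀
    eq' : ∀ a b → + 2 * (+ 4 * a) - ((+ 4 * b + + 2) + + 1) ≡ + 4 * (+ 2 * a - (b + + 1)) + + 1
    eq' = solve-∀
    -- The bound `2 * 4^ n` itself is not stable under `x ↦ 4x + 2`; lowered by one it is.
    strong : ∀ n → chebRadius n + 1ℤ ≤ + 2 * 4^ n
    strong zero = ≤-refl
    strong (suc n) =
      ≤-by (+ 4 * (+ 2 * 4^ n - (chebRadius n + 1ℤ)) + 1ℤ) (0≤+ (0≤* {+ 4} (+≤+ z≤n) (diff (strong n))) (+≤+ z≤n)) (eq' (4^ n) (chebRadius n))

  -- From `h * (4b + 2) ≤ 1` follows `(2h² + 4h) * b ≤ 1`, so each of the `i` doublings uses up one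
  -- step of `chebRadius`.
  cheb-small : ∀ i n {W z} → 0ℤ < W → 0ℤ ≤ z → z * chebRadius (i ℕ.+ n) ≤ W →
    cheb i W z * chebRadius n ≤ scale i W
  cheb-small zero n hW hz h = h
  cheb-small (suc i) n {W} {z} hW hz h
    with cheb i W z | scale i W | cheb-nonneg i hW hz | chebRadius n | chebRadius≥0 n
       | cheb-small i (suc n) {W} {z} hW hz (subst (λ k → z * chebRadius k ≤ W) (sym (ℕ.+-suc i n)) h)
  ... | x | s | x≥0 | b | b≥0 | ih =
    ≤-by ((s - x * (+ 4 * b + + 2)) * (s + + 2 * x) + + 2 * (x * x) * (+ 3 * b + + 2))
      (0≤+ (0≤* (diff ih) (0≤+ s≥0 (0≤* {+ 2} (+≤+ z≤n) x≥0)))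
           (0≤* (0≤* {+ 2} (+≤+ z≤n) (0≤* x≥0 x≥0)) (0≤+ (0≤* {+ 3} (+≤+ z≤n) b≥0) (+≤+ z≤n))))
      (eq x s b)
    where
    s≥0 : 0ℤ ≤ s
    s≥0 = ≤-trans (0≤* x≥0 (0≤+ (0≤* {+ 4} (+≤+ z≤n) b≥0) (+≤+ z≤n))) ih
    eq : ∀ x s b → s * s - (+ 2 * (x * x) + + 4 * s * x) * b ≡ (s - x * (+ 4 * b + + 2)) * (s + + 2 * x) + + 2 * (x * x) * (+ 3 * b + + 2)
    eq = solve-∀

  -- chebGrowth l ≥ T_{2^l}(2)
  chebGrowth : ℕ → ℤ
  chebGrowth zero = + 2
  chebGrowth (suc l) = + 2 * (chebGrowth l * chebGrowth l)

  -- `T_{2^(l+i)}` is `T_{2^l}` composed with `T_{2^i}`, and the latter is at most `2` by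
  -- hypothesis.
  cheb-large : ∀ l i {W z} → 0ℤ < W → 0ℤ ≤ z → cheb i W z ≤ scale i W →
    cheb (l ℕ.+ i) W z ≤ scale (l ℕ.+ i) W * (chebGrowth l - 1ℤ)
  cheb-large zero i {W} {z} hW hz h = ≤-trans h (≤-reflexive (sym (*-identityʳ _)))
  cheb-large (suc l) i {W} {z} hW hz h
    with cheb (l ℕ.+ i) W z | scale (l ℕ.+ i) W | cheb-nonneg (l ℕ.+ i) hW hz | scale≥0 (l ℕ.+ i) hW | chebGrowth l | cheb-large l i {W} {z} hW hz h
  ... | x | s | x≥0 | s≥0 | t | ih =
    ≤-by (+ 2 * ((s * (t - 1ℤ) - x) * (s * (t - 1ℤ) + x)) + + 4 * s * (s * (t - 1ℤ) - x) + s * s)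
      (0≤+ (0≤+ (0≤* {+ 2} (+≤+ z≤n) (0≤* (diff ih) (0≤+ (≤-trans x≥0 ih) x≥0)))
                (0≤* (0≤* {+ 4} (+≤+ z≤n) s≥0) (diff ih)))
           (0≤square s))
      (eq x s t)
    where
    eq : ∀ x s t → s * s * (+ 2 * (t * t) - + 1) - (+ 2 * (x * x) + + 4 * s * x)
       ≡ + 2 * ((s * (t - + 1) - x) * (s * (t - + 1) + x)) + + 4 * s * (s * (t - + 1) - x) + s * s
    eq = solve-∀

  chebGrowth≥2 : ∀ l → + 2 ≤ chebGrowth l
  chebGrowth≥2 zero = ≤-refl
  chebGrowth≥2 (suc l) =
    ≤-by (+ 2 * ((chebGrowth l - + 2) * (chebGrowth l + + 2)) + + 6)
      (0≤+ (0≤* {+ 2} (+≤+ z≤n) (0≤* (diff ih) (0≤+ (≤-trans (+≤+ z≤n) ih) (+≤+ z≤n)))) (+≤+ z≤n))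
      (eq (chebGrowth l))
    where
    ih = chebGrowth≥2 l
    eq : ∀ t → + 2 * (t * t) - + 2 ≡ + 2 * ((t - + 2) * (t + + 2)) + + 6
    eq = solve-∀

  -- z / w is an inner product measured in units in which cheb has 4^J for its scale.
  module Coordinate (J : ℕ) (w : ℤ) (w>0 : 0ℤ < w) where

    W : ℤ
    W = 4^ J * w

    W>0 : 0ℤ < W
    W>0 = 0<* (0<4^ J) w>0

    c : ℤ
    c = scale J W

    c>0 : 0ℤ < c
    c>0 = scale>0 J W>0

    -- In units of `c` this is `3 + (T_{2^J}(1 + z/W) - 1)`. The `3` keeps it at least `1` although
    -- the bracket can reach `-2`.
    g : ℤ → ℤ
    g z = + 3 * c + cheb J W z

    c≤g : ∀ z → - (+ 2 * W) ≤ z → c ≤ g z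
    c≤g z lo with ≤-total 0ℤ z
    ... | inj₁ hz = ≤-by (+ 2 * c + cheb J W z) (0≤+ (0≤* {+ 2} (+≤+ z≤n) (<⇒≤ c>0)) (cheb-nonneg J W>0 hz)) (eq c (cheb J W z))
      where
      eq : ∀ c x → + 3 * c + x - c ≡ + 2 * c + x
      eq = solve-∀
    ... | inj₂ hz = ≤-by (cheb J W z - - (+ 2 * c)) (diff (proj₁ (cheb-neg J W>0 lo hz))) (eq c (cheb J W z))
      where
      eq : ∀ c x → + 3 * c + x - c ≡ x - - (+ 2 * c)
      eq = solve-∀

    0≤g : ∀ z → - (+ 2 * W) ≤ z → 0ℤ ≤ g z
    0≤g z lo = ≤-trans (<⇒≤ c>0) (c≤g z lo)

    -- For `z ≥ 0`, the linear lower bound on `cheb` has slope `4^J / W = 1 / w`, which is why `W`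
    -- contains the factor `4^ J`.
    zc≤wg : ∀ z → - (+ 2 * W) ≤ z → z * c ≤ w * g z
    zc≤wg z lo with ≤-total 0ℤ z
    ... | inj₂ hz = ≤-by (w * g z + (0ℤ - z) * c) (0≤+ (0≤* (<⇒≤ w>0) (0≤g z lo)) (0≤* (diff hz) (<⇒≤ c>0))) (eq z c (w * g z))
      where
      eq : ∀ z c x → x - z * c ≡ x + (+ 0 - z) * c
      eq = solve-∀
    ... | inj₁ hz = ≤-by (+ 3 * (w * c) + (cheb J W z * w - z * c))
        (0≤+ (0≤* {+ 3} (+≤+ z≤n) (0≤* (<⇒≤ w>0) (<⇒≤ c>0))) (diff small)) (eq z c w (cheb J W z))
      where
      eq : ∀ z c w x → w * (+ 3 * c + x) - z * c ≡ + 3 * (w * c) + (x * w - z * c)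
      eq = solve-∀
      eq₁ : ∀ p x w → x * (p * w) ≡ p * (x * w)
      eq₁ = solve-∀
      small : z * c ≤ cheb J W z * w
      small = *-cancelˡ-≤-pos (z * c) (cheb J W z * w) (4^ J) ⦃ positive (0<4^ J) ⦄
        (subst₂ _≤_ (*-assoc (4^ J) z c) (eq₁ (4^ J) (cheb J W z) w) (cheb-growth J W>0 hz))

    -- On the negative range `g` is at most `3 * c`; this is the `3` in the threshold.
    bad⇒ : ∀ m z → - (+ 2 * W) ≤ z → z ≤ - (+ 3 * + m * w) → z * c ≤ - (+ m * w * g z)
    bad⇒ m z lo hi = ≤-by ((- (+ 3 * + m * w) - z) * c + + m * w * (0ℤ - cheb J W z))
      (0≤+ (0≤* (diff hi) (<⇒≤ c>0)) (0≤* (0≤* {+ m} (+≤+ z≤n) (<⇒≤ w>0)) (diff (proj₂ (cheb-neg J W>0 lo z≤0)))))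
      (eq (+ m) w z c (cheb J W z))
      where
      z≤0 : z ≤ 0ℤ
      z≤0 = ≤-trans hi (≤-by (+ 3 * + m * w) (0≤* (0≤* {+ 3} {+ m} (+≤+ z≤n) (+≤+ z≤n)) (<⇒≤ w>0)) (eq' (+ 3 * + m * w)))
        where
        eq' : ∀ x → + 0 - - x ≡ x
        eq' = solve-∀
      eq : ∀ m w z c x → - (m * w * (+ 3 * c + x)) - z * c ≡ (- (+ 3 * m * w) - z) * c + m * w * (+ 0 - x)
      eq = solve-∀

    -- `T_{2^J}` is split as `T_{2^l}` after `T_{2^(J-l)}`. The inner polynomial is still at most
    -- `2` at this `z`, so the bound depends on the level `l` and not on the degree `J`.
    g-bound : ∀ l → l ℕ.≤ J → ∀ z → - (+ 2 * W) ≤ z → + 2 * z ≤ 4^ l * w → g z ≤ c * (+ 2 + chebGrowth l)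
    g-bound l l≤J z lo hi with ≤-total 0ℤ z
    ... | inj₂ hz = ≤-by (c * (chebGrowth l - + 2) + c + (0ℤ - cheb J W z))
        (0≤+ (0≤+ (0≤* (<⇒≤ c>0) (diff (chebGrowth≥2 l))) (<⇒≤ c>0)) (diff (proj₂ (cheb-neg J W>0 lo hz))))
        (eq c (chebGrowth l) (cheb J W z))
      where
      eq : ∀ c t x → c * (+ 2 + t) - (+ 3 * c + x) ≡ c * (t - + 2) + c + (+ 0 - x)
      eq = solve-∀
    ... | inj₁ hz = ≤-by (c * (chebGrowth l - 1ℤ) - cheb J W z) (diff large) (eq c (chebGrowth l) (cheb J W z))
      where
      eq : ∀ c t x → c * (+ 2 + t) - (+ 3 * c + x) ≡ c * (t - + 1) - x
      eq = solve-∀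
      i = J ℕ.∸ l
      l+i : l ℕ.+ i ≡ J
      l+i = ℕ.m+[n∸m]≡n l≤J
      4^-+ : ∀ i l → 4^ (l ℕ.+ i) ≡ 4^ l * 4^ i
      4^-+ i zero = sym (*-identityˡ _)
      4^-+ i (suc l) = trans (cong (+ 4 *_) (4^-+ i l)) (sym (*-assoc (+ 4) (4^ l) (4^ i)))
      radius : z * chebRadius (i ℕ.+ 0) ≤ W
      radius = subst₂ (λ k x → z * chebRadius k ≤ x * w) (sym (ℕ.+-identityʳ i)) (trans (sym (4^-+ i l)) (cong 4^ l+i))
        (≤-trans (*-monoˡ-≤-0≤ hz (chebRadius≤ i))
          (≤-by (4^ i * (4^ l * w - + 2 * z)) (0≤* (<⇒≤ (0<4^ i)) (diff hi)) (eq' (4^ l) (4^ i) z w)))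
        where
        eq' : ∀ a b z w → a * b * w - z * (+ 2 * b) ≡ b * (a * w - + 2 * z)
        eq' = solve-∀
      large : cheb J W z ≤ c * (chebGrowth l - 1ℤ)
      large = subst (λ k → cheb k W z ≤ scale k W * (chebGrowth l - 1ℤ)) l+i
        (cheb-large l i W>0 hz (≤-trans (≤-reflexive (sym (*-identityʳ _))) (cheb-small i 0 W>0 hz radius)))

-- The correlation inequality for several Gram kernels at once.

module Correlations where

  open Cliques
  open Pigeonhole
  open GramKernels
  open import Data.Integer hiding (suc; pred)
  open import Data.Integer.Properties
  open import Data.Integer.Tactic.RingSolver using (solve-∀)
  open import Data.Nat as ℕ using (ℕ; zero; suc; z≤n; s≤s)
  import Data.Nat.Properties as ℕ
  open import Algebra.Properties.Semiring.Sum +-*-semiring using (sum; sum-cong-≗; ∑-distrib-+; *-distribˡ-sum; *-distribʳ-sum)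
  open import Algebra.Properties.Semiring.Sum ℕ.+-*-semiring using () renaming (sum to sumℕ)
  import Algebra.Properties.Semiring.Sum ℕ.+-*-semiring as ℕΣ

  prodℤ : ∀ {r} → (Fin r → ℤ) → ℤ
  prodℤ {zero} g = 1ℤ
  prodℤ {suc r} g = g zero * prodℤ (g ∘ suc)

  -- Σ_j z_j Π_{i≠j} g_i
  cofactorSum : ∀ {r} → (Fin r → ℤ) → (Fin r → ℤ) → ℤ
  cofactorSum {zero} z g = 0ℤ
  cofactorSum {suc r} z g = z zero * prodℤ (g ∘ suc) + g zero * cofactorSum (z ∘ suc) (g ∘ suc)

  gram-prod : ∀ {n r} (K : Fin r → Kernel {n}) → (∀ i → IsGram (K i)) → IsGram (λ u v → prodℤ (λ i → K i u v))
  gram-prod {r = zero} K h = gram-const {c = 1ℤ} (+≤+ z≤n)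
  gram-prod {r = suc r} K h =
    gram-* {K = K zero} {λ u v → prodℤ (λ i → K (suc i) u v)} (h zero) (gram-prod (K ∘ suc) (h ∘ suc))

  gram-cofactorSum : ∀ {n r} (K L : Fin r → Kernel {n}) → (∀ i → IsGram (K i)) → (∀ i → IsGram (L i)) →
    IsGram (λ u v → cofactorSum (λ i → K i u v) (λ i → L i u v))
  gram-cofactorSum {r = zero} K L h k = gram-0
  gram-cofactorSum {r = suc r} K L h k =
    gram-+ {K = λ u v → K zero u v * P u v} {λ u v → L zero u v * S u v}
      (gram-* {K = K zero} {P} (h zero) (gram-prod (L ∘ suc) (k ∘ suc)))
      (gram-* {K = L zero} {S} (k zero) (gram-cofactorSum (K ∘ suc) (L ∘ suc) (h ∘ suc) (k ∘ suc)))
    where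
    P = λ u v → prodℤ (λ i → L (suc i) u v)
    S = λ u v → cofactorSum (λ i → K (suc i) u v) (λ i → L (suc i) u v)

  prodℤ≥0 : ∀ {r} (g : Fin r → ℤ) → (∀ i → 0ℤ ≤ g i) → 0ℤ ≤ prodℤ g
  prodℤ≥0 {zero} g h = +≤+ z≤n
  prodℤ≥0 {suc r} g h = 0≤* (h zero) (prodℤ≥0 (g ∘ suc) (h ∘ suc))

  prodℤ-mono : ∀ {r} (f g : Fin r → ℤ) → (∀ i → 0ℤ ≤ f i) → (∀ i → f i ≤ g i) → prodℤ f ≤ prodℤ g
  prodℤ-mono {zero} f g h k = ≤-refl
  prodℤ-mono {suc r} f g h k =
    *-mono-≤-0≤ (≤-trans (h zero) (k zero)) (prodℤ≥0 (f ∘ suc) (h ∘ suc)) (k zero)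
      (prodℤ-mono (f ∘ suc) (g ∘ suc) (h ∘ suc) (k ∘ suc))

  pow : ℤ → ℕ → ℤ
  pow c r = prodℤ {r} (λ _ → c)

  pow-* : ∀ c b r → pow (c * b) r ≡ pow c r * pow b r
  pow-* c b zero = refl
  pow-* c b (suc r) = trans (cong (c * b *_) (pow-* c b r)) (eq c b (pow c r) (pow b r))
    where
    eq : ∀ c b x y → c * b * (x * y) ≡ c * x * (b * y)
    eq = solve-∀

  pow>0 : ∀ {c} → 0ℤ < c → ∀ r → 0ℤ < pow c r
  pow>0 h zero = +<+ (s≤s z≤n)
  pow>0 h (suc r) = 0<* h (pow>0 h r)

  module _ (c w : ℤ) (w≥0 : 0ℤ ≤ w) where

    -- Relative to the full product, each of the `r` terms is `z i / g i`, hence at most `w / c`.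
    cofactorSum-≤ : ∀ {r} (z g : Fin r → ℤ) → (∀ i → 0ℤ ≤ g i) → (∀ i → z i * c ≤ w * g i) →
      c * cofactorSum z g ≤ + r * w * prodℤ g
    cofactorSum-≤ {zero} z g g≥0 h = ≤-reflexive (*-zeroʳ c)
    cofactorSum-≤ {suc r} z g g≥0 h =
      ≤-by ((w * g zero - z zero * c) * P + g zero * (+ r * w * P - c * S))
        (0≤+ (0≤* (diff (h zero)) (prodℤ≥0 (g ∘ suc) (g≥0 ∘ suc)))
             (0≤* (g≥0 zero) (diff (cofactorSum-≤ (z ∘ suc) (g ∘ suc) (g≥0 ∘ suc) (h ∘ suc)))))
        (eq (+ r) w c (z zero) (g zero) P S)
      where
      P = prodℤ (g ∘ suc)
      S = cofactorSum (z ∘ suc) (g ∘ suc)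
      eq : ∀ r w c z g P S → (+ 1 + r) * w * (g * P) - c * (z * P + g * S)
         ≡ (w * g - z * c) * P + g * (r * w * P - c * S)
      eq = solve-∀

    -- The term of colour `i` counts `-m` instead of `1`, which frees `m + 1` units.
    cofactorSum-neg : ∀ {r} m (z g : Fin r → ℤ) → (∀ i → 0ℤ ≤ g i) → (∀ i → z i * c ≤ w * g i) →
      (i : Fin r) → z i * c ≤ - (m * w * g i) →
      c * cofactorSum z g + (m + 1ℤ) * w * prodℤ g ≤ + r * w * prodℤ g
    cofactorSum-neg {suc r} m z g g≥0 h zero hi =
      ≤-by ((- (m * w * g zero) - z zero * c) * P + g zero * (+ r * w * P - c * S))
        (0≤+ (0≤* (diff hi) (prodℤ≥0 (g ∘ suc) (g≥0 ∘ suc)))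
             (0≤* (g≥0 zero) (diff (cofactorSum-≤ (z ∘ suc) (g ∘ suc) (g≥0 ∘ suc) (h ∘ suc)))))
        (eq (+ r) m w c (z zero) (g zero) P S)
      where
      P = prodℤ (g ∘ suc)
      S = cofactorSum (z ∘ suc) (g ∘ suc)
      eq : ∀ r m w c z g P S → (+ 1 + r) * w * (g * P) - (c * (z * P + g * S) + (m + + 1) * w * (g * P))
         ≡ (- (m * w * g) - z * c) * P + g * (r * w * P - c * S)
      eq = solve-∀
    cofactorSum-neg {suc r} m z g g≥0 h (suc i) hi =
      ≤-by ((w * g zero - z zero * c) * P + g zero * (+ r * w * P - (c * S + (m + 1ℤ) * w * P)))
        (0≤+ (0≤* (diff (h zero)) (prodℤ≥0 (g ∘ suc) (g≥0 ∘ suc)))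
             (0≤* (g≥0 zero) (diff (cofactorSum-neg m (z ∘ suc) (g ∘ suc) (g≥0 ∘ suc) (h ∘ suc) i hi))))
        (eq (+ r) m w c (z zero) (g zero) P S)
      where
      P = prodℤ (g ∘ suc)
      S = cofactorSum (z ∘ suc) (g ∘ suc)
      eq : ∀ r m w c z g P S → (+ 1 + r) * w * (g * P) - (c * (z * P + g * S) + (m + + 1) * w * (g * P))
         ≡ (w * g - z * c) * P + g * (r * w * P - (c * S + (m + + 1) * w * P))
      eq = solve-∀

  sum-+ℕ : ∀ {n} (f : Fin n → ℕ) → sum (λ i → + f i) ≡ + sumℕ f
  sum-+ℕ {zero} f = refl
  sum-+ℕ {suc n} f = trans (cong (_+_ (+ f zero)) (sum-+ℕ (f ∘ suc))) (sym (pos-+ (f zero) _))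

  sum²-+ℕ : ∀ {n} (f : Fin n → Fin n → ℕ) → sum (λ u → sum (λ v → + f u v)) ≡ + sumℕ (λ u → sumℕ (f u))
  sum²-+ℕ f = trans (sum-cong-≗ (λ u → sum-+ℕ (f u))) (sum-+ℕ (λ u → sumℕ (f u)))

  -- This is `2 ^ (2 ^ (l + 1) - 1)`: exponential in the square root of the threshold `4 ^ l`.
  growth : ℕ → ℕ
  growth zero = 2
  growth (suc l) = 2 ℕ.* (growth l ℕ.* growth l)

  growth≡ : ∀ l → chebGrowth l ≡ + growth l
  growth≡ zero = refl
  growth≡ (suc l) = begin
    + 2 * (chebGrowth l * chebGrowth l) ≡⟨ cong (λ x → + 2 * (x * x)) (growth≡ l) ⟩
    + 2 * (+ growth l * + growth l) ≡⟨ cong (+ 2 *_) (sym (pos-* (growth l) (growth l))) ⟩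
    + 2 * + (growth l ℕ.* growth l) ≡⟨ sym (pos-* 2 (growth l ℕ.* growth l)) ⟩
    + growth (suc l) ∎
    where open ≡-Reasoning

  pow-ℕ : ∀ b r → pow (+ b) r ≡ + (b ℕ.^ r)
  pow-ℕ b zero = refl
  pow-ℕ b (suc r) = trans (cong (+ b *_) (pow-ℕ b r)) (sym (pos-* b (b ℕ.^ r)))

  bound : ℕ → ℕ → ℕ
  bound r l = r ℕ.* (2 ℕ.+ growth l) ℕ.^ r

  module Correlation {n r : ℕ} (a D : ℕ) (X : VSet n) (w : ℤ) (w>0 : 0ℤ < w)
    (z : Fin r → Kernel {n}) (gram-z : ∀ i → IsGram (z i))
    (z-lower : ∀ i u v → u ∈ X → v ∈ X → - (+ 2 * (4^ (a ℕ.+ D) * w)) ≤ z i u v)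
    (z-upper : ∀ i u v → u ∈ X → v ∈ X → + 2 * z i u v ≤ 4^ (a ℕ.+ D) * w) where

    open Coordinate (a ℕ.+ D) w w>0

    good : Fin n → Fin n → Bool
    good u v = X u ∧ (X v ∧ does (Fin.all? (λ i → - (+ 3 * + r * w) <? z i u v)))

    exceeds : ℕ → Fin r → Fin n → Fin n → Bool
    exceeds d i u v = good u v ∧ does (4^ (a ℕ.+ d) * w <? + 2 * z i u v)

    -- A pair charged at level `d` stays below level `d + 1` in every colour, hence the shifted
    -- index.
    levelBound : ℕ → ℕ
    levelBound zero = bound r a
    levelBound (suc d) = bound r (suc (a ℕ.+ d))

    open Levels good exceeds levelBound

    private
      f : Kernel {n}
      f u v = cofactorSum (λ i → z i u v) (λ i → g (z i u v))

      M : ℤ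
      M = w * pow c r

      M>0 : 0ℤ < M
      M>0 = 0<* w>0 (pow>0 c>0 r)

      gram-f : IsGram (λ u v → c * f u v)
      gram-f = gram-scale (<⇒≤ c>0) {f} (gram-cofactorSum z (λ i u v → g (z i u v)) gram-z
        (λ i → gram-+ {K = λ _ _ → + 3 * c} {λ u v → cheb (a ℕ.+ D) W (z i u v)}
          (gram-const {c = + 3 * c} (0≤* {+ 3} (+≤+ z≤n) (<⇒≤ c>0))) (gram-cheb (a ℕ.+ D) W>0 {z i} (gram-z i))))

      module Pair {u v} (u∈X : u ∈ X) (v∈X : v ∈ X) where

        zs gs : Fin r → ℤ
        zs i = z i u v
        gs i = g (zs i)

        lo : ∀ i → - (+ 2 * W) ≤ zs i
        lo i = z-lower i u v u∈X v∈X

        G : ℤ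
        G = prodℤ gs

        c^r≤G : pow c r ≤ G
        c^r≤G = prodℤ-mono (λ _ → c) gs (λ _ → <⇒≤ c>0) (λ i → c≤g (zs i) (lo i))

        -- Below the threshold `-3rw` one colour counts `-r`, while the others count at most `r - 1`
        -- together. The total is at most `-1` in units of `w * G`, and `G ≥ c^r`.
        f-neg : (i : Fin r) → zs i ≤ - (+ 3 * + r * w) → c * f u v + M ≤ 0ℤ
        f-neg i hi = ≤-by ((+ r * w * G - (c * f u v + (+ r + 1ℤ) * w * G)) + w * (G - pow c r))
          (0≤+ (diff (cofactorSum-neg c w (<⇒≤ w>0) (+ r) zs gs (λ i → 0≤g (zs i) (lo i)) (λ i → zc≤wg (zs i) (lo i))
                       i (bad⇒ r (zs i) (lo i) hi)))
               (0≤* (<⇒≤ w>0) (diff c^r≤G)))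
          (eq c (f u v) w (pow c r) (+ r) G)
          where
          eq : ∀ c f w p r G → + 0 - (c * f + w * p) ≡ (r * w * G - (c * f + (r + + 1) * w * G)) + w * (G - p)
          eq = solve-∀

        f-level : ∀ l → l ℕ.≤ a ℕ.+ D → (∀ i → + 2 * zs i ≤ 4^ l * w) → c * f u v ≤ M * + bound r l
        f-level l l≤ h = ≤-trans
          (cofactorSum-≤ c w (<⇒≤ w>0) zs gs (λ i → 0≤g (zs i) (lo i)) (λ i → zc≤wg (zs i) (lo i)))
          (≤-trans (*-monoˡ-≤-0≤ (0≤* {+ r} (+≤+ z≤n) (<⇒≤ w>0))
                     (prodℤ-mono gs (λ _ → c * (+ 2 + chebGrowth l)) (λ i → 0≤g (zs i) (lo i))
                       (λ i → g-bound l l≤ (zs i) (lo i) (h i))))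
                   (≤-reflexive bound≡))
          where
          eq : ∀ r w p b → r * w * (p * b) ≡ w * p * (r * b)
          eq = solve-∀
          bound≡ : + r * w * pow (c * (+ 2 + chebGrowth l)) r ≡ M * + bound r l
          bound≡ = begin
            + r * w * pow (c * (+ 2 + chebGrowth l)) r ≡⟨ cong (λ x → + r * w * pow (c * (+ 2 + x)) r) (growth≡ l) ⟩
            + r * w * pow (c * + (2 ℕ.+ growth l)) r ≡⟨ cong (+ r * w *_) (pow-* c (+ (2 ℕ.+ growth l)) r) ⟩
            + r * w * (pow c r * pow (+ (2 ℕ.+ growth l)) r) ≡⟨ cong (λ x → + r * w * (pow c r * x)) (pow-ℕ (2 ℕ.+ growth l) r) ⟩
            + r * w * (pow c r * + ((2 ℕ.+ growth l) ℕ.^ r)) ≡⟨ eq (+ r) w (pow c r) _ ⟩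
            M * (+ r * + ((2 ℕ.+ growth l) ℕ.^ r)) ≡⟨ cong (M *_) (sym (pos-* r _)) ⟩
            M * + bound r l ∎
            where open ≡-Reasoning

        -- Descends from the top level to the highest one that some colour exceeds; there the charge
        -- of that colour covers the pair.
        f-dominant : good u v ≡ true → ∀ d → d ℕ.≤ D → (∀ i → + 2 * zs i ≤ 4^ (a ℕ.+ d) * w) → c * f u v ≤ M * + dominant d u v
        f-dominant gd zero d≤D h rewrite gd | ℕ.*-identityʳ (bound r a) =
          f-level a (ℕ.m≤m+n a D) (λ i → subst (λ k → + 2 * zs i ≤ 4^ k * w) (ℕ.+-identityʳ a) (h i))
        f-dominant gd (suc d) d<D h with Fin.any? (λ i → 4^ (a ℕ.+ d) * w <? + 2 * zs i)
        ... | yes (i , hi) = ≤-trans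
                (f-level (suc (a ℕ.+ d)) (subst (ℕ._≤ a ℕ.+ D) (ℕ.+-suc a d) (ℕ.+-monoʳ-≤ a d<D))
                  (λ i → subst (λ k → + 2 * zs i ≤ 4^ k * w) (ℕ.+-suc a d) (h i)))
                (*-monoˡ-≤-0≤ (<⇒≤ M>0) (+≤+ (ℕ.≤-trans
                  (subst (ℕ._≤ bound r (suc (a ℕ.+ d)) ℕ.* sumℕ (λ i → 𝟙 (exceeds d i u v))) (ℕ.*-identityʳ _)
                    (ℕ.*-monoʳ-≤ (bound r (suc (a ℕ.+ d)))
                      (ℕ.≤-trans (ℕ.≤-reflexive (sym (cong 𝟙 (∧-intro {good u v} gd (true-does (4^ (a ℕ.+ d) * w <? + 2 * zs i) hi)))))
                        (term≤sum (λ i → 𝟙 (exceeds d i u v)) i))))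
                  (ℕ.m≤m+n _ _))))
        ... | no none = ≤-trans
                (f-dominant gd d (ℕ.<⇒≤ d<D) (λ i → ≮⇒≥ (λ lt → none (i , lt))))
                (*-monoˡ-≤-0≤ (<⇒≤ M>0) (+≤+ (ℕ.m≤n+m _ _)))

      χ : Fin n → ℤ
      χ u = + 𝟙 (X u)

      -- The extra `M` on each pair of `X` turns nonnegativity of the kernel sum into a count: a bad
      -- pair absorbs its `M`, so the good pairs and their charges must make up for all
      -- `card X * card X` pairs. The rank-one factor `χ u * χ v` restricts to `X` within Gram
      -- kernels.
      pointwise : ∀ u v → χ u * χ v * (c * f u v) + M * + (𝟙 (X u) ℕ.* 𝟙 (X v)) ≤ M * + (𝟙 (good u v) ℕ.+ dominant D u v)
      pointwise u v = go (X u) (X v) refl refl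
        where
        rhs≥0 : 0ℤ ≤ M * + (𝟙 (good u v) ℕ.+ dominant D u v)
        rhs≥0 = 0≤* (<⇒≤ M>0) (+≤+ z≤n)
        eq₀ : ∀ x y → x * + 0 * y ≡ + 0
        eq₀ = solve-∀
        eq₁ : ∀ x M → + 1 * + 1 * x + M * + 1 ≡ x + M
        eq₁ = solve-∀
        eq₂ : ∀ M d → M * (+ 1 + d) ≡ M * d + M
        eq₂ = solve-∀
        go : ∀ b b' → X u ≡ b → X v ≡ b' →
          + 𝟙 b * + 𝟙 b' * (c * f u v) + M * + (𝟙 b ℕ.* 𝟙 b') ≤ M * + (𝟙 (good u v) ℕ.+ dominant D u v)
        go false b' _ _ = ≤-trans (≤-reflexive (cong₂ _+_ (eq₀ 1ℤ (c * f u v)) (*-zeroʳ M))) rhs≥0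
        go true false _ _ = ≤-trans (≤-reflexive (cong₂ _+_ (eq₀ 1ℤ (c * f u v)) (*-zeroʳ M))) rhs≥0
        go true true u∈X v∈X = ≤-trans (≤-reflexive (eq₁ (c * f u v) M)) main
          where
          open Pair u∈X v∈X
          main : c * f u v + M ≤ M * + (𝟙 (good u v) ℕ.+ dominant D u v)
          main with Fin.all? (λ i → - (+ 3 * + r * w) <? zs i) in all≡
          ... | yes _ = subst (λ b → c * f u v + M ≤ M * + (𝟙 b ℕ.+ dominant D u v)) (sym gd)
                  (≤-trans (+-monoˡ-≤ M (f-dominant gd D ℕ.≤-refl (λ i → z-upper i u v u∈X v∈X)))
                           (≤-reflexive (sym (eq₂ M (+ dominant D u v)))))
            where
            gd : good u v ≡ true
            gd = ∧-intro u∈X (∧-intro v∈X (cong does all≡))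
          ... | no ¬all with Fin.¬∀⟶∃¬ r (λ i → - (+ 3 * + r * w) < zs i) (λ i → - (+ 3 * + r * w) <? zs i) ¬all
          ...   | i , hi = ≤-trans (f-neg i (≮⇒≥ hi)) rhs≥0

    correlation-count : sumℕ (λ u → sumℕ (λ v → 𝟙 (X u) ℕ.* 𝟙 (X v))) ℕ.≤
      sumℕ (λ u → sumℕ (λ v → 𝟙 (good u v) ℕ.+ dominant D u v))
    correlation-count = drop‿+≤+ (subst₂ _≤_ (sum²-+ℕ (λ u v → 𝟙 (X u) ℕ.* 𝟙 (X v))) (sum²-+ℕ (λ u v → 𝟙 (good u v) ℕ.+ dominant D u v)) (0≤i-j⇒j≤i
      (0≤-cancelˡ {M} M>0 (subst (0ℤ ≤_) (sym (eq M R N)) (diff (≤-trans MN≤ (≤-reflexive MR≡)))))))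
      where
      N = sum (λ u → sum (λ v → + (𝟙 (X u) ℕ.* 𝟙 (X v))))
      R = sum (λ u → sum (λ v → + (𝟙 (good u v) ℕ.+ dominant D u v)))
      eq : ∀ M R N → M * (R - N) ≡ M * R - M * N
      eq = solve-∀
      pull : ∀ (h : Fin n → Fin n → ℕ) → sum (λ u → sum (λ v → M * + h u v)) ≡ M * sum (λ u → sum (λ v → + h u v))
      pull h = sym (trans (*-distribˡ-sum M (λ u → sum (λ v → + h u v))) (sum-cong-≗ (λ u → *-distribˡ-sum M (λ v → + h u v))))
      MR≡ = pull (λ u v → 𝟙 (good u v) ℕ.+ dominant D u v)
      K : Kernel {n}
      K u v = χ u * χ v * (c * f u v)
      MN≤ : M * N ≤ sum (λ u → sum (λ v → M * + (𝟙 (good u v) ℕ.+ dominant D u v)))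
      MN≤ = begin
        M * N
          ≡⟨ sym (+-identityˡ _) ⟩
        0ℤ + M * N
          ≤⟨ +-monoˡ-≤ (M * N) (gram-sum≥0 {K = K} (gram-* {K = λ u v → χ u * χ v} {λ u v → c * f u v} (gram-rank1 χ) gram-f)) ⟩
        sum (λ u → sum (λ v → K u v)) + M * N
          ≡⟨ cong (_+_ (sum (λ u → sum (λ v → K u v)))) (sym (pull (λ u v → 𝟙 (X u) ℕ.* 𝟙 (X v)))) ⟩
        sum (λ u → sum (λ v → K u v)) + sum (λ u → sum (λ v → M * + (𝟙 (X u) ℕ.* 𝟙 (X v))))
          ≡⟨ sym (∑-distrib-+ (λ u → sum (λ v → K u v)) (λ u → sum (λ v → M * + (𝟙 (X u) ℕ.* 𝟙 (X v))))) ⟩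
        sum (λ u → sum (λ v → K u v) + sum (λ v → M * + (𝟙 (X u) ℕ.* 𝟙 (X v))))
          ≡⟨ sum-cong-≗ (λ u → sym (∑-distrib-+ (λ v → K u v) (λ v → M * + (𝟙 (X u) ℕ.* 𝟙 (X v))))) ⟩
        sum (λ u → sum (λ v → K u v + M * + (𝟙 (X u) ℕ.* 𝟙 (X v))))
          ≤⟨ sum-monoℤ (λ u → sum-monoℤ (pointwise u)) ⟩
        sum (λ u → sum (λ v → M * + (𝟙 (good u v) ℕ.+ dominant D u v))) ∎
        where open ≤-Reasoning

    correlated-vertex : 0 ℕ.< card X →
      (∃ λ u → u ∈ X × card X ℕ.≤ 2 ℕ.* (1 ℕ.+ bound r a) ℕ.* card (good u)) ⊎
      (∃ λ d → d ℕ.< D × ∃ λ i → ∃ λ u → u ∈ X ×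
        card X ℕ.≤ 2 ℕ.^ (2 ℕ.+ d) ℕ.* (bound r (suc (a ℕ.+ d)) ℕ.* r) ℕ.* card (exceeds d i u))
    correlated-vertex X>0 = Sum.map
      (exists-popular X good (2 ℕ.* (1 ℕ.+ bound r a)) (λ u v p → proj₁ (∧-elim {X u} p)) X>0)
      (λ (d , d<D , i , h) → d , d<D , i ,
        exists-popular X (exceeds d i) (2 ℕ.^ (2 ℕ.+ d) ℕ.* (bound r (suc (a ℕ.+ d)) ℕ.* r))
          (λ u v p → proj₁ (∧-elim {X u} (proj₁ (∧-elim {good u v} p)))) X>0 h)
      (pigeonhole (card X ℕ.* card X) D (ℕ.*-mono-≤ X>0 X>0)
        (ℕ.≤-trans (ℕ.≤-reflexive square) correlation-count))
      where
      square : card X ℕ.* card X ≡ sumℕ (λ u → sumℕ (λ v → 𝟙 (X u) ℕ.* 𝟙 (X v)))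
      square = trans (ℕΣ.*-distribʳ-sum (card X) (λ u → 𝟙 (X u)))
                 (ℕΣ.sum-cong-≗ (λ u → ℕΣ.*-distribˡ-sum (𝟙 (X u)) (λ v → 𝟙 (X v))))

-- Codegree deviations as Gram kernels in a common integer unit.

module Codegrees where

  open Cliques
  open GramKernels
  open Correlations
  open import Data.Integer hiding (suc; pred)
  open import Data.Integer.Properties
  open import Data.Integer.Tactic.RingSolver using (solve-∀)
  open import Data.Nat as ℕ using (ℕ; zero; suc; z≤n; s≤s)
  import Data.Nat.Properties as ℕ
  open import Algebra.Properties.CommutativeMonoid.Sum ℕ.*-1-commutativeMonoid using () renaming (sum to prodℕ)
  open import Algebra.Properties.Semiring.Sum +-*-semiring using (sum; sum-cong-≗)

  𝟙-∧ : ∀ a b → + 𝟙 (a ∧ b) ≡ + 𝟙 a * + 𝟙 b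
  𝟙-∧ true true = refl
  𝟙-∧ true false = refl
  𝟙-∧ false b = refl

  card≡sum : ∀ {n} (S : VSet n) → + card S ≡ sum (λ y → + 𝟙 (S y))
  card≡sum S = sym (sum-+ℕ (λ y → 𝟙 (S y)))

  sum-linear₄ : ∀ {n} A B C E (α β γ δ : Fin n → ℤ) →
    sum (λ y → A * α y + B * β y + C * γ y + E * δ y) ≡ A * sum α + B * sum β + C * sum γ + E * sum δ
  sum-linear₄ {zero} A B C E α β γ δ = eq A B C E
    where
    eq : ∀ A B C E → + 0 ≡ A * + 0 + B * + 0 + C * + 0 + E * + 0
    eq = solve-∀
  sum-linear₄ {suc n} A B C E α β γ δ =
    trans (cong (_+_ (A * α zero + B * β zero + C * γ zero + E * δ zero)) (sum-linear₄ A B C E (α ∘ suc) (β ∘ suc) (γ ∘ suc) (δ ∘ suc)))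
      (eq A B C E (α zero) (β zero) (γ zero) (δ zero) _ _ _ _)
    where
    eq : ∀ A B C E a b c e a' b' c' e' → A * a + B * b + C * c + E * e + (A * a' + B * b' + C * c' + E * e')
       ≡ A * (a + a') + B * (b + b') + C * (c + c') + E * (e + e')
    eq = solve-∀

  module _ {n} (Y : VSet n) (N : Fin n → VSet n) (m : Fin n → ℤ) where

    private
      deg : Fin n → ℤ
      deg u = + card (Y ∩ N u)

    -- Up to the factor m u, the vector of u is the indicator of N u in Y, centred to have sum zero.
    centred : Fin n → Fin n → ℤ
    centred y u = m u * (+ 𝟙 (Y y) * (+ card Y * + 𝟙 (N u y) - deg u))

    centred-inner : ∀ u v → sum (λ y → centred y u * centred y v) ≡
      m u * m v * (+ card Y * (+ card Y * + card (Y ∩ N u ∩ N v) - deg u * deg v))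
    centred-inner u v = begin
      sum (λ y → centred y u * centred y v)
        ≡⟨ sum-cong-≗ pointwise ⟩
      sum (λ y → k * (s * s) * + 𝟙 ((Y ∩ N u ∩ N v) y) + - (k * (s * deg v)) * + 𝟙 ((Y ∩ N u) y)
               + - (k * (s * deg u)) * + 𝟙 ((Y ∩ N v) y) + k * (deg u * deg v) * + 𝟙 (Y y))
        ≡⟨ sum-linear₄ (k * (s * s)) (- (k * (s * deg v))) (- (k * (s * deg u))) (k * (deg u * deg v))
             (λ y → + 𝟙 ((Y ∩ N u ∩ N v) y)) (λ y → + 𝟙 ((Y ∩ N u) y)) (λ y → + 𝟙 ((Y ∩ N v) y)) (λ y → + 𝟙 (Y y)) ⟩
      k * (s * s) * sum (λ y → + 𝟙 ((Y ∩ N u ∩ N v) y)) + - (k * (s * deg v)) * sum (λ y → + 𝟙 ((Y ∩ N u) y))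
               + - (k * (s * deg u)) * sum (λ y → + 𝟙 ((Y ∩ N v) y)) + k * (deg u * deg v) * sum (λ y → + 𝟙 (Y y))
        ≡⟨ cong₂ _+_ (cong₂ _+_ (cong₂ _+_
             (cong (_*_ (k * (s * s))) (sym (card≡sum (Y ∩ N u ∩ N v))))
             (cong (_*_ (- (k * (s * deg v)))) (sym (card≡sum (Y ∩ N u)))))
             (cong (_*_ (- (k * (s * deg u)))) (sym (card≡sum (Y ∩ N v)))))
             (cong (_*_ (k * (deg u * deg v))) (sym (card≡sum Y))) ⟩
      k * (s * s) * + card (Y ∩ N u ∩ N v) + - (k * (s * deg v)) * deg u
               + - (k * (s * deg u)) * deg v + k * (deg u * deg v) * s
        ≡⟨ eq k s (+ card (Y ∩ N u ∩ N v)) (deg u) (deg v) ⟩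
      k * (s * (s * + card (Y ∩ N u ∩ N v) - deg u * deg v)) ∎
      where
      open ≡-Reasoning
      k = m u * m v
      s = + card Y
      eq : ∀ k s e d d' → k * (s * s) * e + - (k * (s * d')) * d + - (k * (s * d)) * d' + k * (d * d') * s
         ≡ k * (s * (s * e - d * d'))
      eq = solve-∀
      eq₁ : ∀ m m' s d d' a b → m * (+ 1 * (s * a - d)) * (m' * (+ 1 * (s * b - d'))) ≡
        m * m' * (s * s) * (a * b) + - (m * m' * (s * d')) * a + - (m * m' * (s * d)) * b + m * m' * (d * d') * + 1
      eq₁ = solve-∀
      eq₀ : ∀ m m' x x' A B C E → m * (+ 0 * x) * (m' * (+ 0 * x')) ≡ A * + 0 + B * + 0 + C * + 0 + E * + 0
      eq₀ = solve-∀
      pointwise : ∀ y → centred y u * centred y v ≡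
        k * (s * s) * + 𝟙 ((Y ∩ N u ∩ N v) y) + - (k * (s * deg v)) * + 𝟙 ((Y ∩ N u) y)
               + - (k * (s * deg u)) * + 𝟙 ((Y ∩ N v) y) + k * (deg u * deg v) * + 𝟙 (Y y)
      pointwise y = go (Y y)
        where
        go : ∀ b → m u * (+ 𝟙 b * (s * + 𝟙 (N u y) - deg u)) * (m v * (+ 𝟙 b * (s * + 𝟙 (N v y) - deg v))) ≡
          k * (s * s) * + 𝟙 ((b ∧ N u y) ∧ N v y) + - (k * (s * deg v)) * + 𝟙 (b ∧ N u y)
                 + - (k * (s * deg u)) * + 𝟙 (b ∧ N v y) + k * (deg u * deg v) * + 𝟙 b
        go true = trans (eq₁ (m u) (m v) s (deg u) (deg v) (+ 𝟙 (N u y)) (+ 𝟙 (N v y)))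
          (cong (λ x → k * (s * s) * x + - (k * (s * deg v)) * + 𝟙 (N u y) + - (k * (s * deg u)) * + 𝟙 (N v y) + k * (deg u * deg v) * 1ℤ)
            (sym (𝟙-∧ (N u y) (N v y))))
        go false = eq₀ (m u) (m v) (s * + 𝟙 (N u y) - deg u) (s * + 𝟙 (N v y) - deg v) (k * (s * s)) (- (k * (s * deg v))) (- (k * (s * deg u))) (k * (deg u * deg v))

    gram-centred : IsGram (λ u v → sum (λ y → centred y u * centred y v))
    gram-centred = gram-sum (λ y u v → centred y u * centred y v) (λ y → gram-rank1 (centred y))

  -- Plays the role of the reciprocals `1 / d u` over the common denominator `prodℕ d`. The factor
  -- depends on one vertex only, so normalising by it keeps a kernel Gram.
  cofactors : ∀ {n} (d : Fin n → ℕ) → Σ (Fin n → ℕ) λ m → ∀ u → m u ℕ.* d u ≡ prodℕ d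
  cofactors {zero} d = (λ ()) , λ ()
  cofactors {suc n} d = m , m-spec
    where
    rest = cofactors (d ∘ suc)
    m : Fin (suc n) → ℕ
    m zero = prodℕ (d ∘ suc)
    m (suc u) = d zero ℕ.* proj₁ rest u
    m-spec : ∀ u → m u ℕ.* d u ≡ prodℕ d
    m-spec zero = ℕ.*-comm (prodℕ (d ∘ suc)) (d zero)
    m-spec (suc u) = trans (ℕ.*-assoc (d zero) (proj₁ rest u) (d (suc u))) (cong (d zero ℕ.*_) (proj₂ rest u))

  prod>0 : ∀ {n} (d : Fin n → ℕ) → (∀ u → 0 ℕ.< d u) → 0 ℕ.< prodℕ d
  prod>0 {zero} d h = s≤s z≤n
  prod>0 {suc n} d h = ℕ.*-mono-≤ (h zero) (prod>0 (d ∘ suc) (h ∘ suc))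

  cast-≤-* : ∀ {a b c d} → a ℕ.* b ℕ.≤ c ℕ.* d → + a * + b ≤ + c * + d
  cast-≤-* {a} {b} {c} {d} h = subst₂ _≤_ (pos-* a b) (pos-* c d) (+≤+ h)

  -- d, d′ are the degrees of two vertices into a set of size s, e their codegree,
  -- z = 3Rq(se - dd′) and w = dd′ψ up to a positive factor κ.
  module CoordinateBounds (κ d d′ s e q ψ V R : ℤ)
    (κ>0 : 0ℤ < κ) (d≥0 : 0ℤ ≤ d) (d′>0 : 0ℤ < d′) (s≥0 : 0ℤ ≤ s) (e≥0 : 0ℤ ≤ e) (q≥0 : 0ℤ ≤ q) (V≥0 : 0ℤ ≤ V) (R≥0 : 0ℤ ≤ R)
    (e≤d : e ≤ d) (q≤V : q ≤ V) (dense : s * q ≤ d′ * V) where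

    z w : ℤ
    z = κ * (+ 3 * R * q * (s * e - d * d′))
    w = κ * (d * d′ * ψ)

    private
      κ≥0 = <⇒≤ κ>0
      dd′≥0 : 0ℤ ≤ d * d′
      dd′≥0 = 0≤* d≥0 (<⇒≤ d′>0)

    -- The deviation is at least `-d * d′` because `e ≥ 0`, and for `upper` the density gives
    -- `q * s * e ≤ d * d′ * V`. So the whole range of `z` is trivially within reach of a
    -- sufficiently high level `P`.
    lower : ∀ P → + 6 * R * V ≤ P * ψ → - (+ 2 * (P * w)) ≤ z
    lower P h = ≤-by (κ * (+ 3 * R * q * (s * e) + d * d′ * (+ 2 * (P * ψ - + 6 * R * V) + + 9 * R * V + + 3 * R * (V - q))))
      (0≤* κ≥0 (0≤+ (0≤* (0≤* (0≤* {+ 3} (+≤+ z≤n) R≥0) q≥0) (0≤* s≥0 e≥0))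
        (0≤* dd′≥0 (0≤+ (0≤+ (0≤* {+ 2} (+≤+ z≤n) (diff h)) (0≤* (0≤* {+ 9} (+≤+ z≤n) R≥0) V≥0))
                        (0≤* (0≤* {+ 3} (+≤+ z≤n) R≥0) (diff q≤V))))))
      (eq κ d d′ s e q ψ V R P)
      where
      eq : ∀ κ d d′ s e q ψ V R P → κ * (+ 3 * R * q * (s * e - d * d′)) - - (+ 2 * (P * (κ * (d * d′ * ψ))))
        ≡ κ * (+ 3 * R * q * (s * e) + d * d′ * (+ 2 * (P * ψ - + 6 * R * V) + + 9 * R * V + + 3 * R * (V - q)))
      eq = solve-∀

    upper : ∀ P → + 6 * R * V ≤ P * ψ → + 2 * z ≤ P * w
    upper P h = ≤-by (κ * (d * d′ * (P * ψ - + 6 * R * V) + + 6 * R * (d * (d′ * V - s * q) + s * q * (d - e)) + + 6 * R * q * (d * d′)))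
      (0≤* κ≥0 (0≤+ (0≤+ (0≤* dd′≥0 (diff h))
        (0≤* (0≤* {+ 6} (+≤+ z≤n) R≥0) (0≤+ (0≤* d≥0 (diff dense)) (0≤* (0≤* s≥0 q≥0) (diff e≤d)))))
        (0≤* (0≤* (0≤* {+ 6} (+≤+ z≤n) R≥0) q≥0) dd′≥0)))
      (eq κ d d′ s e q ψ V R P)
      where
      eq : ∀ κ d d′ s e q ψ V R P → P * (κ * (d * d′ * ψ)) - + 2 * (κ * (+ 3 * R * q * (s * e - d * d′)))
        ≡ κ * (d * d′ * (P * ψ - + 6 * R * V) + + 6 * R * (d * (d′ * V - s * q) + s * q * (d - e)) + + 6 * R * q * (d * d′))
      eq = solve-∀

    -- Density of the second vertex turns the relative estimate into an absolute one:
    -- `e / d ≥ (q - ψ/t) / V`. The factor `R = r * t` in `z` is what makes the loss only `ψ / t`.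
    good⇒ : ∀ r t → 0ℤ < r → 0ℤ ≤ t → R ≡ r * t → - (+ 3 * r * w) < z → d * (t * q) ≤ e * (t * V) + d * ψ
    good⇒ r t r>0 t≥0 refl h = 0≤i-j⇒j≤i (0≤-cancelˡ d′>0 (subst (0ℤ ≤_) (sym (eq₂ d d′ s e q ψ V t))
      (0≤+ (0≤-cancelˡ {+ 3 * r} (3r>0 r r>0) (0≤-cancelˡ κ>0 (subst (0ℤ ≤_) (eq₁ κ d d′ s e q ψ r t) (diff (<⇒≤ h)))))
           (0≤* (0≤* t≥0 e≥0) (diff dense)))))
      where
      3r>0 : ∀ r → 0ℤ < r → 0ℤ < + 3 * r
      3r>0 +[1+ n ] _ = +<+ (s≤s z≤n)
      3r>0 (+ zero) (+<+ ())
      eq₁ : ∀ κ d d′ s e q ψ r t → κ * (+ 3 * (r * t) * q * (s * e - d * d′)) - - (+ 3 * r * (κ * (d * d′ * ψ)))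
         ≡ κ * (+ 3 * r * (t * q * (s * e - d * d′) + d * d′ * ψ))
      eq₁ = solve-∀
      eq₂ : ∀ d d′ s e q ψ V t → d′ * (e * (t * V) + d * ψ - d * (t * q))
         ≡ (t * q * (s * e - d * d′) + d * d′ * ψ) + t * e * (d′ * V - s * q)
      eq₂ = solve-∀

    -- The same passage in the other direction: `e / d ≥ (q + P*ψ / (6*R)) / V`, a gain proportional
    -- to the level.
    exceeds⇒ : ∀ P → P * w < + 2 * z → d * (+ 6 * R * q + P * ψ) ≤ e * (+ 6 * R * V)
    exceeds⇒ P h = 0≤i-j⇒j≤i (0≤-cancelˡ d′>0 (subst (0ℤ ≤_) (sym (eq₂ d d′ s e q ψ V R P))
      (0≤+ (0≤-cancelˡ κ>0 (subst (0ℤ ≤_) (eq₁ κ d d′ s e q ψ R P) (diff (<⇒≤ h))))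
           (0≤* (0≤* (0≤* {+ 6} (+≤+ z≤n) R≥0) e≥0) (diff dense)))))
      where
      eq₁ : ∀ κ d d′ s e q ψ R P → + 2 * (κ * (+ 3 * R * q * (s * e - d * d′))) - P * (κ * (d * d′ * ψ))
         ≡ κ * (+ 6 * R * q * (s * e - d * d′) - P * (d * d′ * ψ))
      eq₁ = solve-∀
      eq₂ : ∀ d d′ s e q ψ V R P → d′ * (e * (+ 6 * R * V) - d * (+ 6 * R * q + P * ψ))
         ≡ (+ 6 * R * q * (s * e - d * d′) - P * (d * d′ * ψ)) + + 6 * R * e * (d′ * V - s * q)
      eq₂ = solve-∀

  *>0⇒ˡ : ∀ a b → 0 ℕ.< a ℕ.* b → 0 ℕ.< a
  *>0⇒ˡ (suc a) b h = s≤s z≤n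

  module Step {n r : ℕ} (N : Fin r → Fin n → VSet n) (t V a D : ℕ) (r>0 : 0 ℕ.< r)
    (X : VSet n) (Y : Fin r → VSet n) (q ψ : Fin r → ℕ)
    (X>0 : 0 ℕ.< card X) (Y>0 : ∀ i → 0 ℕ.< card (Y i)) (q>0 : ∀ i → 0 ℕ.< q i) (ψ>0 : ∀ i → 0 ℕ.< ψ i)
    (dense : ∀ i u → u ∈ X → card (Y i) ℕ.* q i ℕ.≤ card (Y i ∩ N i u) ℕ.* V)
    (fine : ∀ i → 6 ℕ.* (r ℕ.* t) ℕ.* V ℕ.≤ 4 ℕ.^ (a ℕ.+ D) ℕ.* ψ i) where

    private
      deg : Fin r → Fin n → ℕ
      deg i u = card (Y i ∩ N i u)

      deg>0 : ∀ i u → u ∈ X → 0 ℕ.< deg i u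
      deg>0 i u u∈X = *>0⇒ˡ (deg i u) V (ℕ.<-≤-trans (ℕ.*-mono-≤ (Y>0 i) (q>0 i)) (dense i u u∈X))

      -- Degrees may vanish outside `X`; the default `1` keeps their product positive.
      deg⁺ : Fin r → Fin n → ℕ
      deg⁺ i u = if X u then deg i u else 1

      deg⁺>0 : ∀ i u → 0 ℕ.< deg⁺ i u
      deg⁺>0 i u with X u in eq
      ... | true = deg>0 i u eq
      ... | false = s≤s z≤n

      deg⁺≡ : ∀ i u → u ∈ X → deg⁺ i u ≡ deg i u
      deg⁺≡ i u u∈X rewrite u∈X = refl

      cof : ∀ i → Fin n → ℕ
      cof i = proj₁ (cofactors (deg⁺ i))

      Π : Fin r → ℕ
      Π i = prodℕ (deg⁺ i)

      Π>0 : ∀ i → 0 ℕ.< Π i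
      Π>0 i = prod>0 (deg⁺ i) (deg⁺>0 i)

      cof-deg : ∀ i u → u ∈ X → cof i u ℕ.* deg i u ≡ Π i
      cof-deg i u u∈X = trans (cong (cof i u ℕ.*_) (sym (deg⁺≡ i u u∈X))) (proj₂ (cofactors (deg⁺ i)) u)

      cof>0 : ∀ i u → u ∈ X → 0 ℕ.< cof i u
      cof>0 i u u∈X = *>0⇒ˡ (cof i u) (deg i u) (subst (0 ℕ.<_) (sym (cof-deg i u u∈X)) (Π>0 i))

      -- The colours have different denominators. Multiplying colour `i` by the complementary
      -- product `co i` gives all kernels the same `w`, as the correlation inequality demands.
      unit : Fin r → ℕ
      unit i = Π i ℕ.* Π i ℕ.* (ψ i ℕ.* card (Y i))

      unit>0 : ∀ i → 0 ℕ.< unit i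
      unit>0 i = ℕ.*-mono-≤ (ℕ.*-mono-≤ (Π>0 i) (Π>0 i)) (ℕ.*-mono-≤ (ψ>0 i) (Y>0 i))

      w : ℤ
      w = + prodℕ unit

      co : Fin r → ℕ
      co = proj₁ (cofactors unit)

      co>0 : ∀ i → 0 ℕ.< co i
      co>0 i = *>0⇒ˡ (co i) (unit i) (subst (0 ℕ.<_) (sym (proj₂ (cofactors unit) i)) (prod>0 unit unit>0))

      w>0 : 0ℤ < w
      w>0 = +<+ (prod>0 unit unit>0)

      R : ℤ
      R = + r * + t

      R≥0 : 0ℤ ≤ R
      R≥0 = 0≤* {+ r} {+ t} (+≤+ z≤n) (+≤+ z≤n)

      coefficient : Fin r → ℤ
      coefficient i = + co i * (+ 3 * R * + q i)

      z : Fin r → Kernel {n}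
      z i u v = coefficient i * sum (λ y → centred (Y i) (N i) (λ u → + cof i u) y u * centred (Y i) (N i) (λ u → + cof i u) y v)

      gram-z : ∀ i → IsGram (z i)
      gram-z i = gram-scale {c = coefficient i} (0≤* {+ co i} (+≤+ z≤n) (0≤* (0≤* {+ 3} (+≤+ z≤n) R≥0) (+≤+ z≤n)))
        (gram-centred (Y i) (N i) (λ u → + cof i u))

      module Bounds (i : Fin r) (u v : Fin n) (u∈X : u ∈ X) (v∈X : v ∈ X) where

        e : ℕ
        e = card (Y i ∩ N i u ∩ N i v)

        κ : ℤ
        κ = + co i * + card (Y i) * (+ cof i u * + cof i v)

        κ>0 : 0ℤ < κ
        κ>0 = 0<* (0<* {+ co i} (+<+ (co>0 i)) (+<+ (Y>0 i))) (0<* {+ cof i u} (+<+ (cof>0 i u u∈X)) (+<+ (cof>0 i v v∈X)))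

        deg≤ : ∀ u → deg i u ℕ.≤ card (Y i)
        deg≤ u = card-mono {S = Y i ∩ N i u} {Y i} (λ y p → proj₁ (∧-elim {Y i y} p))

        q≤V : q i ℕ.≤ V
        q≤V = ℕ.*-cancelˡ-≤ (card (Y i)) ⦃ ℕ.>-nonZero (Y>0 i) ⦄ (ℕ.≤-trans (dense i u u∈X) (ℕ.*-monoˡ-≤ V (deg≤ u)))

        e≤deg : e ℕ.≤ deg i u
        e≤deg = card-mono {S = Y i ∩ N i u ∩ N i v} {Y i ∩ N i u} (λ y p → proj₁ (∧-elim {(Y i ∩ N i u) y} p))

        open CoordinateBounds κ (+ deg i u) (+ deg i v) (+ card (Y i)) (+ e) (+ q i) (+ ψ i) (+ V) R
          κ>0 (+≤+ z≤n) (+<+ (deg>0 i v v∈X)) (+≤+ z≤n) (+≤+ z≤n) (+≤+ z≤n) (+≤+ z≤n) R≥0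
          (+≤+ e≤deg) (+≤+ q≤V) (cast-≤-* {card (Y i)} {q i} {deg i v} {V} (dense i v v∈X)) public
          renaming (z to z′; w to w′)

        z≡ : z i u v ≡ z′
        z≡ = trans (cong (coefficient i *_) (centred-inner (Y i) (N i) (λ u → + cof i u) u v))
          (eq (+ co i) (+ 3 * R * + q i) (+ cof i u) (+ cof i v) (+ card (Y i)) _)
          where
          eq : ∀ c x m m′ s y → c * x * (m * m′ * (s * y)) ≡ c * s * (m * m′) * (x * y)
          eq = solve-∀

        w≡ : w ≡ w′
        w≡ = begin
          w ≡⟨ cong +_ (sym (proj₂ (cofactors unit) i)) ⟩
          + (co i ℕ.* unit i) ≡⟨ pos-* (co i) (unit i) ⟩
          + co i * + unit i ≡⟨ cong (+ co i *_) (pos-* (Π i ℕ.* Π i) _) ⟩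
          + co i * (+ (Π i ℕ.* Π i) * + (ψ i ℕ.* card (Y i)))
            ≡⟨ cong₂ (λ x y → + co i * (x * y)) (pos-* (Π i) (Π i)) (pos-* (ψ i) (card (Y i))) ⟩
          + co i * (+ Π i * + Π i * (+ ψ i * + card (Y i)))
            ≡⟨ cong₂ (λ x y → + co i * (x * y * (+ ψ i * + card (Y i)))) (Π≡ u u∈X) (Π≡ v v∈X) ⟩
          + co i * (+ cof i u * + deg i u * (+ cof i v * + deg i v) * (+ ψ i * + card (Y i)))
            ≡⟨ eq (+ co i) (+ cof i u) (+ deg i u) (+ cof i v) (+ deg i v) (+ ψ i) (+ card (Y i)) ⟩
          w′ ∎
          where
          open ≡-Reasoning
          Π≡ : ∀ u → u ∈ X → + Π i ≡ + cof i u * + deg i u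
          Π≡ u u∈X = trans (cong +_ (sym (cof-deg i u u∈X))) (pos-* (cof i u) (deg i u))
          eq : ∀ c m d m′ d′ ψ s → c * (m * d * (m′ * d′) * (ψ * s)) ≡ c * s * (m * m′) * (d * d′ * ψ)
          eq = solve-∀

      fineℤ : ∀ i → + 6 * R * + V ≤ 4^ (a ℕ.+ D) * + ψ i
      fineℤ i = subst₂ _≤_ lhs (cong (_* + ψ i) (sym (4^≡ (a ℕ.+ D)))) (cast-≤-* {6 ℕ.* (r ℕ.* t)} {V} {4 ℕ.^ (a ℕ.+ D)} {ψ i} (fine i))
        where
        lhs : + (6 ℕ.* (r ℕ.* t)) * + V ≡ + 6 * R * + V
        lhs = cong (_* + V) (trans (pos-* 6 (r ℕ.* t)) (cong (+ 6 *_) (pos-* r t)))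

      z-lower : ∀ i u v → u ∈ X → v ∈ X → - (+ 2 * (4^ (a ℕ.+ D) * w)) ≤ z i u v
      z-lower i u v u∈X v∈X = subst₂ (λ x y → - (+ 2 * (4^ (a ℕ.+ D) * x)) ≤ y) (sym w≡) (sym z≡) (lower (4^ (a ℕ.+ D)) (fineℤ i))
        where open Bounds i u v u∈X v∈X

      z-upper : ∀ i u v → u ∈ X → v ∈ X → + 2 * z i u v ≤ 4^ (a ℕ.+ D) * w
      z-upper i u v u∈X v∈X = subst₂ (λ x y → + 2 * y ≤ 4^ (a ℕ.+ D) * x) (sym w≡) (sym z≡) (upper (4^ (a ℕ.+ D)) (fineℤ i))
        where open Bounds i u v u∈X v∈X

      open Correlation a D X w w>0 z gram-z z-lower z-upper

      good-codegree : ∀ u v → u ∈ X → good u v ≡ true → ∀ i →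
        deg i u ℕ.* (t ℕ.* q i) ℕ.≤ card (Y i ∩ N i u ∩ N i v) ℕ.* (t ℕ.* V) ℕ.+ deg i u ℕ.* ψ i
      good-codegree u v u∈X gd i = drop‿+≤+ (subst₂ _≤_ lhs rhs
          (good⇒ (+ r) (+ t) (+<+ r>0) (+≤+ z≤n) refl (subst₂ (λ x y → - (+ 3 * + r * x) < y) w≡ z≡ (all-z i))))
        where
        v∈ = ∧-elim {X v} (proj₂ (∧-elim {X u} gd))
        open Bounds i u v u∈X (proj₁ v∈)
        all-z : ∀ i → - (+ 3 * + r * w) < z i u v
        all-z = does-true (Fin.all? (λ i → - (+ 3 * + r * w) <? z i u v)) (proj₂ v∈)
        lhs : + deg i u * (+ t * + q i) ≡ + (deg i u ℕ.* (t ℕ.* q i))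
        lhs = trans (cong (+ deg i u *_) (sym (pos-* t (q i)))) (sym (pos-* (deg i u) _))
        rhs : + e * (+ t * + V) + + deg i u * + ψ i ≡ + (e ℕ.* (t ℕ.* V) ℕ.+ deg i u ℕ.* ψ i)
        rhs = trans (cong₂ _+_ (trans (cong (+ e *_) (sym (pos-* t V))) (sym (pos-* e _))) (sym (pos-* (deg i u) (ψ i))))
                    (sym (pos-+ (e ℕ.* (t ℕ.* V)) _))

      exceeds-codegree : ∀ d i u v → u ∈ X → exceeds d i u v ≡ true →
        deg i u ℕ.* (6 ℕ.* (r ℕ.* t) ℕ.* q i ℕ.+ 4 ℕ.^ (a ℕ.+ d) ℕ.* ψ i) ℕ.≤ card (Y i ∩ N i u ∩ N i v) ℕ.* (6 ℕ.* (r ℕ.* t) ℕ.* V)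
      exceeds-codegree d i u v u∈X ex = drop‿+≤+ (subst₂ _≤_ lhs rhs
          (exceeds⇒ (4^ (a ℕ.+ d)) (subst₂ (λ x y → 4^ (a ℕ.+ d) * x < + 2 * y) w≡ z≡ big)))
        where
        both = ∧-elim {good u v} ex
        open Bounds i u v u∈X (proj₁ (∧-elim {X v} (proj₂ (∧-elim {X u} (proj₁ both)))))
        big : 4^ (a ℕ.+ d) * w < + 2 * z i u v
        big = does-true (4^ (a ℕ.+ d) * w <? + 2 * z i u v) (proj₂ both)
        6R* : ∀ x → + 6 * R * + x ≡ + (6 ℕ.* (r ℕ.* t) ℕ.* x)
        6R* x = trans (cong (_* + x) (trans (cong (+ 6 *_) (sym (pos-* r t))) (sym (pos-* 6 (r ℕ.* t))))) (sym (pos-* (6 ℕ.* (r ℕ.* t)) x))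
        lhs : + deg i u * (+ 6 * R * + q i + 4^ (a ℕ.+ d) * + ψ i)
          ≡ + (deg i u ℕ.* (6 ℕ.* (r ℕ.* t) ℕ.* q i ℕ.+ 4 ℕ.^ (a ℕ.+ d) ℕ.* ψ i))
        lhs = trans (cong (+ deg i u *_) (trans (cong₂ _+_ (6R* (q i))
                (trans (cong (_* + ψ i) (4^≡ (a ℕ.+ d))) (sym (pos-* (4 ℕ.^ (a ℕ.+ d)) (ψ i)))))
                (sym (pos-+ (6 ℕ.* (r ℕ.* t) ℕ.* q i) _)))) (sym (pos-* (deg i u) _))
        rhs : + e * (+ 6 * R * + V) ≡ + (e ℕ.* (6 ℕ.* (r ℕ.* t) ℕ.* V))
        rhs = trans (cong (+ e *_) (6R* V)) (sym (pos-* e _))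

    -- The first alternative feeds a colour step of the book algorithm, the second a boost at level
    -- `d`.
    step : (∃ λ u → u ∈ X × Σ (VSet n) λ X′ → X′ ⊆ X × card X ℕ.≤ 2 ℕ.* (1 ℕ.+ bound r a) ℕ.* card X′ ×
              (∀ v → v ∈ X′ → ∀ i → card (Y i ∩ N i u) ℕ.* (t ℕ.* q i) ℕ.≤
                card (Y i ∩ N i u ∩ N i v) ℕ.* (t ℕ.* V) ℕ.+ card (Y i ∩ N i u) ℕ.* ψ i))
         ⊎ (∃ λ d → d ℕ.< D × ∃ λ i → ∃ λ u → u ∈ X × Σ (VSet n) λ X′ → X′ ⊆ X ×
              card X ℕ.≤ 2 ℕ.^ (2 ℕ.+ d) ℕ.* (bound r (suc (a ℕ.+ d)) ℕ.* r) ℕ.* card X′ ×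
              (∀ v → v ∈ X′ → card (Y i ∩ N i u) ℕ.* (6 ℕ.* (r ℕ.* t) ℕ.* q i ℕ.+ 4 ℕ.^ (a ℕ.+ d) ℕ.* ψ i) ℕ.≤
                card (Y i ∩ N i u ∩ N i v) ℕ.* (6 ℕ.* (r ℕ.* t) ℕ.* V)))
    step = Sum.map
      (λ (u , u∈X , h) → u , u∈X , good u , (λ v gd → proj₁ (∧-elim {X v} (proj₂ (∧-elim {X u} gd)))) , h ,
        λ v gd → good-codegree u v u∈X gd)
      (λ (d , d<D , i , u , u∈X , h) → d , d<D , i , u , u∈X , exceeds d i u ,
        (λ v ex → proj₁ (∧-elim {X v} (proj₂ (∧-elim {X u} (proj₁ (∧-elim {good u v} ex)))))) , h ,
        λ v ex → exceeds-codegree d i u v u∈X ex)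
      (correlated-vertex X>0)

-- The multicolour book algorithm.

module Books where

  open Cliques
  open Correlations using (bound)
  open Codegrees using (module Step; *>0⇒ˡ)
  open import Data.Nat
  open import Data.Nat.Properties
  open import Data.Nat.Tactic.RingSolver using (solve-∀)
  open import Algebra.Properties.Semiring.Sum +-*-semiring using (sum; ∑-distrib-+)

  infixl 5 _∪_
  _∪_ : ∀ {n} → VSet n → VSet n → VSet n
  (S ∪ T) v = S v ∨ T v

  ∪-elim : ∀ {n} (S T : VSet n) v → v ∈ (S ∪ T) → v ∈ S ⊎ v ∈ T
  ∪-elim S T v h with S v
  ... | true = inj₁ refl
  ... | false = inj₂ h

  ∪-introˡ : ∀ {n} (S T : VSet n) v → v ∈ S → v ∈ (S ∪ T)
  ∪-introˡ S T v h rewrite h = refl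

  ∪-introʳ : ∀ {n} (S T : VSet n) v → v ∈ T → v ∈ (S ∪ T)
  ∪-introʳ S T v h with S v
  ... | true = refl
  ... | false = h

  ∪-mono : ∀ {n} {S S′ T T′ : VSet n} → S ⊆ S′ → T ⊆ T′ → (S ∪ T) ⊆ (S′ ∪ T′)
  ∪-mono {S = S} {S′} {T} {T′} f g v h with ∪-elim S T v h
  ... | inj₁ p = ∪-introˡ S′ T′ v (f v p)
  ... | inj₂ p = ∪-introʳ S′ T′ v (g v p)

  ∩-⊆ˡ : ∀ {n} (S T : VSet n) → (S ∩ T) ⊆ S
  ∩-⊆ˡ S T v h = proj₁ (∧-elim {S v} h)

  -- (U + ψ e)/V is the density guaranteed at potential e. A colour step spends two units of potential,
  -- a boost at level d gains Δ units for each of its ν units of budget.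
  record Parameters (r : ℕ) : Set where
    field
      t U V A B P a D σ Δ : ℕ
      ψ : ℕ → ℕ
      t>0 : 0 < t
      U≤V : U ≤ V
      V>0 : 0 < V
      B>0 : 0 < B
      ψ>0 : ∀ e → 0 < ψ e
      ψ-mono : ∀ {e f} → e ≤ f → ψ e ≤ ψ f
      -- Giving up two units of potential compensates the density loss `ψ / t` of a colour step.
      ψ-step : ∀ e → 2 + e ≤ 2 * t + Δ * σ → t * ψ e + ψ (2 + e) ≤ t * ψ (2 + e)
      -- Spending the entire boost budget would force a density above `1`.
      ψ-full : V < U + ψ (Δ * σ)
      fine : ∀ e → 6 * (r * t) * V ≤ 4 ^ (a + D) * ψ e
      -- Strictness provides for `u` itself, which lies in none of its `r` neighbourhoods.
      colour-cost : 2 * (1 + bound r a) * r < P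
      -- Smaller `ν′` are included because a boost that overdraws the budget `s` is refuted by
      -- looking at its part `ν′ = s`.
      boost : ∀ d → d < D → ∃ λ ν → 0 < ν × 2 ^ (2 + d) * (bound r (suc (a + d)) * r) ≤ P ^ ν ×
        (∀ ν′ → ν′ ≤ ν → ∀ e → e + Δ * ν′ ≤ 2 * t + Δ * σ →
          6 * (r * t) * ψ (e + Δ * ν′) ≤ 6 * (r * t) * ψ e + 4 ^ (a + d) * ψ e)

  module BookAlgorithm {r n} (c : EdgeColouring r n) (r>0 : 0 < r) (params : Parameters r) (W : VSet n) where

    open Parameters params
    open Colouring c

    potential : ℕ → ℕ → ℕ
    potential c s = 2 * c + Δ * (σ ∸ s)

    potential≤ : ∀ {c s} → c ≤ t → potential c s ≤ 2 * t + Δ * σ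
    potential≤ {c} {s} c≤t = +-mono-≤ (*-monoʳ-≤ 2 c≤t) (*-monoʳ-≤ Δ (m∸n≤m σ s))

    -- c colour steps of colour i and s units of its boost budget are left.
    record Invariant (i : Fin r) (X Y : VSet n) (c s : ℕ) : Set where
      field
        c≤t    : c ≤ t
        s≤σ    : s ≤ σ
        inside : Y ⊆ W
        -- Both sets lie in the common neighbourhood of the vertices found so far: further vertices
        -- come from `X`, the final clique from `Y`.
        extend : ∀ m → Clique i m (X ∪ Y) → Clique i ((t ∸ c) + m) W
        -- Each of the `c + s` units left has a factor `U / V` of the size of `Y` reserved for it.
        size   : V ^ (c + s) * B ≤ card Y * (U ^ (c + s) * A)
        dense  : ∀ u → u ∈ X → card Y * (U + ψ (potential c s)) ≤ card (Y ∩ nb i u) * V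

    open Invariant

    Book : Set
    Book = ∃ λ i → Σ (VSet n) λ Y → Y ⊆ W × (∀ m → Clique i m Y → Clique i (t + m) W) × B ≤ card Y * A

    Invariant-⊆ : ∀ {i X X′ Y c s} → X′ ⊆ X → Invariant i X Y c s → Invariant i X′ Y c s
    Invariant-⊆ {X = X} {X′} {Y} h I = record
      { c≤t = c≤t I ; s≤σ = s≤σ I ; inside = inside I ; size = size I
      ; extend = λ m q → extend I m (Clique-mono (∪-mono {S = X′} {X} {Y} {Y} h (λ _ p → p)) q)
      ; dense = λ u u∈X′ → dense I u (h u u∈X′) }

    size-shrink : ∀ x {y} g → V ^ (x + g) * B ≤ y * (U ^ (x + g) * A) → V ^ g * B ≤ y * (U ^ g * A)
    size-shrink x {y} g h = *-cancelˡ-≤ (V ^ x) ⦃ m^n≢0 V x ⦃ >-nonZero V>0 ⦄ ⦄ (begin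
      V ^ x * (V ^ g * B) ≡⟨ sym (*-assoc (V ^ x) (V ^ g) B) ⟩
      V ^ x * V ^ g * B ≡⟨ cong (_* B) (sym (^-distribˡ-+-* V x g)) ⟩
      V ^ (x + g) * B ≤⟨ h ⟩
      y * (U ^ (x + g) * A) ≡⟨ cong (λ z → y * (z * A)) (^-distribˡ-+-* U x g) ⟩
      y * (U ^ x * U ^ g * A) ≡⟨ eq y (U ^ x) (U ^ g) A ⟩
      U ^ x * (y * (U ^ g * A)) ≤⟨ *-monoˡ-≤ _ (^-monoˡ-≤ x U≤V) ⟩
      V ^ x * (y * (U ^ g * A)) ∎)
      where
      open ≤-Reasoning
      eq : ∀ y u v A → y * (u * v * A) ≡ u * (y * (v * A))
      eq = solve-∀

    size-step : ∀ y y′ g → y * U ≤ y′ * V → V ^ suc g * B ≤ y * (U ^ suc g * A) → V ^ g * B ≤ y′ * (U ^ g * A)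
    size-step y y′ g h k = *-cancelˡ-≤ V ⦃ >-nonZero V>0 ⦄ (begin
      V * (V ^ g * B) ≡⟨ sym (*-assoc V (V ^ g) B) ⟩
      V ^ suc g * B ≤⟨ k ⟩
      y * (U * U ^ g * A) ≡⟨ eq y U (U ^ g) A ⟩
      y * U * (U ^ g * A) ≤⟨ *-monoˡ-≤ _ h ⟩
      y′ * V * (U ^ g * A) ≡⟨ eq′ y′ V (U ^ g * A) ⟩
      V * (y′ * (U ^ g * A)) ∎)
      where
      open ≤-Reasoning
      eq : ∀ y u v A → y * (u * v * A) ≡ y * u * (v * A)
      eq = solve-∀
      eq′ : ∀ y v x → y * v * x ≡ v * (y * x)
      eq′ = solve-∀

    card>0 : ∀ {i X Y c s} → Invariant i X Y c s → 0 < card Y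
    card>0 {Y = Y} {c} {s} I with card Y | size I
    ... | suc _ | _ = s≤s z≤n
    ... | zero | h = ⊥-elim (<⇒≱ (*-mono-≤ (m^n>0 V ⦃ >-nonZero V>0 ⦄ (c + s)) B>0) h)

    neighbours-large : ∀ {i X Y c s} → Invariant i X Y c s → ∀ u → u ∈ X → card Y * U ≤ card (Y ∩ nb i u) * V
    neighbours-large {Y = Y} I u u∈X = ≤-trans (*-monoʳ-≤ (card Y) (m≤m+n U _)) (dense I u u∈X)

    Invariant-colour : ∀ {i X Y X′ c s u} → Invariant i X Y (suc c) s → u ∈ X → X′ ⊆ (X ∩ nb i u) →
      (∀ v → v ∈ X′ → card (Y ∩ nb i u) * (t * (U + ψ (potential (suc c) s))) ≤
         card (Y ∩ nb i u ∩ nb i v) * (t * V) + card (Y ∩ nb i u) * ψ (potential (suc c) s)) →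
      Invariant i X′ (Y ∩ nb i u) c s
    Invariant-colour {i} {X} {Y} {X′} {c} {s} {u} I u∈X X′⊆ codegree = record
      { c≤t = <⇒≤ (c≤t I)
      ; s≤σ = s≤σ I
      ; inside = λ v h → inside I v (∩-⊆ˡ Y (nb i u) v h)
      ; extend = λ m q → subst (λ k → Clique i k W) (shift m)
          (extend I (suc m) (cons u (∪-introˡ X Y u u∈X) (Clique-mono sub q)))
      ; size = size-step (card Y) (card (Y ∩ nb i u)) (c + s) (neighbours-large I u u∈X) (size I)
      ; dense = dense′
      }
      where
      sub : (X′ ∪ Y ∩ nb i u) ⊆ ((X ∪ Y) ∩ nb i u)
      sub v h with ∪-elim X′ (Y ∩ nb i u) v h
      ... | inj₁ p = let q = ∧-elim {X v} (X′⊆ v p) in ∧-intro (∪-introˡ X Y v (proj₁ q)) (proj₂ q)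
      ... | inj₂ p = let q = ∧-elim {Y v} p in ∧-intro (∪-introʳ X Y v (proj₁ q)) (proj₂ q)
      shift : ∀ m → (t ∸ suc c) + suc m ≡ (t ∸ c) + m
      shift m = trans (+-suc (t ∸ suc c) m) (cong (_+ m) (sym (+-∸-assoc 1 (c≤t I))))
      e = potential c s
      pot : potential (suc c) s ≡ 2 + e
      pot = eq c (Δ * (σ ∸ s))
        where
        eq : ∀ c x → 2 * suc c + x ≡ 2 + (2 * c + x)
        eq = solve-∀
      dense′ : ∀ v → v ∈ X′ → card (Y ∩ nb i u) * (U + ψ e) ≤ card (Y ∩ nb i u ∩ nb i v) * V
      dense′ v v∈X′ = *-cancelˡ-≤ t ⦃ >-nonZero t>0 ⦄ (+-cancelʳ-≤ (d * ψ (2 + e)) _ _ (begin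
        t * (d * (U + ψ e)) + d * ψ (2 + e) ≡⟨ eq₁ t d U (ψ e) (ψ (2 + e)) ⟩
        d * (t * U + (t * ψ e + ψ (2 + e))) ≤⟨ *-monoʳ-≤ d (+-monoʳ-≤ (t * U)
             (ψ-step e (subst (_≤ 2 * t + Δ * σ) pot (potential≤ {s = s} (c≤t I))))) ⟩
        d * (t * U + t * ψ (2 + e)) ≡⟨ cong (d *_) (sym (*-distribˡ-+ t U _)) ⟩
        d * (t * (U + ψ (2 + e))) ≤⟨ subst (λ p → d * (t * (U + ψ p)) ≤ e′ * (t * V) + d * ψ p) pot (codegree v v∈X′) ⟩
        e′ * (t * V) + d * ψ (2 + e) ≡⟨ cong (_+ d * ψ (2 + e)) (eq₂ e′ t V) ⟩
        t * (e′ * V) + d * ψ (2 + e) ∎))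
        where
        open ≤-Reasoning
        d = card (Y ∩ nb i u)
        e′ = card (Y ∩ nb i u ∩ nb i v)
        eq₁ : ∀ t d U x y → t * (d * (U + x)) + d * y ≡ d * (t * U + (t * x + y))
        eq₁ = solve-∀
        eq₂ : ∀ e t V → e * (t * V) ≡ t * (e * V)
        eq₂ = solve-∀

    module Boost {i X Y X′ c s u} (I : Invariant i X Y c s) (r>0 : 0 < r) (u∈X : u ∈ X) (X′⊆X : X′ ⊆ X) (l ν : ℕ)
      (grow : ∀ ν′ → ν′ ≤ ν → ∀ e → e + Δ * ν′ ≤ 2 * t + Δ * σ → 6 * (r * t) * ψ (e + Δ * ν′) ≤ 6 * (r * t) * ψ e + 4 ^ l * ψ e)
      (codegree : ∀ v → v ∈ X′ → card (Y ∩ nb i u) * (6 * (r * t) * (U + ψ (potential c s)) + 4 ^ l * ψ (potential c s)) ≤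
        card (Y ∩ nb i u ∩ nb i v) * (6 * (r * t) * V)) where

      e = potential c s
      ρ = 6 * (r * t)

      ρ>0 : 0 < ρ
      ρ>0 = *-mono-≤ {1} {6} (s≤s z≤n) (*-mono-≤ r>0 t>0)

      gain : ∀ ν′ → ν′ ≤ ν → ν′ ≤ s → ∀ v → v ∈ X′ →
        card (Y ∩ nb i u) * (U + ψ (e + Δ * ν′)) ≤ card (Y ∩ nb i u ∩ nb i v) * V
      gain ν′ ν′≤ν ν′≤s v v∈X′ = *-cancelˡ-≤ ρ ⦃ >-nonZero ρ>0 ⦄ (begin
        ρ * (d * (U + ψ (e + Δ * ν′))) ≡⟨ eq₁ ρ d U (ψ (e + Δ * ν′)) ⟩
        d * (ρ * U + ρ * ψ (e + Δ * ν′)) ≤⟨ *-monoʳ-≤ d (+-monoʳ-≤ (ρ * U) (grow ν′ ν′≤ν e e≤)) ⟩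
        d * (ρ * U + (ρ * ψ e + 4 ^ l * ψ e)) ≡⟨ eq₂ d ρ U (ψ e) (4 ^ l * ψ e) ⟩
        d * (ρ * (U + ψ e) + 4 ^ l * ψ e) ≤⟨ codegree v v∈X′ ⟩
        card (Y ∩ nb i u ∩ nb i v) * (ρ * V) ≡⟨ eq₃ (card (Y ∩ nb i u ∩ nb i v)) ρ V ⟩
        ρ * (card (Y ∩ nb i u ∩ nb i v) * V) ∎)
        where
        open ≤-Reasoning
        d = card (Y ∩ nb i u)
        eq₁ : ∀ p d U x → p * (d * (U + x)) ≡ d * (p * U + p * x)
        eq₁ = solve-∀
        eq₂ : ∀ d p U x y → d * (p * U + (p * x + y)) ≡ d * (p * (U + x) + y)
        eq₂ = solve-∀
        eq₃ : ∀ e p V → e * (p * V) ≡ p * (e * V)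
        eq₃ = solve-∀
        e≤ : e + Δ * ν′ ≤ 2 * t + Δ * σ
        e≤ = begin
          2 * c + Δ * (σ ∸ s) + Δ * ν′ ≡⟨ eq₄ (2 * c) Δ (σ ∸ s) ν′ ⟩
          2 * c + Δ * (σ ∸ s + ν′) ≤⟨ +-mono-≤ (*-monoʳ-≤ 2 (c≤t I)) (*-monoʳ-≤ Δ (begin
              σ ∸ s + ν′ ≤⟨ +-monoʳ-≤ (σ ∸ s) ν′≤s ⟩
              σ ∸ s + s ≡⟨ m∸n+n≡m (s≤σ I) ⟩
              σ ∎)) ⟩
          2 * t + Δ * σ ∎
          where
          eq₄ : ∀ x d y z → x + d * y + d * z ≡ x + d * (y + z)
          eq₄ = solve-∀

      -- Otherwise the boosted density would exceed 1.
      ν≤s : 0 < card X′ → ν ≤ s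
      ν≤s X′>0 with ν ≤? s
      ... | yes p = p
      ... | no ν≰s with card>0⇒inhabited X′ X′>0
      ...   | v , v∈X′ = ⊥-elim (<⇒≱ ψ-full (begin
        U + ψ (Δ * σ) ≤⟨ +-monoʳ-≤ U (ψ-mono Δσ≤) ⟩
        U + ψ (e + Δ * s) ≤⟨ *-cancelˡ-≤ d ⦃ >-nonZero d>0 ⦄ (≤-trans (gain s (<⇒≤ (≰⇒> ν≰s)) ≤-refl v v∈X′)
                               (*-monoˡ-≤ V (card-mono {S = Y ∩ nb i u ∩ nb i v} {Y ∩ nb i u} (∩-⊆ˡ (Y ∩ nb i u) (nb i v))))) ⟩
        V ∎))
        where
        open ≤-Reasoning
        d = card (Y ∩ nb i u)
        d>0 : 0 < d
        d>0 = *>0⇒ˡ d V (<-≤-trans (*-mono-≤ (card>0 I) (≤-trans (ψ>0 e) (m≤n+m _ U))) (dense I u u∈X))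
        Δσ≤ : Δ * σ ≤ e + Δ * s
        Δσ≤ = begin
          Δ * σ ≡⟨ cong (Δ *_) (sym (m∸n+n≡m (s≤σ I))) ⟩
          Δ * (σ ∸ s + s) ≡⟨ *-distribˡ-+ Δ (σ ∸ s) s ⟩
          Δ * (σ ∸ s) + Δ * s ≤⟨ +-monoˡ-≤ (Δ * s) (m≤n+m _ (2 * c)) ⟩
          e + Δ * s ∎

      boosted : 0 < ν → 0 < card X′ → Invariant i X′ (Y ∩ nb i u) c (s ∸ ν)
      boosted ν>0 X′>0 = record
        { c≤t = c≤t I
        ; s≤σ = ≤-trans (m∸n≤m s ν) (s≤σ I)
        ; inside = λ v h → inside I v (∩-⊆ˡ Y (nb i u) v h)
        ; extend = λ m q → extend I m (Clique-mono (∪-mono {S = X′} {X} {Y ∩ nb i u} {Y} X′⊆X (∩-⊆ˡ Y (nb i u))) q)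
        -- A boost spends `ν` units of budget but takes only one neighbourhood; the other `pred ν`
        -- factors are given away, as `U ≤ V`.
        ; size = size-shrink (pred ν) {card (Y ∩ nb i u)} (c + (s ∸ ν)) (size-step (card Y) (card (Y ∩ nb i u)) (pred ν + (c + (s ∸ ν)))
            (neighbours-large I u u∈X) (subst (λ g → V ^ g * B ≤ card Y * (U ^ g * A)) total (size I)))
        ; dense = λ v v∈X′ → subst (λ p → card (Y ∩ nb i u) * (U + ψ p) ≤ card (Y ∩ nb i u ∩ nb i v) * V)
            pot (gain ν ≤-refl ν≤ v v∈X′)
        }
        where
        ν≤ = ν≤s X′>0
        total : c + s ≡ suc (pred ν + (c + (s ∸ ν)))
        total = begin
          c + s ≡⟨ cong (c +_) (sym (m+[n∸m]≡n ν≤)) ⟩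
          c + (ν + (s ∸ ν)) ≡⟨ cong (λ k → c + (k + (s ∸ ν))) (sym (suc-pred ν ⦃ >-nonZero ν>0 ⦄)) ⟩
          c + (suc (pred ν) + (s ∸ ν)) ≡⟨ eq c (pred ν) (s ∸ ν) ⟩
          suc (pred ν + (c + (s ∸ ν))) ∎
          where
          open ≡-Reasoning
          eq : ∀ c p x → c + (suc p + x) ≡ suc (p + (c + x))
          eq = solve-∀
        pot : e + Δ * ν ≡ potential c (s ∸ ν)
        pot = begin
          2 * c + Δ * (σ ∸ s) + Δ * ν ≡⟨ eq (2 * c) Δ (σ ∸ s) ν ⟩
          2 * c + Δ * (σ ∸ s + ν) ≡⟨ cong (λ k → 2 * c + Δ * k) refund ⟩
          2 * c + Δ * (σ ∸ (s ∸ ν)) ∎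
          where
          open ≡-Reasoning
          eq : ∀ x d y z → x + d * y + d * z ≡ x + d * (y + z)
          eq = solve-∀
          refund : σ ∸ s + ν ≡ σ ∸ (s ∸ ν)
          refund = begin
            σ ∸ s + ν ≡⟨ cong (λ k → σ ∸ k + ν) (sym (m∸n+n≡m ν≤)) ⟩
            σ ∸ (s ∸ ν + ν) + ν ≡⟨ cong (_+ ν) (sym (∸-+-assoc σ (s ∸ ν) ν)) ⟩
            σ ∸ (s ∸ ν) ∸ ν + ν ≡⟨ m∸n+n≡m ν≤refund ⟩
            σ ∸ (s ∸ ν) ∎
            where
            ν≤refund : ν ≤ σ ∸ (s ∸ ν)
            ν≤refund = m+n≤o⇒m≤o∸n ν (subst (_≤ σ) (sym (m+[n∸m]≡n ν≤)) (s≤σ I))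

    Invariants : VSet n → (Fin r → VSet n) → (Fin r → ℕ) → (Fin r → ℕ) → Set
    Invariants X Y c s = ∀ i → Invariant i X (Y i) (c i) (s i)

    remaining : (Fin r → ℕ) → (Fin r → ℕ) → ℕ
    remaining c s = sum (λ i → c i + s i)

    Invariants-update : ∀ {X X′ Y c s} → X′ ⊆ X → Invariants X Y c s → ∀ j Y′ (f g : ℕ → ℕ) →
      Invariant j X′ Y′ (f (c j)) (g (s j)) →
      Invariants X′ (updateAt Y j (λ _ → Y′)) (updateAt c j f) (updateAt s j g)
    Invariants-update {X} {X′} {Y} {c} {s} X′⊆X I j Y′ f g J i with i ≟ᶠ j
    ... | yes refl rewrite updateAt-updates i {λ _ → Y′} Y | updateAt-updates i {f} c | updateAt-updates i {g} s = J
    ... | no i≢j rewrite updateAt-minimal i j {λ _ → Y′} Y i≢j | updateAt-minimal i j {f} c i≢j | updateAt-minimal i j {g} s i≢j =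
      Invariant-⊆ X′⊆X (I i)

    P>0 : 0 < P
    P>0 = ≤-trans (s≤s z≤n) colour-cost

    finish : ∀ {X Y c s} i → c ≡ 0 → Invariant i X Y c s → Book
    finish {X} {Y} {s = s} i refl I = i , Y , inside I ,
      (λ m q → extend I m (Clique-mono (∪-introʳ X Y) q)) ,
      subst₂ _≤_ (*-identityˡ B) (cong (card Y *_) (*-identityˡ A))
        (size-shrink s {card Y} 0 (subst (λ g → V ^ g * B ≤ card Y * (U ^ g * A)) (sym (+-identityʳ s)) (size I)))

    large-neighbourhood : ∀ X u p → r * p < card X → ∃ λ j → p ≤ card (X ∩ nb j u)
    large-neighbourhood X u p h with Fin.any? (λ j → p ≤? card (X ∩ nb j u))
    ... | yes q = q
    ... | no none = ⊥-elim (<⇒≱ (m<m+n (card X) r>0) (begin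
      card X + r
        ≤⟨ +-monoˡ-≤ r (card≤1+nbs X u) ⟩
      1 + sum (λ j → card (X ∩ nb j u)) + r
        ≡⟨ cong (1 + sum (λ j → card (X ∩ nb j u)) +_) (sym (trans (sum-const r 1) (*-identityʳ r))) ⟩
      1 + (sum (λ j → card (X ∩ nb j u)) + sum {r} (λ _ → 1))
        ≡⟨ cong suc (sym (∑-distrib-+ (λ j → card (X ∩ nb j u)) (λ _ → 1))) ⟩
      1 + sum (λ j → card (X ∩ nb j u) + 1)
        ≤⟨ s≤s (sum-mono {f = λ j → card (X ∩ nb j u) + 1} {λ _ → p}
             (λ j → subst (_≤ p) (+-comm 1 (card (X ∩ nb j u))) (≰⇒> (λ q → none (j , q))))) ⟩
      1 + sum {r} (λ _ → p)
        ≡⟨ cong suc (sum-const r p) ⟩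
      1 + r * p
        ≤⟨ h ⟩
      card X ∎))
      where open ≤-Reasoning

    remaining-update : ∀ {m} (c s : Fin m → ℕ) (f g : ℕ → ℕ) j x → c j + s j ≡ x + (f (c j) + g (s j)) →
      sum (λ i → c i + s i) ≡ x + sum (λ i → updateAt c j f i + updateAt s j g i)
    remaining-update c s f g zero x eq rewrite eq = +-assoc x (f (c zero) + g (s zero)) _
    remaining-update c s f g (suc j) x eq rewrite remaining-update (c ∘ suc) (s ∘ suc) f g j x eq =
      swap (c zero + s zero) x (sum (λ i → updateAt (c ∘ suc) j f i + updateAt (s ∘ suc) j g i))
      where
      swap : ∀ y x z → y + (x + z) ≡ x + (y + z)
      swap = solve-∀

    module Turn (X : VSet n) (Y : Fin r → VSet n) (c s : Fin r → ℕ) (I : Invariants X Y c s)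
      (X-large : P ^ remaining c s ≤ card X) (c>0 : ∀ i → 0 < c i) where

      i₀ : Fin r
      i₀ = fromℕ< r>0

      X>0 : 0 < card X
      X>0 = ≤-trans (m^n>0 P ⦃ >-nonZero P>0 ⦄ (remaining c s)) X-large

      Smaller : Set
      Smaller = Σ (VSet n) λ X′ → Σ (Fin r → VSet n) λ Y′ → Σ (Fin r → ℕ) λ c′ → Σ (Fin r → ℕ) λ s′ →
        Invariants X′ Y′ c′ s′ × P ^ remaining c′ s′ ≤ card X′ × remaining c′ s′ < remaining c s

      shrunk : ∀ C (X′ : VSet n) → card X ≤ C * card X′ → 0 < card X′
      shrunk C X′ h = *>0⇒ˡ (card X′) C (subst (0 <_) (*-comm C (card X′)) (<-≤-trans X>0 h))

      -- The codegrees are controlled in all colours because the majority colour `j` is known only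
      -- once `X′` has been split by the colours at `u`.
      colour-turn : ∀ u → u ∈ X → ∀ X′ → X′ ⊆ X → card X ≤ 2 * (1 + bound r a) * card X′ →
        (∀ v → v ∈ X′ → ∀ i → card (Y i ∩ nb i u) * (t * (U + ψ (potential (c i) (s i)))) ≤
           card (Y i ∩ nb i u ∩ nb i v) * (t * V) + card (Y i ∩ nb i u) * ψ (potential (c i) (s i))) → Smaller
      colour-turn u u∈X X′ X′⊆X large codegree =
        X′ ∩ nb j u , updateAt Y j (λ _ → Y j ∩ nb j u) , updateAt c j pred , updateAt s j (λ x → x) ,
        Invariants-update {Y = Y} {c} {s} (λ v h → X′⊆X v (∩-⊆ˡ X′ (nb j u) v h)) I j (Y j ∩ nb j u) pred (λ x → x)
          (Invariant-colour (subst (λ k → Invariant j X (Y j) k (s j)) (sym suc-c) (I j)) u∈X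
            (λ v h → ∧-intro (X′⊆X v (proj₁ (∧-elim {X′ v} h))) (proj₂ (∧-elim {X′ v} h)))
            (λ v h → subst (λ k → card (Y j ∩ nb j u) * (t * (U + ψ (potential k (s j)))) ≤
               card (Y j ∩ nb j u ∩ nb j v) * (t * V) + card (Y j ∩ nb j u) * ψ (potential k (s j))) (sym suc-c)
               (codegree v (∩-⊆ˡ X′ (nb j u) v h) j))) ,
        subst (λ g → P ^ g ≤ card (X′ ∩ nb j u)) (cong pred fewer) (proj₂ large-nb) ,
        ≤-reflexive (sym fewer)
        where
        open ≤-Reasoning
        p = P ^ pred (remaining c s)
        A₀ = 2 * (1 + bound r a)
        g>0 : 0 < remaining c s
        g>0 = ≤-trans (c>0 i₀) (≤-trans (m≤m+n (c i₀) (s i₀)) (term≤sum (λ i → c i + s i) i₀))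
        enough : r * p < card X′
        enough = *-cancelˡ-< A₀ (r * p) (card X′) (begin-strict
          A₀ * (r * p) ≡⟨ sym (*-assoc A₀ r p) ⟩
          A₀ * r * p <⟨ *-monoˡ-< p ⦃ m^n≢0 P (pred (remaining c s)) ⦃ >-nonZero P>0 ⦄ ⦄ colour-cost ⟩
          P * p ≡⟨ cong (P ^_) (suc-pred (remaining c s) ⦃ >-nonZero g>0 ⦄) ⟩
          P ^ remaining c s ≤⟨ X-large ⟩
          card X ≤⟨ large ⟩
          A₀ * card X′ ∎)
        large-nb = large-neighbourhood X′ u p enough
        j = proj₁ large-nb
        suc-c : suc (pred (c j)) ≡ c j
        suc-c = suc-pred (c j) ⦃ >-nonZero (c>0 j) ⦄
        fewer : remaining c s ≡ 1 + remaining (updateAt c j pred) (updateAt s j (λ x → x))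
        fewer = remaining-update c s pred (λ x → x) j 1 (cong (_+ s j) (sym suc-c))

      boost-turn : ∀ d → d < D → ∀ j u → u ∈ X → ∀ X′ → X′ ⊆ X →
        card X ≤ 2 ^ (2 + d) * (bound r (suc (a + d)) * r) * card X′ →
        (∀ v → v ∈ X′ → card (Y j ∩ nb j u) * (6 * (r * t) * (U + ψ (potential (c j) (s j))) + 4 ^ (a + d) * ψ (potential (c j) (s j))) ≤
           card (Y j ∩ nb j u ∩ nb j v) * (6 * (r * t) * V)) → Smaller
      boost-turn d d<D j u u∈X X′ X′⊆X large codegree =
        X′ , updateAt Y j (λ _ → Y j ∩ nb j u) , updateAt c j (λ x → x) , updateAt s j (_∸ ν) ,
        Invariants-update {Y = Y} {c} {s} X′⊆X I j (Y j ∩ nb j u) (λ x → x) (_∸ ν) (boosted ν>0 X′>0) , X′-large ,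
        ≤-trans (+-monoˡ-≤ g′ ν>0) (≤-reflexive (sym fewer))
        where
        open ≤-Reasoning
        b = boost d d<D
        ν = proj₁ b
        ν>0 = proj₁ (proj₂ b)
        cost = proj₁ (proj₂ (proj₂ b))
        X′>0 : 0 < card X′
        X′>0 = shrunk (2 ^ (2 + d) * (bound r (suc (a + d)) * r)) X′ large
        open Boost (I j) r>0 u∈X X′⊆X (a + d) ν (proj₂ (proj₂ (proj₂ b))) codegree
        g′ = remaining (updateAt c j (λ x → x)) (updateAt s j (_∸ ν))
        fewer : remaining c s ≡ ν + g′
        fewer = remaining-update c s (λ x → x) (_∸ ν) j ν
          (trans (cong (c j +_) (sym (m+[n∸m]≡n (ν≤s X′>0)))) (swap (c j) ν (s j ∸ ν)))
          where
          swap : ∀ y x z → y + (x + z) ≡ x + (y + z)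
          swap = solve-∀
        X′-large : P ^ g′ ≤ card X′
        X′-large = *-cancelˡ-≤ (P ^ ν) ⦃ m^n≢0 P ν ⦃ >-nonZero P>0 ⦄ ⦄ (begin
          P ^ ν * P ^ g′ ≡⟨ sym (^-distribˡ-+-* P ν g′) ⟩
          P ^ (ν + g′) ≡⟨ cong (P ^_) (sym fewer) ⟩
          P ^ remaining c s ≤⟨ X-large ⟩
          card X ≤⟨ large ⟩
          2 ^ (2 + d) * (bound r (suc (a + d)) * r) * card X′ ≤⟨ *-monoˡ-≤ (card X′) cost ⟩
          P ^ ν * card X′ ∎)

      turn : Smaller
      turn = Sum.[ (λ (u , u∈X , X′ , X′⊆X , large , codegree) → colour-turn u u∈X X′ X′⊆X large codegree) ,
                   (λ (d , d<D , i , u , u∈X , X′ , X′⊆X , large , codegree) → boost-turn d d<D i u u∈X X′ X′⊆X large codegree) ]′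
        (Step.step nb t V a D r>0 X Y
          (λ i → U + ψ (potential (c i) (s i))) (λ i → ψ (potential (c i) (s i)))
          X>0 (λ i → card>0 (I i)) (λ i → ≤-trans (ψ>0 (potential (c i) (s i))) (m≤n+m _ U))
          (λ i → ψ>0 (potential (c i) (s i))) (λ i → dense (I i)) (λ i → fine (potential (c i) (s i))))

    run : ∀ fuel X Y c s → Invariants X Y c s → P ^ remaining c s ≤ card X → remaining c s ≤ fuel → Book
    run fuel X Y c s I X-large g≤ with Fin.any? (λ i → c i ≟ 0)
    ... | yes (i , ci) = finish i ci (I i)
    -- `remaining` bounds every `c i`, so with no fuel a colour would already have finished.
    run zero X Y c s I X-large g≤ | no c≢0 =
      ⊥-elim (c≢0 (i , n≤0⇒n≡0 (≤-trans (m≤m+n (c i) (s i)) (≤-trans (term≤sum (λ i → c i + s i) i) g≤))))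
      where i = fromℕ< r>0
    run (suc fuel) X Y c s I X-large g≤ | no c≢0 =
      let (X′ , Y′ , c′ , s′ , I′ , X′-large , fewer) = Turn.turn X Y c s I X-large (λ i → n≢0⇒n>0 (λ e → c≢0 (i , e)))
      in run fuel X′ Y′ c′ s′ I′ X′-large (≤-pred (≤-trans fewer g≤))

    book : P ^ (r * (t + σ)) ≤ card W → V ^ (t + σ) * B ≤ card W * (U ^ (t + σ) * A) →
      (∀ i u → u ∈ W → card W * (U + ψ (2 * t)) ≤ card (W ∩ nb i u) * V) → Book
    book W-large W-size W-dense = run (remaining c₀ s₀) W (λ _ → W) c₀ s₀
      (λ i → record
        { c≤t = ≤-refl ; s≤σ = ≤-refl ; inside = λ _ h → h ; size = W-size
        ; extend = λ m q → subst (λ k → Clique i (k + m) W) (sym (n∸n≡0 t)) (Clique-mono (λ v h → Sum.[ (λ p → p) , (λ p → p) ]′ (∪-elim W W v h)) q)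
        ; dense = λ u u∈W → subst (λ e → card W * (U + ψ e) ≤ card (W ∩ nb i u) * V) (sym start) (W-dense i u u∈W) })
      (subst (λ g → P ^ g ≤ card W) (sym (sum-const r (t + σ))) W-large) ≤-refl
      where
      c₀ s₀ : Fin r → ℕ
      c₀ _ = t
      s₀ _ = σ
      start : potential t σ ≡ 2 * t
      start = trans (cong (λ k → 2 * t + Δ * k) (n∸n≡0 σ)) (trans (cong (2 * t +_) (*-zeroʳ Δ)) (+-identityʳ (2 * t)))

-- Reduction to nearly regular sets.

module Regularity where

  open Cliques
  open import Data.Nat
  open import Data.Nat.Properties
  open import Data.Nat.Tactic.RingSolver using (solve-∀)
  open import Algebra.Properties.Semiring.Sum +-*-semiring using (sum)
  open import Algebra.Properties.CommutativeMonoid.Sum *-1-commutativeMonoid using () renaming (sum to prod; sum-cong-≗ to prod-cong)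

  prod-const : ∀ n x → prod {n} (λ _ → x) ≡ x ^ n
  prod-const zero x = refl
  prod-const (suc n) x = cong (x *_) (prod-const n x)

  ^-distribʳ-* : ∀ m n o → (m * n) ^ o ≡ m ^ o * n ^ o
  ^-distribʳ-* m n zero = refl
  ^-distribʳ-* m n (suc o) = trans (cong (m * n *_) (^-distribʳ-* m n o)) (eq m n (m ^ o) (n ^ o))
    where
    eq : ∀ m n x y → m * n * (x * y) ≡ m * x * (n * y)
    eq = solve-∀

  module Regularisation {r′ n} (c : EdgeColouring (suc r′) n) (r′>0 : 0 < r′) (E : ℕ) (E>0 : 0 < E) where

    open Colouring c

    private
      r = suc r′

    Clique-truncate : ∀ {i k k′ W} → k′ ≤ k → Clique i k W → Clique i k′ W
    Clique-truncate z≤n q = nil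
    Clique-truncate (s≤s h) (cons v p q) = cons v p (Clique-truncate h q)

    Regular : VSet n → Set
    Regular W = ∀ i v → v ∈ W → E * r * card (W ∩ nb i v) ≤ suc E * card W

    strengthen : ∀ x y z → 0 < z → x ≤ y * z → x < (r′ * y + 1) * z
    strengthen x y z z>0 h = begin-strict
      x ≤⟨ h ⟩
      y * z ≤⟨ *-monoˡ-≤ z (m≤n*m y r′ ⦃ >-nonZero r′>0 ⦄) ⟩
      r′ * y * z <⟨ m<m+n (r′ * y * z) z>0 ⟩
      r′ * y * z + z ≡⟨ eq (r′ * y) z ⟩
      (r′ * y + 1) * z ∎
      where
      open ≤-Reasoning
      eq : ∀ x z → x * z + z ≡ (x + 1) * z
      eq = solve-∀

    uniform-bound : ∀ k W → r ^ sum k ≤ card W → Good W k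
    uniform-bound k W h = weighted-bound (sum k) k W refl
      (subst (λ x → r ^ sum k < (r′ * card W + 1) * x) (sym weight≡1)
        (strengthen (r ^ sum k) (card W) 1 (s≤s z≤n) (subst (r ^ sum k ≤_) (sym (*-identityʳ (card W))) h)))
      where
      open ErdősSzekeres c (λ _ → 1) r (≤-reflexive (trans (sum-const r 1) (*-identityʳ r)))
      weight≡1 : weight k ≡ 1
      weight≡1 = trans (prod-cong (λ i → ^-zeroˡ (k i))) (trans (prod-const r 1) (^-zeroˡ r))

    -- Here `i` steps are done and `j` are left. A vertex of too large degree beats an
    -- Erdős-Szekeres step by `1 + 1/E`, so `N` such steps repay the whole initial deficit. If there
    -- is none, `W` is regular and within `(2 * r) ^ N` of the size `M`; then `found` gives a clique
    -- for the original target `k₀`, which is truncated.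
    regularise : ∀ M N k₀ → (∀ W → Regular W → M ≤ card W * (2 * r) ^ N → ∃ λ i → Clique i k₀ W) →
      ∀ i j k W → i + j ≡ N → (∀ l → k l ≤ k₀) → M ≤ r ^ (sum k + i) →
      r ^ sum k * E ^ j ≤ card W * suc E ^ j → Good W k
    regularise M N k₀ found i j k W i+j≡N k≤k₀ M≤ W-large with Fin.any? (λ l → k l ≟ 0)
    ... | yes (l , kl) = zero-good k l kl
    regularise M N k₀ found i zero k W i+j≡N k≤k₀ M≤ W-large | no k≢0 =
      uniform-bound k W (subst₂ _≤_ (*-identityʳ (r ^ sum k)) (*-identityʳ (card W)) W-large)
    regularise M N k₀ found i (suc j) k W i+j≡N k≤k₀ M≤ W-large | no k≢0
      with Fin.any? (λ l → Fin.any? (λ v → (W v Bool.≟ true) ×-dec (suc E * card W <? E * r * card (W ∩ nb l v))))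
    ... | yes (l , v , v∈W , dense) = Good-cons k l v v∈W (n≢0⇒n>0 (λ e → k≢0 (l , e)))
        (regularise M N k₀ found (suc i) j k′ (W ∩ nb l v) (trans (sym (+-suc i j)) i+j≡N) k′≤k₀
          (subst (λ x → M ≤ r ^ x) (trans (cong (_+ i) Σk) (sym (+-suc (sum k′) i))) M≤) W′-large)
      where
      open ≤-Reasoning
      k′ = updateAt k l pred
      Σk : sum k ≡ suc (sum k′)
      Σk = sum-update (λ _ x → x) k pred l 1 (sym (suc-pred (k l) ⦃ ≢-nonZero (λ e → k≢0 (l , e)) ⦄))
      k′≤k₀ : ∀ m → k′ m ≤ k₀
      k′≤k₀ m with m ≟ᶠ l
      ... | yes refl rewrite updateAt-updates m {pred} k = ≤-trans pred[n]≤n (k≤k₀ m)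
      ... | no m≢l rewrite updateAt-minimal m l {pred} k m≢l = k≤k₀ m
      x = card (W ∩ nb l v)
      W′-large : r ^ sum k′ * E ^ j ≤ x * suc E ^ j
      W′-large = *-cancelˡ-≤ (E * r) ⦃ m*n≢0 E r ⦃ >-nonZero E>0 ⦄ ⦄ (begin
        E * r * (r ^ sum k′ * E ^ j) ≡⟨ eq₁ E r (r ^ sum k′) (E ^ j) ⟩
        r ^ suc (sum k′) * (E ^ suc j) ≡⟨ cong (λ y → r ^ y * E ^ suc j) (sym Σk) ⟩
        r ^ sum k * E ^ suc j ≤⟨ W-large ⟩
        card W * suc E ^ suc j ≡⟨ eq₂ (card W) (suc E) (suc E ^ j) ⟩
        suc E * card W * suc E ^ j ≤⟨ *-monoˡ-≤ (suc E ^ j) (<⇒≤ dense) ⟩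
        E * r * x * suc E ^ j ≡⟨ *-assoc (E * r) x (suc E ^ j) ⟩
        E * r * (x * suc E ^ j) ∎)
        where
        eq₁ : ∀ E r x y → E * r * (x * y) ≡ r * x * (E * y)
        eq₁ = solve-∀
        eq₂ : ∀ w e x → w * (e * x) ≡ e * w * x
        eq₂ = solve-∀
    ... | no none = let (l , q) = found W (λ l v v∈W → ≮⇒≥ (λ h → none (l , v , v∈W , h))) W-big
                    in l , Clique-truncate (k≤k₀ l) q
      where
      open ≤-Reasoning
      j⁺ = suc j
      W-big : M ≤ card W * (2 * r) ^ N
      W-big = *-cancelˡ-≤ (E ^ j⁺) ⦃ m^n≢0 E j⁺ ⦃ >-nonZero E>0 ⦄ ⦄ (begin
        E ^ j⁺ * M ≤⟨ *-monoʳ-≤ (E ^ j⁺) M≤ ⟩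
        E ^ j⁺ * r ^ (sum k + i) ≡⟨ cong (E ^ j⁺ *_) (^-distribˡ-+-* r (sum k) i) ⟩
        E ^ j⁺ * (r ^ sum k * r ^ i) ≡⟨ eq₁ (E ^ j⁺) (r ^ sum k) (r ^ i) ⟩
        r ^ sum k * E ^ j⁺ * r ^ i ≤⟨ *-monoˡ-≤ (r ^ i) W-large ⟩
        card W * suc E ^ j⁺ * r ^ i ≤⟨ *-monoˡ-≤ (r ^ i) (*-monoʳ-≤ (card W) (^-monoˡ-≤ j⁺ E+1≤2E)) ⟩
        card W * (2 * E) ^ j⁺ * r ^ i ≡⟨ cong (λ y → card W * y * r ^ i) (^-distribʳ-* 2 E j⁺) ⟩
        card W * (2 ^ j⁺ * E ^ j⁺) * r ^ i ≡⟨ eq₂ (card W) (2 ^ j⁺) (E ^ j⁺) (r ^ i) ⟩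
        E ^ j⁺ * (card W * (2 ^ j⁺ * r ^ i)) ≤⟨ *-monoʳ-≤ (E ^ j⁺) (*-monoʳ-≤ (card W) (begin
          2 ^ j⁺ * r ^ i ≤⟨ *-mono-≤ (^-monoˡ-≤ j⁺ (m≤m*n 2 r)) (^-monoˡ-≤ i (m≤n*m r 2)) ⟩
          (2 * r) ^ j⁺ * (2 * r) ^ i ≡⟨ sym (^-distribˡ-+-* (2 * r) j⁺ i) ⟩
          (2 * r) ^ (j⁺ + i) ≡⟨ cong ((2 * r) ^_) (trans (+-comm j⁺ i) i+j≡N) ⟩
          (2 * r) ^ N ∎)) ⟩
        E ^ j⁺ * (card W * (2 * r) ^ N) ∎)
        where
        E+1≤2E : suc E ≤ 2 * E
        E+1≤2E = ≤-trans (+-monoˡ-≤ E E>0) (≤-reflexive (cong (E +_) (sym (+-identityʳ E))))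
        eq₁ : ∀ e x y → e * (x * y) ≡ x * e * y
        eq₁ = solve-∀
        eq₂ : ∀ w p e x → w * (p * e) * x ≡ e * (w * (p * x))
        eq₂ = solve-∀

-- Elementary estimates for powers and for the costs of the steps.

module PowerBounds where

  open Correlations using (bound; growth)
  open Regularity using (^-distribʳ-*)
  open import Data.Nat
  open import Data.Nat.Properties
  open import Data.Nat.Tactic.RingSolver using (solve-∀)

  n<2^n : ∀ n → n < 2 ^ n
  n<2^n zero = s≤s z≤n
  n<2^n (suc n) = begin-strict
    suc n <⟨ +-mono-≤-< (m^n>0 2 n) (n<2^n n) ⟩
    2 ^ n + 2 ^ n ≡⟨ cong (2 ^ n +_) (sym (+-identityʳ (2 ^ n))) ⟩
    2 ^ suc n ∎
    where open ≤-Reasoning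

  4^≡2^*2^ : ∀ n → 4 ^ n ≡ 2 ^ n * 2 ^ n
  4^≡2^*2^ n = ^-distribʳ-* 2 2 n

  2^≤4^ : ∀ n → 2 ^ n ≤ 4 ^ n
  2^≤4^ n = ^-monoˡ-≤ n (s≤s (s≤s z≤n))

  pow>0 : ∀ {m} n → 0 < m → 0 < m ^ n
  pow>0 {m} n h = m^n>0 m ⦃ >-nonZero h ⦄ n

  -- (1 + δ/γ)^m ≤ 1 + 2mδ/γ
  pow-upper : ∀ γ δ m → 2 * m * δ ≤ γ → γ * (γ + δ) ^ m ≤ (γ + 2 * m * δ) * γ ^ m
  pow-upper γ δ zero h = ≤-reflexive (cong (_* 1) (sym (+-identityʳ γ)))
  pow-upper γ δ (suc m) h = begin
    γ * ((γ + δ) * (γ + δ) ^ m) ≡⟨ eq₁ γ δ ((γ + δ) ^ m) ⟩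
    (γ + δ) * (γ * (γ + δ) ^ m) ≤⟨ *-monoʳ-≤ (γ + δ) (pow-upper γ δ m (≤-trans (*-monoˡ-≤ δ (*-monoʳ-≤ 2 (n≤1+n m))) h)) ⟩
    (γ + δ) * ((γ + 2 * m * δ) * γ ^ m) ≡⟨ eq₂ γ δ m (γ ^ m) ⟩
    (γ * γ + γ * δ + 2 * m * δ * γ + δ * (2 * m * δ)) * γ ^ m
      ≤⟨ *-monoˡ-≤ (γ ^ m) (+-monoʳ-≤ (γ * γ + γ * δ + 2 * m * δ * γ) (*-monoʳ-≤ δ (≤-trans (*-monoˡ-≤ δ (*-monoʳ-≤ 2 (n≤1+n m))) h))) ⟩
    (γ * γ + γ * δ + 2 * m * δ * γ + δ * γ) * γ ^ m ≡⟨ eq₃ γ δ m (γ ^ m) ⟩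
    (γ + 2 * suc m * δ) * (γ * γ ^ m) ∎
    where
    open ≤-Reasoning
    eq₁ : ∀ γ δ x → γ * ((γ + δ) * x) ≡ (γ + δ) * (γ * x)
    eq₁ = solve-∀
    eq₂ : ∀ γ δ m x → (γ + δ) * ((γ + 2 * m * δ) * x) ≡ (γ * γ + γ * δ + 2 * m * δ * γ + δ * (2 * m * δ)) * x
    eq₂ = solve-∀
    eq₃ : ∀ γ δ m x → (γ * γ + γ * δ + 2 * m * δ * γ + δ * γ) * x ≡ (γ + 2 * suc m * δ) * (γ * x)
    eq₃ = solve-∀

  pow-≤2* : ∀ γ δ m → 0 < γ → 2 * m * δ ≤ γ → (γ + δ) ^ m ≤ 2 * γ ^ m
  pow-≤2* γ δ m γ>0 h = *-cancelˡ-≤ γ ⦃ >-nonZero γ>0 ⦄ (begin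
    γ * (γ + δ) ^ m ≤⟨ pow-upper γ δ m h ⟩
    (γ + 2 * m * δ) * γ ^ m ≤⟨ *-monoˡ-≤ (γ ^ m) (+-monoʳ-≤ γ h) ⟩
    (γ + γ) * γ ^ m ≡⟨ eq γ (γ ^ m) ⟩
    γ * (2 * γ ^ m) ∎)
    where
    open ≤-Reasoning
    eq : ∀ γ x → (γ + γ) * x ≡ γ * (2 * x)
    eq = solve-∀

  bernoulli : ∀ γ m → γ ^ m * (γ + m) ≤ suc γ ^ m * γ
  bernoulli γ zero = ≤-reflexive (cong (1 *_) (+-identityʳ γ))
  bernoulli γ (suc m) = begin
    γ * γ ^ m * (γ + suc m) ≡⟨ eq₁ γ (γ ^ m) m ⟩
    γ ^ m * (γ * (γ + suc m)) ≤⟨ *-monoʳ-≤ (γ ^ m) (≤-trans (m≤m+n _ m) (≤-reflexive (eq₂ γ m))) ⟩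
    γ ^ m * (suc γ * (γ + m)) ≡⟨ eq₃ γ (γ ^ m) m ⟩
    suc γ * (γ ^ m * (γ + m)) ≤⟨ *-monoʳ-≤ (suc γ) (bernoulli γ m) ⟩
    suc γ * (suc γ ^ m * γ) ≡⟨ sym (*-assoc (suc γ) (suc γ ^ m) γ) ⟩
    suc γ ^ suc m * γ ∎
    where
    open ≤-Reasoning
    eq₁ : ∀ γ x m → γ * x * (γ + suc m) ≡ x * (γ * (γ + suc m))
    eq₁ = solve-∀
    eq₂ : ∀ γ m → γ * (γ + suc m) + m ≡ suc γ * (γ + m)
    eq₂ = solve-∀
    eq₃ : ∀ γ x m → x * (suc γ * (γ + m)) ≡ suc γ * (x * (γ + m))
    eq₃ = solve-∀

  doubling : ∀ γ → 0 < γ → 2 * γ ^ γ ≤ suc γ ^ γ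
  doubling γ γ>0 = *-cancelʳ-≤ _ _ γ ⦃ >-nonZero γ>0 ⦄ (begin
    2 * γ ^ γ * γ ≡⟨ eq γ (γ ^ γ) ⟩
    γ ^ γ * (γ + γ) ≤⟨ bernoulli γ γ ⟩
    suc γ ^ γ * γ ∎)
    where
    open ≤-Reasoning
    eq : ∀ γ x → 2 * x * γ ≡ x * (γ + γ)
    eq = solve-∀

  doubling-^ : ∀ γ s → 0 < γ → 2 ^ s * γ ^ (γ * s) ≤ suc γ ^ (γ * s)
  doubling-^ γ s γ>0 = begin
    2 ^ s * γ ^ (γ * s) ≡⟨ cong (2 ^ s *_) (sym (^-*-assoc γ γ s)) ⟩
    2 ^ s * (γ ^ γ) ^ s ≡⟨ sym (^-distribʳ-* 2 (γ ^ γ) s) ⟩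
    (2 * γ ^ γ) ^ s ≤⟨ ^-monoˡ-≤ s (doubling γ γ>0) ⟩
    (suc γ ^ γ) ^ s ≡⟨ ^-*-assoc (suc γ) γ s ⟩
    suc γ ^ (γ * s) ∎
    where open ≤-Reasoning

  growth≥2 : ∀ l → 2 ≤ growth l
  growth≥2 zero = ≤-refl
  growth≥2 (suc l) = ≤-trans (s≤s (s≤s z≤n)) (*-mono-≤ {2} {2} ≤-refl (*-mono-≤ (growth≥2 l) (growth≥2 l)))

  -- With the factor `2` in front, the recursion is an exact squaring.
  growth≤ : ∀ l → 2 * growth l ≤ 2 ^ (2 * 2 ^ l)
  growth≤ zero = ≤-refl
  growth≤ (suc l) = begin
    2 * (2 * (growth l * growth l)) ≡⟨ eq₁ (growth l) ⟩
    2 * growth l * (2 * growth l) ≤⟨ *-mono-≤ (growth≤ l) (growth≤ l) ⟩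
    2 ^ (2 * 2 ^ l) * 2 ^ (2 * 2 ^ l) ≡⟨ sym (^-distribˡ-+-* 2 (2 * 2 ^ l) (2 * 2 ^ l)) ⟩
    2 ^ (2 * 2 ^ l + 2 * 2 ^ l) ≡⟨ cong (2 ^_) (eq₂ (2 ^ l)) ⟩
    2 ^ (2 * 2 ^ suc l) ∎
    where
    open ≤-Reasoning
    eq₁ : ∀ g → 2 * (2 * (g * g)) ≡ 2 * g * (2 * g)
    eq₁ = solve-∀
    eq₂ : ∀ x → 2 * x + 2 * x ≡ 2 * (2 * x)
    eq₂ = solve-∀

  bound≤ : ∀ r l → bound r l ≤ 2 ^ (r + 2 * 2 ^ l * r)
  bound≤ r l = begin
    r * (2 + growth l) ^ r ≤⟨ *-mono-≤ (<⇒≤ (n<2^n r)) (^-monoˡ-≤ r (begin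
        2 + growth l ≤⟨ +-monoˡ-≤ (growth l) (growth≥2 l) ⟩
        growth l + growth l ≡⟨ cong (growth l +_) (sym (+-identityʳ (growth l))) ⟩
        2 * growth l ≤⟨ growth≤ l ⟩
        2 ^ (2 * 2 ^ l) ∎)) ⟩
    2 ^ r * (2 ^ (2 * 2 ^ l)) ^ r ≡⟨ cong (2 ^ r *_) (^-*-assoc 2 (2 * 2 ^ l) r) ⟩
    2 ^ r * 2 ^ (2 * 2 ^ l * r) ≡⟨ sym (^-distribˡ-+-* 2 r (2 * 2 ^ l * r)) ⟩
    2 ^ (r + 2 * 2 ^ l * r) ∎
    where open ≤-Reasoning

  colour-cost-bound : ∀ r a → 2 * (1 + bound r a) * r < 2 ^ ((3 + 8 * r) * 2 ^ a)
  colour-cost-bound r a = begin-strict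
    2 * (1 + bound r a) * r ≤⟨ *-mono-≤ (*-monoʳ-≤ 2 (+-mono-≤ (m^n>0 2 e) (bound≤ r a))) (<⇒≤ (n<2^n r)) ⟩
    2 * (2 ^ e + 2 ^ e) * 2 ^ r ≡⟨ cong (λ x → 2 * x * 2 ^ r) (cong (2 ^ e +_) (sym (+-identityʳ (2 ^ e)))) ⟩
    2 ^ (2 + e) * 2 ^ r ≡⟨ sym (^-distribˡ-+-* 2 (2 + e) r) ⟩
    2 ^ (2 + e + r) <⟨ ^-monoʳ-< 2 (s≤s (s≤s z≤n)) exponent ⟩
    2 ^ ((3 + 8 * r) * 2 ^ a) ∎
    where
    open ≤-Reasoning
    e = r + 2 * 2 ^ a * r
    eq : ∀ r x → (3 + 8 * r) * x ≡ 2 * x * r + (3 + 6 * r) * x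
    eq = solve-∀
    eq′ : ∀ r y → 3 + (r + y + r) ≡ y + (3 + 2 * r)
    eq′ = solve-∀
    exponent : 2 + e + r < (3 + 8 * r) * 2 ^ a
    exponent = begin
      3 + (r + 2 * 2 ^ a * r + r) ≡⟨ eq′ r (2 * 2 ^ a * r) ⟩
      2 * 2 ^ a * r + (3 + 2 * r) ≤⟨ +-monoʳ-≤ (2 * 2 ^ a * r) (≤-trans
        (+-monoʳ-≤ 3 (*-monoˡ-≤ r {2} {6} (s≤s (s≤s z≤n)))) (m≤m*n (3 + 6 * r) (2 ^ a) ⦃ m^n≢0 2 a ⦄)) ⟩
      2 * 2 ^ a * r + (3 + 6 * r) * 2 ^ a ≡⟨ sym (eq r (2 ^ a)) ⟩
      (3 + 8 * r) * 2 ^ a ∎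

  -- Compared with a colour step, the exponent is `2 ^ d` times as large, whereas the correlation
  -- threshold is `4 ^ d` times as large.
  boost-cost-bound : ∀ r a d → 2 ^ (2 + d) * (bound r (suc (a + d)) * r) ≤ 2 ^ ((3 + 8 * r) * 2 ^ (a + d))
  boost-cost-bound r a d = begin
    2 ^ (2 + d) * (bound r (suc l) * r) ≤⟨ *-monoʳ-≤ (2 ^ (2 + d)) (*-mono-≤ (bound≤ r (suc l)) (<⇒≤ (n<2^n r))) ⟩
    2 ^ (2 + d) * (2 ^ e * 2 ^ r) ≡⟨ cong (2 ^ (2 + d) *_) (sym (^-distribˡ-+-* 2 e r)) ⟩
    2 ^ (2 + d) * 2 ^ (e + r) ≡⟨ sym (^-distribˡ-+-* 2 (2 + d) (e + r)) ⟩
    2 ^ (2 + d + (e + r)) ≤⟨ ^-monoʳ-≤ 2 (begin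
        2 + d + (r + 2 * (2 * 2 ^ l) * r + r) ≡⟨ eq₁ d r (2 ^ l) ⟩
        d + (2 + 2 * r) + 4 * 2 ^ l * r ≤⟨ +-monoˡ-≤ (4 * 2 ^ l * r) (+-mono-≤
            (≤-trans (m≤n+m d a) (<⇒≤ (n<2^n l)))
            (≤-trans (+-monoʳ-≤ 2 (*-monoˡ-≤ r {2} {4} (s≤s (s≤s z≤n)))) (m≤m*n (2 + 4 * r) (2 ^ l) ⦃ m^n≢0 2 l ⦄))) ⟩
        2 ^ l + (2 + 4 * r) * 2 ^ l + 4 * 2 ^ l * r ≡⟨ eq₂ r (2 ^ l) ⟩
        (3 + 8 * r) * 2 ^ l ∎) ⟩
    2 ^ ((3 + 8 * r) * 2 ^ l) ∎
    where
    open ≤-Reasoning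
    l = a + d
    e = r + 2 * 2 ^ suc l * r
    eq₁ : ∀ d r x → 2 + d + (r + 2 * (2 * x) * r + r) ≡ d + (2 + 2 * r) + 4 * x * r
    eq₁ = solve-∀
    eq₂ : ∀ r x → x + (2 + 4 * r) * x + 4 * x * r ≡ (3 + 8 * r) * x
    eq₂ = solve-∀

-- The potential function and admissible parameters for the book algorithm.

module ParameterChoice where

  open Correlations using (bound)
  open Books using (Parameters)
  open PowerBounds
  open import Data.Nat
  open import Data.Nat.Properties
  open import Data.Nat.Tactic.RingSolver using (solve-∀)

  -- t^N (1 + 1/t)^e for e ≤ N
  module Potential (t N : ℕ) (t≥2 : 2 ≤ t) where

    t>0 : 0 < t
    t>0 = ≤-trans (s≤s z≤n) t≥2

    ψ : ℕ → ℕ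
    ψ e = t ^ (N ∸ e) * suc t ^ e

    ψ>0 : ∀ e → 0 < ψ e
    ψ>0 e = *-mono-≤ (pow>0 (N ∸ e) t>0) (pow>0 e (s≤s z≤n))

    ψ-0 : ψ 0 ≡ t ^ N
    ψ-0 = *-identityʳ (t ^ N)

    ψ-suc : ∀ e → ψ e ≤ ψ (suc e)
    ψ-suc e with <-≤-connex e N
    ... | inj₁ e<N = begin
      t ^ (N ∸ e) * suc t ^ e ≡⟨ cong (λ k → t ^ k * suc t ^ e) (sym (suc-pred (N ∸ e) ⦃ >-nonZero (m<n⇒0<n∸m e<N) ⦄)) ⟩
      t ^ suc (pred (N ∸ e)) * suc t ^ e ≡⟨ cong (λ k → t ^ suc k * suc t ^ e) (pred[m∸n]≡m∸[1+n] N e) ⟩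
      t * t ^ (N ∸ suc e) * suc t ^ e ≡⟨ eq t (t ^ (N ∸ suc e)) (suc t ^ e) ⟩
      t ^ (N ∸ suc e) * (t * suc t ^ e) ≤⟨ *-monoʳ-≤ (t ^ (N ∸ suc e)) (*-monoˡ-≤ (suc t ^ e) (n≤1+n t)) ⟩
      ψ (suc e) ∎
      where
      open ≤-Reasoning
      eq : ∀ t x y → t * x * y ≡ x * (t * y)
      eq = solve-∀
    -- Beyond `N` the truncated exponent of `t` stays `0`; the formula changes its meaning but
    -- remains monotone.
    ... | inj₂ N≤e = begin
      t ^ (N ∸ e) * suc t ^ e ≡⟨ cong (λ k → t ^ k * suc t ^ e) (trans (m≤n⇒m∸n≡0 N≤e) (sym (m≤n⇒m∸n≡0 (≤-trans N≤e (n≤1+n e))))) ⟩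
      t ^ (N ∸ suc e) * suc t ^ e ≤⟨ *-monoʳ-≤ (t ^ (N ∸ suc e)) (m≤n*m (suc t ^ e) (suc t)) ⟩
      ψ (suc e) ∎
      where open ≤-Reasoning

    ψ-mono : ∀ {e f} → e ≤ f → ψ e ≤ ψ f
    ψ-mono {e} {f} e≤f = subst (λ k → ψ e ≤ ψ k) (m+[n∸m]≡n e≤f) (go (f ∸ e))
      where
      go : ∀ d → ψ e ≤ ψ (e + d)
      go zero = ≤-reflexive (cong ψ (sym (+-identityʳ e)))
      go (suc d) = ≤-trans (go d) (≤-trans (ψ-suc (e + d)) (≤-reflexive (cong ψ (sym (+-suc e d)))))

    ψ-shift : ∀ e m → e + m ≤ N → ψ (e + m) * t ^ m ≡ ψ e * suc t ^ m
    ψ-shift e m e+m≤N = begin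
      t ^ (N ∸ (e + m)) * suc t ^ (e + m) * t ^ m
        ≡⟨ cong (λ x → t ^ (N ∸ (e + m)) * x * t ^ m) (^-distribˡ-+-* (suc t) e m) ⟩
      t ^ (N ∸ (e + m)) * (suc t ^ e * suc t ^ m) * t ^ m
        ≡⟨ eq (t ^ (N ∸ (e + m))) (suc t ^ e) (suc t ^ m) (t ^ m) ⟩
      t ^ (N ∸ (e + m)) * t ^ m * suc t ^ e * suc t ^ m
        ≡⟨ cong (λ x → x * suc t ^ e * suc t ^ m) (sym (^-distribˡ-+-* t (N ∸ (e + m)) m)) ⟩
      t ^ (N ∸ (e + m) + m) * suc t ^ e * suc t ^ m
        ≡⟨ cong (λ k → t ^ k * suc t ^ e * suc t ^ m) (begin
             N ∸ (e + m) + m ≡⟨ cong (_+ m) (sym (∸-+-assoc N e m)) ⟩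
             N ∸ e ∸ m + m ≡⟨ m∸n+n≡m (m+n≤o⇒m≤o∸n m (subst (_≤ N) (+-comm e m) e+m≤N)) ⟩
             N ∸ e ∎) ⟩
      ψ e * suc t ^ m ∎
      where
      open ≡-Reasoning
      eq : ∀ a b c d → a * (b * c) * d ≡ a * d * b * c
      eq = solve-∀

    -- This says `(1 - 1/t) * (1 + 1/t)² ≥ 1`, that is `t + 1 ≤ t²`. One unit per colour step would
    -- fail, since `(1 - 1/t) * (1 + 1/t) < 1`.
    ψ-step : ∀ e → 2 + e ≤ N → t * ψ e + ψ (2 + e) ≤ t * ψ (2 + e)
    ψ-step e 2+e≤N = *-cancelʳ-≤ _ _ (t ^ 2) ⦃ m^n≢0 t 2 ⦃ >-nonZero t>0 ⦄ ⦄ (begin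
      (t * ψ e + ψ (2 + e)) * t ^ 2 ≡⟨ eq₁ t (ψ e) (ψ (2 + e)) (t ^ 2) ⟩
      t * (ψ e * t ^ 2) + ψ (2 + e) * t ^ 2 ≡⟨ cong (t * (ψ e * t ^ 2) +_) shift ⟩
      t * (ψ e * t ^ 2) + ψ e * suc t ^ 2 ≡⟨ eq₂ t (ψ e) ⟩
      ψ e * (t * t * t + t * t + t + (t + 1)) ≤⟨ *-monoʳ-≤ (ψ e) (≤-trans
          (+-monoʳ-≤ (t * t * t + t * t + t) (≤-trans (+-monoʳ-≤ t t>0) (≤-trans (≤-reflexive (cong (t +_) (sym (+-identityʳ t)))) (*-monoˡ-≤ t t≥2))))
          (≤-reflexive (eq₃ t))) ⟩
      ψ e * (t * (suc t * suc t)) ≡⟨ eq₄ t (ψ e) ⟩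
      t * (ψ e * suc t ^ 2) ≡⟨ cong (t *_) (sym shift) ⟩
      t * (ψ (2 + e) * t ^ 2) ≡⟨ sym (*-assoc t (ψ (2 + e)) (t ^ 2)) ⟩
      t * ψ (2 + e) * t ^ 2 ∎)
      where
      open ≤-Reasoning
      shift : ψ (2 + e) * t ^ 2 ≡ ψ e * suc t ^ 2
      shift = trans (cong (λ k → ψ k * t ^ 2) (+-comm 2 e)) (ψ-shift e 2 (subst (_≤ N) (+-comm 2 e) 2+e≤N))
      eq₁ : ∀ t x y z → (t * x + y) * z ≡ t * (x * z) + y * z
      eq₁ = solve-∀
      eq₂ : ∀ t x → t * (x * (t * (t * 1))) + x * (suc t * (suc t * 1)) ≡ x * (t * t * t + t * t + t + (t + 1))
      eq₂ = solve-∀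
      eq₃ : ∀ t → t * t * t + t * t + t + t * t ≡ t * (suc t * suc t)
      eq₃ = solve-∀
      eq₄ : ∀ t x → x * (t * (suc t * suc t)) ≡ t * (x * (suc t * (suc t * 1)))
      eq₄ = solve-∀

    ψ-upper : ∀ e m → e + m ≤ N → 2 * m ≤ t → t * ψ (e + m) ≤ (t + 2 * m) * ψ e
    ψ-upper e m e+m≤N 2m≤t = *-cancelʳ-≤ _ _ (t ^ m) ⦃ m^n≢0 t m ⦃ >-nonZero t>0 ⦄ ⦄ (begin
      t * ψ (e + m) * t ^ m ≡⟨ *-assoc t (ψ (e + m)) (t ^ m) ⟩
      t * (ψ (e + m) * t ^ m) ≡⟨ cong (t *_) (ψ-shift e m e+m≤N) ⟩
      t * (ψ e * suc t ^ m) ≡⟨ eq₁ t (ψ e) (suc t ^ m) ⟩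
      ψ e * (t * suc t ^ m) ≤⟨ *-monoʳ-≤ (ψ e) (subst₂ (λ x y → t * x ^ m ≤ (t + y) * t ^ m) (+-comm t 1) (*-identityʳ (2 * m))
           (pow-upper t 1 m (subst (_≤ t) (sym (*-identityʳ (2 * m))) 2m≤t))) ⟩
      ψ e * ((t + 2 * m) * t ^ m) ≡⟨ eq₂ (ψ e) (t + 2 * m) (t ^ m) ⟩
      (t + 2 * m) * ψ e * t ^ m ∎)
      where
      open ≤-Reasoning
      eq₁ : ∀ t x y → t * (x * y) ≡ x * (t * y)
      eq₁ = solve-∀
      eq₂ : ∀ x y z → x * (y * z) ≡ y * x * z
      eq₂ = solve-∀

    ψ-lower : ∀ s → t * s ≤ N → 2 ^ s * t ^ N ≤ ψ (t * s)
    ψ-lower s ts≤N = *-cancelʳ-≤ _ _ (t ^ (t * s)) ⦃ m^n≢0 t (t * s) ⦃ >-nonZero t>0 ⦄ ⦄ (begin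
      2 ^ s * t ^ N * t ^ (t * s) ≡⟨ eq (2 ^ s) (t ^ N) (t ^ (t * s)) ⟩
      t ^ N * (2 ^ s * t ^ (t * s)) ≤⟨ *-monoʳ-≤ (t ^ N) (doubling-^ t s t>0) ⟩
      t ^ N * suc t ^ (t * s) ≡⟨ cong (_* suc t ^ (t * s)) (sym ψ-0) ⟩
      ψ 0 * suc t ^ (t * s) ≡⟨ sym (ψ-shift 0 (t * s) ts≤N) ⟩
      ψ (t * s) * t ^ (t * s) ∎)
      where
      open ≤-Reasoning
      eq : ∀ x y z → x * y * z ≡ y * (x * z)
      eq = solve-∀

    -- The fourth power of `(1 + 1/t)^(t/2) ≤ 2`.
    ψ-2t : ∀ m → t ≡ 2 * m → 2 * t ≤ N → ψ (2 * t) ≤ 16 * t ^ N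
    ψ-2t m t≡2m 2t≤N = *-cancelʳ-≤ _ _ (t ^ (2 * t)) ⦃ m^n≢0 t (2 * t) ⦃ >-nonZero t>0 ⦄ ⦄ (begin
      ψ (2 * t) * t ^ (2 * t) ≡⟨ ψ-shift 0 (2 * t) 2t≤N ⟩
      ψ 0 * suc t ^ (2 * t) ≡⟨ cong₂ _*_ ψ-0 (cong (suc t ^_) 2t≡) ⟩
      t ^ N * suc t ^ (m * 4) ≡⟨ cong (t ^ N *_) (sym (^-*-assoc (suc t) m 4)) ⟩
      t ^ N * (suc t ^ m) ^ 4 ≤⟨ *-monoʳ-≤ (t ^ N) (^-monoˡ-≤ 4 (subst (λ x → x ^ m ≤ 2 * t ^ m) (+-comm t 1)
          (pow-≤2* t 1 m t>0 (≤-reflexive (trans (*-identityʳ (2 * m)) (sym t≡2m)))))) ⟩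
      t ^ N * (2 * t ^ m) ^ 4 ≡⟨ eq (t ^ N) (t ^ m) ⟩
      16 * t ^ N * (t ^ m) ^ 4 ≡⟨ cong (16 * t ^ N *_) (trans (^-*-assoc t m 4) (cong (t ^_) (sym 2t≡))) ⟩
      16 * t ^ N * t ^ (2 * t) ∎)
      where
      open ≤-Reasoning
      2t≡ : 2 * t ≡ m * 4
      2t≡ = trans (cong (2 *_) t≡2m) (eq₀ m)
        where
        eq₀ : ∀ m → 2 * (2 * m) ≡ m * 4
        eq₀ = solve-∀
      eq : ∀ x y → x * (2 * y * (2 * y * (2 * y * (2 * y * 1)))) ≡ 16 * x * (y * (y * (y * (y * 1))))
      eq = solve-∀

  module Choice (r a′ x y b D₀ γ A B : ℕ) (r>0 : 0 < r) (D₀>0 : 0 < D₀) (B>0 : 0 < B)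
    (full : D₀ * (b + r) ≤ 4 ^ a′) (2^b≡ : 2 ^ b ≡ γ + 18) (fineness : 24 * (r * r) * 2 ^ b * D₀ ≤ 4 ^ y) (y≤x : y ≤ x) where

    a T τ t Δ N : ℕ
    -- The summand `r + 2` supplies the factor `12 * r` that `grow` needs.
    a = r + 2 + a′
    T = 1 + a′ + x
    τ = 4 ^ T
    t = D₀ * τ
    Δ = 4 ^ a′
    -- The largest potential that can occur: all colour steps left and the whole boost budget spent.
    N = 2 * t + Δ * τ

    t≡ : t ≡ 2 * (2 * (D₀ * 4 ^ (a′ + x)))
    t≡ = eq D₀ (4 ^ (a′ + x))
      where
      eq : ∀ d z → d * (4 * z) ≡ 2 * (2 * (d * z))
      eq = solve-∀

    t≥2 : 2 ≤ t
    t≥2 = subst (2 ≤_) (sym t≡) (*-monoʳ-≤ 2 {1} (*-mono-≤ {1} {2} (s≤s z≤n) (*-mono-≤ D₀>0 (pow>0 (a′ + x) (s≤s z≤n)))))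

    open Potential t N t≥2

    4^+ : ∀ m n → 4 ^ (m + n) ≡ 4 ^ m * 4 ^ n
    4^+ = ^-distribˡ-+-* 4

    t^N>0 : 0 < t ^ N
    t^N>0 = pow>0 N t>0

    V U : ℕ
    -- The base density `U / V` is `(1 - 18/2^b) / r`; `t ^ N` is the common denominator of `ψ`.
    V = r * 2 ^ b * t ^ N
    U = γ * t ^ N

    γ≤2^b : γ ≤ 2 ^ b
    γ≤2^b = subst (γ ≤_) (sym 2^b≡) (m≤m+n γ 18)

    U≤V : U ≤ V
    U≤V = *-monoˡ-≤ (t ^ N) (≤-trans γ≤2^b (m≤n*m (2 ^ b) r ⦃ >-nonZero r>0 ⦄))

    -- By `full` the budget is worth at least `t * (b + r)` units of potential, and every `t` units
    -- double `ψ`.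
    V≤ψΔτ : V ≤ ψ (Δ * τ)
    V≤ψΔτ = begin
      r * 2 ^ b * t ^ N ≤⟨ *-monoˡ-≤ (t ^ N) (*-monoˡ-≤ (2 ^ b) (<⇒≤ (n<2^n r))) ⟩
      2 ^ r * 2 ^ b * t ^ N ≡⟨ cong (_* t ^ N) (sym (^-distribˡ-+-* 2 r b)) ⟩
      2 ^ (r + b) * t ^ N ≡⟨ cong (λ k → 2 ^ k * t ^ N) (+-comm r b) ⟩
      2 ^ (b + r) * t ^ N ≤⟨ ψ-lower (b + r) (≤-trans ts≤ (m≤n+m (Δ * τ) (2 * t))) ⟩
      ψ (t * (b + r)) ≤⟨ ψ-mono ts≤ ⟩
      ψ (Δ * τ) ∎
      where
      open ≤-Reasoning
      ts≤ : t * (b + r) ≤ Δ * τ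
      ts≤ = ≤-trans (≤-reflexive (eq D₀ τ (b + r))) (*-monoˡ-≤ τ full)
        where
        eq : ∀ d t s → d * t * s ≡ d * s * t
        eq = solve-∀

    fine : ∀ e → 6 * (r * t) * V ≤ 4 ^ (a + (x + y)) * ψ e
    fine e = begin
      6 * (r * (D₀ * (4 * 4 ^ (a′ + x)))) * (r * 2 ^ b * t ^ N) ≡⟨ eq₁ r D₀ (4 ^ (a′ + x)) (2 ^ b) (t ^ N) ⟩
      24 * (r * r) * 2 ^ b * D₀ * 4 ^ (a′ + x) * t ^ N ≤⟨ *-monoˡ-≤ (t ^ N) (*-monoˡ-≤ (4 ^ (a′ + x)) fineness) ⟩
      4 ^ y * 4 ^ (a′ + x) * t ^ N ≡⟨ cong (_* t ^ N) (sym (4^+ y (a′ + x))) ⟩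
      4 ^ (y + (a′ + x)) * t ^ N ≤⟨ *-mono-≤ (^-monoʳ-≤ 4 (≤-trans (m≤n+m _ (r + 2)) (≤-reflexive (eq₂ r y a′ x))))
          (≤-trans (≤-reflexive (sym ψ-0)) (ψ-mono {0} {e} z≤n)) ⟩
      4 ^ (a + (x + y)) * ψ e ∎
      where
      open ≤-Reasoning
      eq₁ : ∀ r d z β n → 6 * (r * (d * (4 * z))) * (r * β * n) ≡ 24 * (r * r) * β * d * z * n
      eq₁ = solve-∀
      eq₂ : ∀ r y a x → r + 2 + (y + (a + x)) ≡ r + 2 + a + (x + y)
      eq₂ = solve-∀

    12r≤ : 12 * r ≤ 4 ^ (r + 2)
    12r≤ = begin
      12 * r ≤⟨ *-mono-≤ {12} {16} (m≤m+n 12 4) (≤-trans (<⇒≤ (n<2^n r)) (2^≤4^ r)) ⟩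
      16 * 4 ^ r ≡⟨ *-comm 16 (4 ^ r) ⟩
      4 ^ r * 4 ^ 2 ≡⟨ sym (4^+ r 2) ⟩
      4 ^ (r + 2) ∎
      where open ≤-Reasoning

    grow : ∀ d ν → ν ≤ 4 ^ d → ν ≤ 4 ^ x → ∀ e → e + Δ * ν ≤ N →
      6 * (r * t) * ψ (e + Δ * ν) ≤ 6 * (r * t) * ψ e + 4 ^ (a + d) * ψ e
    grow d ν ν≤4^d ν≤4^x e e≤ = begin
      6 * (r * t) * ψ (e + m) ≡⟨ eq₁ r t (ψ (e + m)) ⟩
      6 * r * (t * ψ (e + m)) ≤⟨ *-monoʳ-≤ (6 * r) (ψ-upper e m e≤ 2m≤t) ⟩
      6 * r * ((t + 2 * m) * ψ e) ≡⟨ eq₂ r t m (ψ e) ⟩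
      6 * (r * t) * ψ e + 12 * r * m * ψ e ≤⟨ +-monoʳ-≤ (6 * (r * t) * ψ e) (*-monoˡ-≤ (ψ e) (begin
          12 * r * m ≤⟨ *-mono-≤ 12r≤ (*-monoʳ-≤ Δ ν≤4^d) ⟩
          4 ^ (r + 2) * (4 ^ a′ * 4 ^ d) ≡⟨ sym (*-assoc (4 ^ (r + 2)) (4 ^ a′) (4 ^ d)) ⟩
          4 ^ (r + 2) * 4 ^ a′ * 4 ^ d ≡⟨ cong (_* 4 ^ d) (sym (4^+ (r + 2) a′)) ⟩
          4 ^ a * 4 ^ d ≡⟨ sym (4^+ a d) ⟩
          4 ^ (a + d) ∎)) ⟩
      6 * (r * t) * ψ e + 4 ^ (a + d) * ψ e ∎
      where
      open ≤-Reasoning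
      m = Δ * ν
      eq₁ : ∀ r t z → 6 * (r * t) * z ≡ 6 * r * (t * z)
      eq₁ = solve-∀
      eq₂ : ∀ r t m z → 6 * r * ((t + 2 * m) * z) ≡ 6 * (r * t) * z + 12 * r * m * z
      eq₂ = solve-∀
      2m≤t : 2 * m ≤ t
      2m≤t = begin
        2 * (4 ^ a′ * ν) ≤⟨ *-monoʳ-≤ 2 (*-monoʳ-≤ (4 ^ a′) ν≤4^x) ⟩
        2 * (4 ^ a′ * 4 ^ x) ≡⟨ cong (2 *_) (sym (4^+ a′ x)) ⟩
        2 * 4 ^ (a′ + x) ≤⟨ *-monoʳ-≤ 2 (≤-trans (m≤n*m (4 ^ (a′ + x)) D₀ ⦃ >-nonZero D₀>0 ⦄) (m≤n*m _ 2)) ⟩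
        2 * (2 * (D₀ * 4 ^ (a′ + x))) ≡⟨ sym t≡ ⟩
        t ∎

    P : ℕ
    P = 2 ^ ((3 + 8 * r) * 2 ^ a)

    boost-cost : ∀ d ν → 2 ^ d ≤ ν → 2 ^ (2 + d) * (bound r (suc (a + d)) * r) ≤ P ^ ν
    boost-cost d ν h = begin
      2 ^ (2 + d) * (bound r (suc (a + d)) * r) ≤⟨ boost-cost-bound r a d ⟩
      2 ^ ((3 + 8 * r) * 2 ^ (a + d)) ≡⟨ cong (λ z → 2 ^ ((3 + 8 * r) * z)) (^-distribˡ-+-* 2 a d) ⟩
      2 ^ ((3 + 8 * r) * (2 ^ a * 2 ^ d)) ≤⟨ ^-monoʳ-≤ 2 (≤-trans (*-monoʳ-≤ (3 + 8 * r) (*-monoʳ-≤ (2 ^ a) h))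
           (≤-reflexive (sym (*-assoc (3 + 8 * r) (2 ^ a) ν)))) ⟩
      2 ^ ((3 + 8 * r) * 2 ^ a * ν) ≡⟨ sym (^-*-assoc 2 ((3 + 8 * r) * 2 ^ a) ν) ⟩
      P ^ ν ∎
      where open ≤-Reasoning

    -- A single boost gains at most 4^x units, which keeps its potential gain Δν within t/4.
    boost : ∀ d → d < x + y → ∃ λ ν → 0 < ν × 2 ^ (2 + d) * (bound r (suc (a + d)) * r) ≤ P ^ ν ×
      (∀ ν′ → ν′ ≤ ν → ∀ e → e + Δ * ν′ ≤ N → 6 * (r * t) * ψ (e + Δ * ν′) ≤ 6 * (r * t) * ψ e + 4 ^ (a + d) * ψ e)
    boost d d<D with ≤-total d x
    ... | inj₁ d≤x = 4 ^ d , pow>0 d (s≤s z≤n) , boost-cost d (4 ^ d) (2^≤4^ d) ,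
      λ ν ν≤ e e≤ → grow d ν ν≤ (≤-trans ν≤ (^-monoʳ-≤ 4 d≤x)) e e≤
    -- Capping at `4 ^ x` still covers the cost `2 ^ d`, because `d < x + y ≤ 2 * x`.
    ... | inj₂ x≤d = 4 ^ x , pow>0 x (s≤s z≤n) , boost-cost d (4 ^ x)
        (≤-trans (^-monoʳ-≤ 2 (≤-trans (<⇒≤ d<D) (+-monoʳ-≤ x y≤x)))
          (≤-reflexive (trans (^-distribˡ-+-* 2 x x) (sym (4^≡2^*2^ x))))) ,
      λ ν ν≤ e e≤ → grow d ν (≤-trans ν≤ (^-monoʳ-≤ 4 x≤d)) ν≤ e e≤

    parameters : 0 < γ → Parameters r
    parameters γ>0 = record
      { t = t ; U = U ; V = V ; A = A ; B = B ; P = P ; a = a ; D = x + y ; σ = τ ; Δ = Δ ; ψ = ψ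
      ; t>0 = t>0 ; U≤V = U≤V ; V>0 = *-mono-≤ (*-mono-≤ r>0 (pow>0 b (s≤s z≤n))) t^N>0 ; B>0 = B>0
      ; ψ>0 = ψ>0 ; ψ-mono = ψ-mono ; ψ-step = ψ-step
      ; ψ-full = ≤-trans (s≤s V≤ψΔτ) (+-monoˡ-≤ (ψ (Δ * τ)) (*-mono-≤ γ>0 t^N>0))
      ; fine = fine ; colour-cost = colour-cost-bound r a ; boost = boost }

-- Balance of the losses against the gain from skewed weights.

module WeightGain where

  open Regularity using (^-distribʳ-*)
  open PowerBounds
  open import Data.Nat
  open import Data.Nat.Properties
  open import Data.Nat.Tactic.RingSolver using (solve-∀)

  pow-pow-≤ : ∀ x y z m n → x ^ m ≤ z * y ^ m → x ^ (m * n) ≤ z ^ n * y ^ (m * n)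
  pow-pow-≤ x y z m n h = begin
    x ^ (m * n) ≡⟨ sym (^-*-assoc x m n) ⟩
    (x ^ m) ^ n ≤⟨ ^-monoˡ-≤ n h ⟩
    (z * y ^ m) ^ n ≡⟨ ^-distribʳ-* z (y ^ m) n ⟩
    z ^ n * (y ^ m) ^ n ≡⟨ cong (z ^ n *_) (^-*-assoc y m n) ⟩
    z ^ n * y ^ (m * n) ∎
    where open ≤-Reasoning

  -- The gain of the weights 1/w_ℓ = g/(rΘ), 1/w_i = (Θ+1)/(rΘ) over the uniform weights 1/r.
  module Gain (r′ Θ g D′ γ b S τ l : ℕ) (r′>0 : 0 < r′) (g>0 : 0 < g) (γ>0 : 0 < γ) (Θ≡ : Θ ≡ g + r′)
    (D′-large : 8 * (suc r′ * suc r′) ≤ 2 ^ D′) (2^b≡ : 2 ^ b ≡ γ + 18)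
    (γ-large : 2 * (Θ * D′ + 1) * 18 ≤ γ)
    (g-large : 2 * (4 * (S * (Θ * D′))) * (r′ * r′) ≤ g * (g + 2 * r′))
    (l≤ : l ≤ 4 * (S * (Θ * D′)) * τ) where

    r t m : ℕ
    r = suc r′
    t = Θ * D′ * τ
    m = t + τ

    Θ>0 : 0 < Θ
    Θ>0 = subst (0 <_) (sym Θ≡) (≤-trans g>0 (m≤m+n g r′))

    -- `(1 + 18/γ)^(Θ*D′ + 1)` is at most `2`, and `m` is `τ` times this exponent.
    density-loss : (2 ^ b) ^ m ≤ 2 ^ τ * γ ^ m
    density-loss = subst₂ (λ x y → x ^ y ≤ 2 ^ τ * γ ^ y) (sym 2^b≡) (eq (Θ * D′) τ)
      (pow-pow-≤ (γ + 18) γ 2 (Θ * D′ + 1) τ (pow-≤2* γ 18 (Θ * D′ + 1) γ>0 γ-large))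
      where
      eq : ∀ d τ → (d + 1) * τ ≡ d * τ + τ
      eq = solve-∀

    private
      γ₂ = g * (g + 2 * r′)

      γ₂>0 : 0 < γ₂
      γ₂>0 = *-mono-≤ g>0 (≤-trans g>0 (m≤m+n g (2 * r′)))

      Θ² : Θ * Θ ≡ γ₂ + r′ * r′
      Θ² = trans (cong (λ x → x * x) Θ≡) (eq g r′)
        where
        eq : ∀ g r → (g + r) * (g + r) ≡ g * (g + 2 * r) + r * r
        eq = solve-∀

    square-loss : (Θ * Θ) ^ l ≤ 2 ^ τ * γ₂ ^ l
    square-loss = *-cancelʳ-≤ _ _ ((Θ * Θ) ^ z) ⦃ m^n≢0 (Θ * Θ) z ⦃ m*n≢0 Θ Θ ⦃ >-nonZero Θ>0 ⦄ ⦃ >-nonZero Θ>0 ⦄ ⦄ ⦄ (begin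
      (Θ * Θ) ^ l * (Θ * Θ) ^ z ≡⟨ sym (^-distribˡ-+-* (Θ * Θ) l z) ⟩
      (Θ * Θ) ^ (l + z) ≡⟨ cong₂ _^_ Θ² (m+[n∸m]≡n l≤) ⟩
      (γ₂ + r′ * r′) ^ (M * τ) ≤⟨ pow-pow-≤ (γ₂ + r′ * r′) γ₂ 2 M τ (pow-≤2* γ₂ (r′ * r′) M γ₂>0 g-large) ⟩
      2 ^ τ * γ₂ ^ (M * τ) ≡⟨ cong (λ k → 2 ^ τ * γ₂ ^ k) (sym (m+[n∸m]≡n l≤)) ⟩
      2 ^ τ * γ₂ ^ (l + z) ≡⟨ cong (2 ^ τ *_) (^-distribˡ-+-* γ₂ l z) ⟩
      2 ^ τ * (γ₂ ^ l * γ₂ ^ z) ≤⟨ *-monoʳ-≤ (2 ^ τ) (*-monoʳ-≤ (γ₂ ^ l) (^-monoˡ-≤ z (≤-trans (m≤m+n γ₂ (r′ * r′)) (≤-reflexive (sym Θ²))))) ⟩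
      2 ^ τ * (γ₂ ^ l * (Θ * Θ) ^ z) ≡⟨ sym (*-assoc (2 ^ τ) (γ₂ ^ l) ((Θ * Θ) ^ z)) ⟩
      2 ^ τ * γ₂ ^ l * (Θ * Θ) ^ z ∎)
      where
      open ≤-Reasoning
      M = 4 * (S * (Θ * D′))
      z = M * τ ∸ l

    -- By Bernoulli, `(1 - r′/Θ) * (1 + 1/Θ)^r′ ≥ 1 - r′²/Θ²`: for equal targets the skewed weights
    -- lose only to second order, and `square-loss` bounds the `l`-th power.
    balanced-loss : Θ ^ (r * l) ≤ 2 ^ τ * (g * suc Θ ^ r′) ^ l
    balanced-loss = *-cancelʳ-≤ _ _ (Θ ^ l) ⦃ m^n≢0 Θ l ⦃ >-nonZero Θ>0 ⦄ ⦄ (begin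
      Θ ^ (l + r′ * l) * Θ ^ l ≡⟨ cong (_* Θ ^ l) (^-distribˡ-+-* Θ l (r′ * l)) ⟩
      Θ ^ l * Θ ^ (r′ * l) * Θ ^ l ≡⟨ eq₁ (Θ ^ l) (Θ ^ (r′ * l)) ⟩
      Θ ^ (r′ * l) * (Θ ^ l * Θ ^ l) ≡⟨ cong₂ _*_ (sym (^-*-assoc Θ r′ l)) (sym (^-distribʳ-* Θ Θ l)) ⟩
      (Θ ^ r′) ^ l * (Θ * Θ) ^ l ≤⟨ *-monoʳ-≤ ((Θ ^ r′) ^ l) square-loss ⟩
      (Θ ^ r′) ^ l * (2 ^ τ * γ₂ ^ l) ≡⟨ eq₂ ((Θ ^ r′) ^ l) (2 ^ τ) (γ₂ ^ l) ⟩
      2 ^ τ * ((Θ ^ r′) ^ l * γ₂ ^ l) ≡⟨ cong (2 ^ τ *_) (sym (^-distribʳ-* (Θ ^ r′) γ₂ l)) ⟩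
      2 ^ τ * (Θ ^ r′ * γ₂) ^ l ≤⟨ *-monoʳ-≤ (2 ^ τ) (^-monoˡ-≤ l (begin
          Θ ^ r′ * (g * (g + 2 * r′)) ≡⟨ eq₃ (Θ ^ r′) g r′ ⟩
          g * (Θ ^ r′ * (g + r′ + r′)) ≡⟨ cong (λ x → g * (Θ ^ r′ * (x + r′))) (sym Θ≡) ⟩
          g * (Θ ^ r′ * (Θ + r′)) ≤⟨ *-monoʳ-≤ g (bernoulli Θ r′) ⟩
          g * (suc Θ ^ r′ * Θ) ≡⟨ sym (*-assoc g (suc Θ ^ r′) Θ) ⟩
          g * suc Θ ^ r′ * Θ ∎)) ⟩
      2 ^ τ * (g * suc Θ ^ r′ * Θ) ^ l ≡⟨ cong (2 ^ τ *_) (^-distribʳ-* (g * suc Θ ^ r′) Θ l) ⟩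
      2 ^ τ * ((g * suc Θ ^ r′) ^ l * Θ ^ l) ≡⟨ sym (*-assoc (2 ^ τ) _ (Θ ^ l)) ⟩
      2 ^ τ * (g * suc Θ ^ r′) ^ l * Θ ^ l ∎)
      where
      open ≤-Reasoning
      eq₁ : ∀ x y → x * y * x ≡ y * (x * x)
      eq₁ = solve-∀
      eq₂ : ∀ x y z → x * (y * z) ≡ y * (x * z)
      eq₂ = solve-∀
      eq₃ : ∀ x g r → x * (g * (g + 2 * r)) ≡ g * (x * (g + r + r))
      eq₃ = solve-∀

    -- The first-order gain for the `t` vertices that the book has already supplied:
    -- `(1 + 1/Θ)^Θ ≥ 2` and `t = Θ * D′ * τ`.
    book-gain : (8 * (r * r)) ^ τ * Θ ^ (r′ * t) ≤ suc Θ ^ (r′ * t)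
    book-gain = begin
      (8 * (r * r)) ^ τ * Θ ^ (r′ * t) ≤⟨ *-monoˡ-≤ (Θ ^ (r′ * t)) (≤-trans (^-monoˡ-≤ τ D′-large) (m≤m^n (pow>0 τ (pow>0 D′ (s≤s z≤n))))) ⟩
      ((2 ^ D′) ^ τ) ^ r′ * Θ ^ (r′ * t) ≡⟨ cong (((2 ^ D′) ^ τ) ^ r′ *_) (trans (cong (Θ ^_) (*-comm r′ t)) (sym (^-*-assoc Θ t r′))) ⟩
      ((2 ^ D′) ^ τ) ^ r′ * (Θ ^ t) ^ r′ ≡⟨ sym (^-distribʳ-* ((2 ^ D′) ^ τ) (Θ ^ t) r′) ⟩
      ((2 ^ D′) ^ τ * Θ ^ t) ^ r′ ≤⟨ ^-monoˡ-≤ r′ (begin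
          (2 ^ D′) ^ τ * Θ ^ t ≡⟨ cong ((2 ^ D′) ^ τ *_) (sym (^-*-assoc Θ (Θ * D′) τ)) ⟩
          (2 ^ D′) ^ τ * (Θ ^ (Θ * D′)) ^ τ ≡⟨ sym (^-distribʳ-* (2 ^ D′) (Θ ^ (Θ * D′)) τ) ⟩
          (2 ^ D′ * Θ ^ (Θ * D′)) ^ τ ≤⟨ ^-monoˡ-≤ τ (doubling-^ Θ D′ Θ>0) ⟩
          (suc Θ ^ (Θ * D′)) ^ τ ≡⟨ ^-*-assoc (suc Θ) (Θ * D′) τ ⟩
          suc Θ ^ t ∎) ⟩
      (suc Θ ^ t) ^ r′ ≡⟨ trans (^-*-assoc (suc Θ) t r′) (cong (suc Θ ^_) (*-comm t r′)) ⟩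
      suc Θ ^ (r′ * t) ∎
      where
      open ≤-Reasoning
      m≤m^n : ∀ {x} → 0 < x → x ≤ x ^ r′
      m≤m^n {x} x>0 = subst (_≤ x ^ r′) (*-identityʳ x) (^-monoʳ-≤ x ⦃ >-nonZero x>0 ⦄ r′>0)

    k : ℕ
    k = t + l

    -- `A / B` is the product of the weights for target `l` in the colour of the book and `k` in the
    -- other `r′` colours.
    A B : ℕ
    A = g ^ l * suc Θ ^ (r′ * k)
    B = (r * Θ) ^ (l + r′ * k)

    -- Two of the three factors `2 ^ τ` in `8 ^ τ` pay for `density-loss` and `balanced-loss`. What
    -- remains pays for `(2 * r) ^ τ` from the regularisation and `r ^ τ` from the boosts.
    reduced-gain : (r * r) ^ τ * 2 ^ τ * ((2 ^ b) ^ m * Θ ^ (l + r′ * k)) ≤ γ ^ m * A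
    reduced-gain = *-cancelˡ-≤ (p * p) ⦃ m*n≢0 p p ⦃ m^n≢0 2 τ ⦄ ⦃ m^n≢0 2 τ ⦄ ⦄ (begin
      p * p * ((r * r) ^ τ * p * ((2 ^ b) ^ m * Θ ^ (l + r′ * k)))
        ≡⟨ cong (λ x → p * p * ((r * r) ^ τ * p * ((2 ^ b) ^ m * x))) split ⟩
      p * p * ((r * r) ^ τ * p * ((2 ^ b) ^ m * (Θ ^ (r * l) * Θ ^ (r′ * t))))
        ≡⟨ eq₁ p ((r * r) ^ τ) ((2 ^ b) ^ m) (Θ ^ (r * l)) (Θ ^ (r′ * t)) ⟩
      (2 ^ b) ^ m * (Θ ^ (r * l) * (p * (p * p) * (r * r) ^ τ * Θ ^ (r′ * t)))
        ≡⟨ cong (λ x → (2 ^ b) ^ m * (Θ ^ (r * l) * (x * Θ ^ (r′ * t)))) eight ⟩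
      (2 ^ b) ^ m * (Θ ^ (r * l) * ((8 * (r * r)) ^ τ * Θ ^ (r′ * t)))
        ≤⟨ *-mono-≤ density-loss (*-mono-≤ balanced-loss book-gain) ⟩
      p * γ ^ m * (p * (g * suc Θ ^ r′) ^ l * suc Θ ^ (r′ * t))
        ≡⟨ eq₂ p (γ ^ m) ((g * suc Θ ^ r′) ^ l) (suc Θ ^ (r′ * t)) ⟩
      p * p * (γ ^ m * ((g * suc Θ ^ r′) ^ l * suc Θ ^ (r′ * t)))
        ≡⟨ cong (λ x → p * p * (γ ^ m * x)) merge ⟩
      p * p * (γ ^ m * A) ∎)
      where
      open ≤-Reasoning
      p = 2 ^ τ
      eq₁ : ∀ p R u v w → p * p * (R * p * (u * (v * w))) ≡ u * (v * (p * (p * p) * R * w))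
      eq₁ = solve-∀
      eq₂ : ∀ p u v w → p * u * (p * v * w) ≡ p * p * (u * (v * w))
      eq₂ = solve-∀
      eq₃ : ∀ r′ t l → l + r′ * (t + l) ≡ suc r′ * l + r′ * t
      eq₃ = solve-∀
      eq₄ : ∀ r′ t l → r′ * (t + l) ≡ r′ * l + r′ * t
      eq₄ = solve-∀
      split : Θ ^ (l + r′ * k) ≡ Θ ^ (r * l) * Θ ^ (r′ * t)
      split = trans (cong (Θ ^_) (eq₃ r′ t l)) (^-distribˡ-+-* Θ (r * l) (r′ * t))
      eight : p * (p * p) * (r * r) ^ τ ≡ (8 * (r * r)) ^ τ
      eight = sym (trans (^-distribʳ-* 8 (r * r) τ) (cong (_* (r * r) ^ τ)
        (trans (^-distribʳ-* 2 4 τ) (cong (p *_) (^-distribʳ-* 2 2 τ)))))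
      merge : (g * suc Θ ^ r′) ^ l * suc Θ ^ (r′ * t) ≡ A
      merge = begin-equality
        (g * suc Θ ^ r′) ^ l * suc Θ ^ (r′ * t) ≡⟨ cong (_* suc Θ ^ (r′ * t)) (^-distribʳ-* g (suc Θ ^ r′) l) ⟩
        g ^ l * (suc Θ ^ r′) ^ l * suc Θ ^ (r′ * t) ≡⟨ cong (λ x → g ^ l * x * suc Θ ^ (r′ * t)) (^-*-assoc (suc Θ) r′ l) ⟩
        g ^ l * suc Θ ^ (r′ * l) * suc Θ ^ (r′ * t) ≡⟨ *-assoc (g ^ l) _ _ ⟩
        g ^ l * (suc Θ ^ (r′ * l) * suc Θ ^ (r′ * t)) ≡⟨ cong (g ^ l *_) (sym (^-distribˡ-+-* (suc Θ) (r′ * l) (r′ * t))) ⟩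
        g ^ l * suc Θ ^ (r′ * l + r′ * t) ≡⟨ cong (λ x → g ^ l * suc Θ ^ x) (sym (eq₄ r′ t l)) ⟩
        A ∎

    total-gain : ∀ W → r ^ (r * k) ≤ W * (2 * r) ^ τ → (r * 2 ^ b) ^ m * B ≤ W * (γ ^ m * A)
    total-gain W h = *-cancelʳ-≤ _ _ ((2 * r) ^ τ) ⦃ m^n≢0 (2 * r) τ ⦄ (begin
      (r * 2 ^ b) ^ m * B * (2 * r) ^ τ
        ≡⟨ cong₂ _*_ (cong₂ _*_ (^-distribʳ-* r (2 ^ b) m) (^-distribʳ-* r Θ (l + r′ * k))) (^-distribʳ-* 2 r τ) ⟩
      r ^ m * (2 ^ b) ^ m * (r ^ (l + r′ * k) * Θ ^ (l + r′ * k)) * (2 ^ τ * r ^ τ)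
        ≡⟨ eq₁ (r ^ m) ((2 ^ b) ^ m) (r ^ (l + r′ * k)) (Θ ^ (l + r′ * k)) (2 ^ τ) (r ^ τ) ⟩
      r ^ m * r ^ (l + r′ * k) * r ^ τ * (2 ^ τ * ((2 ^ b) ^ m * Θ ^ (l + r′ * k)))
        ≡⟨ cong (_* (2 ^ τ * ((2 ^ b) ^ m * Θ ^ (l + r′ * k)))) collect ⟩
      r ^ (r * k) * (r * r) ^ τ * (2 ^ τ * ((2 ^ b) ^ m * Θ ^ (l + r′ * k)))
        ≡⟨ eq₂ (r ^ (r * k)) ((r * r) ^ τ) (2 ^ τ) ((2 ^ b) ^ m * Θ ^ (l + r′ * k)) ⟩
      r ^ (r * k) * ((r * r) ^ τ * 2 ^ τ * ((2 ^ b) ^ m * Θ ^ (l + r′ * k)))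
        ≤⟨ *-mono-≤ h reduced-gain ⟩
      W * (2 * r) ^ τ * (γ ^ m * A)
        ≡⟨ eq₃ W ((2 * r) ^ τ) (γ ^ m * A) ⟩
      W * (γ ^ m * A) * (2 * r) ^ τ ∎)
      where
      open ≤-Reasoning
      eq₁ : ∀ a b c d e f → a * b * (c * d) * (e * f) ≡ a * c * f * (e * (b * d))
      eq₁ = solve-∀
      eq₂ : ∀ a b c d → a * b * (c * d) ≡ a * (b * c * d)
      eq₂ = solve-∀
      eq₃ : ∀ a b c → a * b * c ≡ a * c * b
      eq₃ = solve-∀
      eq₄ : ∀ t τ l r′ → t + τ + (l + r′ * (t + l)) + τ ≡ suc r′ * (t + l) + (τ + τ)
      eq₄ = solve-∀
      collect : r ^ m * r ^ (l + r′ * k) * r ^ τ ≡ r ^ (r * k) * (r * r) ^ τ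
      collect = begin-equality
        r ^ m * r ^ (l + r′ * k) * r ^ τ ≡⟨ cong (_* r ^ τ) (sym (^-distribˡ-+-* r m (l + r′ * k))) ⟩
        r ^ (m + (l + r′ * k)) * r ^ τ ≡⟨ sym (^-distribˡ-+-* r (m + (l + r′ * k)) τ) ⟩
        r ^ (m + (l + r′ * k) + τ) ≡⟨ cong (r ^_) (eq₄ t τ l r′) ⟩
        r ^ (r * k + (τ + τ)) ≡⟨ ^-distribˡ-+-* r (r * k) (τ + τ) ⟩
        r ^ (r * k) * r ^ (τ + τ) ≡⟨ cong (r ^ (r * k) *_) (trans (^-distribˡ-+-* r τ τ) (sym (^-distribʳ-* r r τ))) ⟩
        r ^ (r * k) * (r * r) ^ τ ∎

-- From a regular set to a monochromatic clique.

module Endgames where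

  open Cliques
  open Books
  open Regularity
  open PowerBounds
  open ParameterChoice
  open WeightGain
  open import Data.Nat
  open import Data.Nat.Properties
  open import Data.Nat.Tactic.RingSolver using (solve-∀)
  open import Algebra.Properties.Semiring.Sum +-*-semiring using (sum; *-distribˡ-sum)
  open import Algebra.Properties.CommutativeMonoid.Sum *-1-commutativeMonoid using () renaming (sum to prod)

  sum-update-const : ∀ {n} (F : ℕ → ℕ) x (h : ℕ → ℕ) (i : Fin (suc n)) →
    sum (λ j → F (updateAt (λ _ → x) i h j)) ≡ F (h x) + n * F x
  sum-update-const {n} F x h zero = cong (F (h x) +_) (sum-const n (F x))
  sum-update-const {suc n} F x h (suc i) = trans (cong (F x +_) (sum-update-const F x h i)) (eq (F x) (F (h x)) (n * F x))
    where
    eq : ∀ a b c → a + (b + c) ≡ b + (a + c)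
    eq = solve-∀

  prod-update-const₂ : ∀ {n} (F : ℕ → ℕ → ℕ) x y (h k : ℕ → ℕ) (i : Fin (suc n)) →
    prod (λ j → F (updateAt (λ _ → x) i h j) (updateAt (λ _ → y) i k j)) ≡ F (h x) (k y) * F x y ^ n
  prod-update-const₂ {n} F x y h k zero = cong (F (h x) (k y) *_) (prod-const n (F x y))
  prod-update-const₂ {suc n} F x y h k (suc i) =
    trans (cong (F x y *_) (prod-update-const₂ F x y h k i)) (eq (F x y) (F (h x) (k y)) (F x y ^ n))
    where
    eq : ∀ a b c → a * (b * c) ≡ b * (a * c)
    eq = solve-∀

  sum≤term+rest : ∀ {n} (f : Fin (suc n) → ℕ) b → (∀ i → f i ≤ b) → ∀ i → sum f ≤ f i + n * b
  sum≤term+rest {n} f b h zero = +-monoʳ-≤ (f zero) (≤-trans (sum-mono (h ∘ suc)) (≤-reflexive (sum-const n b)))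
  sum≤term+rest {suc n} f b h (suc i) = ≤-trans (+-mono-≤ (h zero) (sum≤term+rest (f ∘ suc) b (h ∘ suc) i))
    (≤-reflexive (eq b (f (suc i)) (n * b)))
    where
    eq : ∀ a b c → a + (b + c) ≡ b + (a + c)
    eq = solve-∀

  -- S is k/t up to a factor 4, and τ = 4^T is both the number of regularisation steps and the boost budget.
  module Endgame {r′ n} (c : EdgeColouring (suc r′) n) (r′>0 : 0 < r′)
    (a′ x y b γ Θ g D′ S l : ℕ) (g>0 : 0 < g) (γ>0 : 0 < γ) (D′>0 : 0 < D′) (Θ≡ : Θ ≡ g + r′)
    (D′-large : 8 * (suc r′ * suc r′) ≤ 2 ^ D′) (2^b≡ : 2 ^ b ≡ γ + 18)
    (γ-large : 2 * (Θ * D′ + 1) * 18 ≤ γ)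
    (g-large : 2 * (4 * (S * (Θ * D′))) * (r′ * r′) ≤ g * (g + 2 * r′))
    (full : Θ * D′ * (b + suc r′) ≤ 4 ^ a′)
    (fineness : 24 * (suc r′ * suc r′) * 2 ^ b * (Θ * D′) ≤ 4 ^ y) (y≤x : y ≤ x)
    (S≡ : S ≡ 2 * (suc r′ * ((3 + 8 * suc r′) * 2 ^ (suc r′ + 2 + a′))))
    (St≤k : S * (Θ * D′ * 4 ^ (1 + a′ + x)) ≤ Θ * D′ * 4 ^ (1 + a′ + x) + l)
    (l≤ : l ≤ 4 * (S * (Θ * D′)) * 4 ^ (1 + a′ + x))
    (r+b≤k : suc r′ + b ≤ Θ * D′ * 4 ^ (1 + a′ + x) + l) where

    open Colouring c

    private
      module Gn = Gain r′ Θ g D′ γ b S (4 ^ (1 + a′ + x)) l r′>0 g>0 γ>0 Θ≡ D′-large 2^b≡ γ-large g-large l≤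

      D₀>0 : 0 < Θ * D′
      D₀>0 = *-mono-≤ Gn.Θ>0 D′>0

      A>0 : 0 < Gn.A
      A>0 = *-mono-≤ (pow>0 l g>0) (pow>0 (r′ * Gn.k) (s≤s z≤n))

      B>0 : 0 < Gn.B
      B>0 = pow>0 (l + r′ * Gn.k) (*-mono-≤ {1} {suc r′} (s≤s z≤n) Gn.Θ>0)

      module Ch = Choice (suc r′) a′ x y b (Θ * D′) γ Gn.A Gn.B (s≤s z≤n) D₀>0 B>0 full 2^b≡ fineness y≤x

    open Gn using (r; t; m; k; A; B)
    open Ch using (τ; T; a; N; V; U; P)

    E : ℕ
    E = r * 2 ^ b

    E>0 : 0 < E
    E>0 = *-mono-≤ {1} {r} (s≤s z≤n) (pow>0 b (s≤s z≤n))

    open Regularisation c r′>0 E E>0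

    τ≤t : τ ≤ t
    τ≤t = m≤n*m τ (Θ * D′) ⦃ >-nonZero D₀>0 ⦄

    module _ (W : VSet n) (regular : Regular W) (W-large : r ^ (r * k) ≤ card W * (2 * r) ^ τ) where

      2τ≤k : τ + τ ≤ k
      2τ≤k = begin
        τ + τ ≤⟨ +-mono-≤ τ≤t τ≤t ⟩
        t + t ≡⟨ cong (t +_) (sym (+-identityʳ t)) ⟩
        2 * t ≤⟨ *-monoˡ-≤ t (≤-trans (*-monoʳ-≤ 2 (*-mono-≤ {1} {r} (s≤s z≤n) (*-mono-≤ {1} {3 + 8 * r} (s≤s z≤n) (pow>0 a (s≤s z≤n))))) (≤-reflexive (sym S≡))) ⟩
        S * t ≤⟨ St≤k ⟩
        k ∎
        where open ≤-Reasoning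

      2^k≤W : 2 ^ k ≤ card W
      2^k≤W = *-cancelʳ-≤ _ _ ((2 * r) ^ τ) ⦃ m^n≢0 (2 * r) τ ⦄ (begin
        2 ^ k * (2 * r) ^ τ ≤⟨ *-mono-≤ (^-monoˡ-≤ k 2≤r) (^-monoˡ-≤ τ (*-monoˡ-≤ r 2≤r)) ⟩
        r ^ k * (r * r) ^ τ ≡⟨ cong (r ^ k *_) (trans (^-distribʳ-* r r τ) (sym (^-distribˡ-+-* r τ τ))) ⟩
        r ^ k * r ^ (τ + τ) ≤⟨ *-monoʳ-≤ (r ^ k) (^-monoʳ-≤ r 2τ≤k) ⟩
        r ^ k * r ^ k ≡⟨ sym (^-distribˡ-+-* r k k) ⟩
        r ^ (k + k) ≡⟨ cong (λ z → r ^ (k + z)) (sym (+-identityʳ k)) ⟩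
        r ^ (2 * k) ≤⟨ ^-monoʳ-≤ r (*-monoˡ-≤ k 2≤r) ⟩
        r ^ (r * k) ≤⟨ W-large ⟩
        card W * (2 * r) ^ τ ∎)
        where
        open ≤-Reasoning
        2≤r : 2 ≤ r
        2≤r = s≤s r′>0

      -- Lets `colour-degree` absorb the vertex `v` itself.
      E≤W : E ≤ card W
      E≤W = begin
        r * 2 ^ b ≤⟨ *-monoˡ-≤ (2 ^ b) (<⇒≤ (n<2^n r)) ⟩
        2 ^ r * 2 ^ b ≡⟨ sym (^-distribˡ-+-* 2 r b) ⟩
        2 ^ (r + b) ≤⟨ ^-monoʳ-≤ 2 r+b≤k ⟩
        2 ^ k ≤⟨ 2^k≤W ⟩
        card W ∎
        where open ≤-Reasoning

      -- Regularity bounds the degrees in the other colours from above.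
      colour-degree : ∀ i v → v ∈ W → 2 ^ b * card W ≤ E * card (W ∩ nb i v) + 2 * card W
      colour-degree i v v∈W = *-cancelˡ-≤ r (+-cancelʳ-≤ (r′ * E * w) _ _ (begin
        r * (2 ^ b * w) + r′ * E * w ≡⟨ eq₁ r′ (2 ^ b) w ⟩
        E * r * w ≤⟨ *-monoʳ-≤ (E * r) (card≤1+nbs W v) ⟩
        E * r * (1 + sum d) ≡⟨ *-distribˡ-+ (E * r) 1 (sum d) ⟩
        E * r * 1 + E * r * sum d ≡⟨ cong₂ _+_ (*-identityʳ (E * r)) (*-distribˡ-sum (E * r) d) ⟩
        E * r + sum (λ j → E * r * d j) ≤⟨ +-monoʳ-≤ (E * r) (sum≤term+rest (λ j → E * r * d j) (suc E * w) (λ j → regular j v v∈W) i) ⟩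
        E * r + (E * r * d i + r′ * (suc E * w)) ≤⟨ +-monoˡ-≤ _ (*-monoˡ-≤ r E≤W) ⟩
        w * r + (E * r * d i + r′ * (suc E * w)) ≤⟨ m≤m+n _ w ⟩
        w * r + (E * r * d i + r′ * (suc E * w)) + w ≡⟨ eq₂ r′ E w (d i) ⟩
        r * (E * d i + 2 * w) + r′ * E * w ∎))
        where
        open ≤-Reasoning
        w = card W
        d : Fin r → ℕ
        d j = card (W ∩ nb j v)
        eq₁ : ∀ r β w → suc r * (β * w) + r * (suc r * β) * w ≡ suc r * β * suc r * w
        eq₁ = solve-∀
        eq₂ : ∀ r E w d → w * suc r + (E * suc r * d + r * (suc E * w)) + w ≡ suc r * (E * d + 2 * w) + r * E * w
        eq₂ = solve-∀

      X-size : P ^ (r * (t + τ)) ≤ card W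
      X-size = begin
        P ^ (r * (t + τ)) ≡⟨ ^-*-assoc 2 ((3 + 8 * r) * 2 ^ a) (r * (t + τ)) ⟩
        2 ^ ((3 + 8 * r) * 2 ^ a * (r * (t + τ))) ≤⟨ ^-monoʳ-≤ 2 (begin
            (3 + 8 * r) * 2 ^ a * (r * (t + τ)) ≤⟨ *-monoʳ-≤ ((3 + 8 * r) * 2 ^ a) (*-monoʳ-≤ r (+-monoʳ-≤ t τ≤t)) ⟩
            (3 + 8 * r) * 2 ^ a * (r * (t + t)) ≡⟨ eq ((3 + 8 * r) * 2 ^ a) r t ⟩
            2 * (r * ((3 + 8 * r) * 2 ^ a)) * t ≡⟨ cong (_* t) (sym S≡) ⟩
            S * t ≤⟨ St≤k ⟩
            k ∎) ⟩
        2 ^ k ≤⟨ 2^k≤W ⟩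
        card W ∎
        where
        open ≤-Reasoning
        eq : ∀ c r t → c * (r * (t + t)) ≡ 2 * (r * c) * t
        eq = solve-∀

      Y-size : V ^ (t + τ) * B ≤ card W * (U ^ (t + τ) * A)
      Y-size = begin
        (E * t ^ N) ^ m * B ≡⟨ cong (_* B) (^-distribʳ-* E (t ^ N) m) ⟩
        E ^ m * (t ^ N) ^ m * B ≡⟨ eq₁ (E ^ m) ((t ^ N) ^ m) B ⟩
        E ^ m * B * (t ^ N) ^ m ≤⟨ *-monoˡ-≤ ((t ^ N) ^ m) (Gn.total-gain (card W) W-large) ⟩
        card W * (γ ^ m * A) * (t ^ N) ^ m ≡⟨ eq₂ (card W) (γ ^ m) A ((t ^ N) ^ m) ⟩
        card W * (γ ^ m * (t ^ N) ^ m * A) ≡⟨ cong (λ z → card W * (z * A)) (sym (^-distribʳ-* γ (t ^ N) m)) ⟩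
        card W * (U ^ m * A) ∎
        where
        open ≤-Reasoning
        eq₁ : ∀ a b c → a * b * c ≡ a * c * b
        eq₁ = solve-∀
        eq₂ : ∀ a b c d → a * (b * c) * d ≡ a * (b * d * c)
        eq₂ = solve-∀

      open Potential t N Ch.t≥2 using (ψ; ψ-2t)

      -- The `18` is made up of `16` for `ψ (2 * t)` and `2` for the irregularity allowed by
      -- `colour-degree`.
      Y-dense : ∀ i u → u ∈ W → card W * (U + ψ (2 * t)) ≤ card (W ∩ nb i u) * V
      Y-dense i u u∈W = begin
        w * (γ * q + ψ (2 * t)) ≤⟨ *-monoʳ-≤ w (+-monoʳ-≤ (γ * q) (ψ-2t (2 * (Θ * D′ * 4 ^ (a′ + x))) Ch.t≡ (m≤m+n (2 * t) _))) ⟩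
        w * (γ * q + 16 * q) ≡⟨ eq₁ w γ q ⟩
        (γ + 16) * w * q ≤⟨ *-monoˡ-≤ q (+-cancelʳ-≤ (2 * w) ((γ + 16) * w) (E * d) (begin
            (γ + 16) * w + 2 * w ≡⟨ eq₂ γ w ⟩
            (γ + 18) * w ≡⟨ cong (_* w) (sym 2^b≡) ⟩
            2 ^ b * w ≤⟨ colour-degree i u u∈W ⟩
            E * d + 2 * w ∎)) ⟩
        E * d * q ≡⟨ eq₃ E d q ⟩
        d * (E * q) ∎
        where
        open ≤-Reasoning
        w = card W
        d = card (W ∩ nb i u)
        q = t ^ N
        eq₁ : ∀ w γ q → w * (γ * q + 16 * q) ≡ (γ + 16) * w * q
        eq₁ = solve-∀
        eq₂ : ∀ γ w → (γ + 16) * w + 2 * w ≡ (γ + 18) * w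
        eq₂ = solve-∀
        eq₃ : ∀ a b c → a * b * c ≡ b * (a * c)
        eq₃ = solve-∀

      -- Inside `Y` colour `i` needs `t` vertices fewer, so its weight can be lowered to `g` in
      -- favour of the other colours.
      book⇒clique : ∀ i (Y : VSet n) → Y ⊆ W → (∀ j → Clique i j Y → Clique i (t + j) W) → B ≤ card Y * A →
        ∃ λ i → Clique i k W
      book⇒clique i Y Y⊆W extend B≤ = final good
        where
        weights target : Fin r → ℕ
        weights = updateAt (λ _ → suc Θ) i (λ _ → g)
        target = updateAt (λ _ → k) i (_∸ t)

        k∸t : k ∸ t ≡ l
        k∸t = m+n∸m≡n t l

        Σtarget : sum target ≡ l + r′ * k
        Σtarget = trans (sum-update-const (λ z → z) k (_∸ t) i) (cong (_+ r′ * k) k∸t)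

        Σweights : sum weights ≡ r * Θ
        Σweights = trans (sum-update-const (λ z → z) (suc Θ) (λ _ → g) i)
          (trans (eq g r′ Θ) (cong (_+ r′ * Θ) (sym Θ≡)))
          where
          eq : ∀ g r Θ → g + r * suc Θ ≡ g + r + r * Θ
          eq = solve-∀

        open ErdősSzekeres c weights (r * Θ) (≤-reflexive Σweights)

        weight≡ : weight target ≡ A
        weight≡ = trans (prod-update-const₂ _^_ (suc Θ) k (λ _ → g) (_∸ t) i)
          (cong₂ (λ z w → g ^ z * w) k∸t (trans (^-*-assoc (suc Θ) k r′) (cong (suc Θ ^_) (*-comm k r′))))

        good : Good Y target
        good = weighted-bound (l + r′ * k) target Y Σtarget
          (subst (λ z → (r * Θ) ^ (l + r′ * k) < (r′ * card Y + 1) * z) (sym weight≡)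
            (strengthen B (card Y) A A>0 B≤))

        final : Good Y target → ∃ λ i → Clique i k W
        final (j , q) with j ≟ᶠ i
        ... | yes refl = j , subst (λ z → Clique j z W) (m+[n∸m]≡n (m≤m+n t l))
                (extend (k ∸ t) (subst (λ z → Clique j z Y) (updateAt-updates j (λ _ → k)) q))
        ... | no j≢i = j , Clique-mono Y⊆W (subst (λ z → Clique j z Y) (updateAt-minimal j i (λ _ → k) j≢i) q)

      regular⇒clique : ∃ λ i → Clique i k W
      regular⇒clique =
        let (i , Y , Y⊆W , extend , B≤) = BookAlgorithm.book c (s≤s z≤n) (Ch.parameters γ>0) W X-size Y-size Y-dense
        in book⇒clique i Y Y⊆W extend B≤

    mono-clique : r ^ (r * k) * E ^ τ ≤ n * suc E ^ τ → MonoClique c k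
    mono-clique n-large = Good⇒MonoClique k
      (regularise (r ^ (r * k)) τ k regular⇒clique 0 τ (λ _ → k) (λ _ → true) refl (λ _ → ≤-refl)
        (≤-reflexive (cong (r ^_) (sym (trans (+-identityʳ _) (sum-const r k)))))
        (subst₂ (λ z w → r ^ z * E ^ τ ≤ w * suc E ^ τ) (sym (sum-const r k)) (sym (card-full n)) n-large))

-- From the saving in `τ` to a saving exponential in `k`.

module Asymptotics where

  open Regularity using (^-distribʳ-*)
  open PowerBounds
  open Endgames
  open import Data.Nat
  open import Data.Nat.DivMod using (m/n*n≤m; m%n<n; m≡m%n+[m/n]*n)
  open import Data.Nat.Properties
  open import Data.Nat.Tactic.RingSolver using (solve-∀)

  n<4^n : ∀ n → n < 4 ^ n
  n<4^n n = <-≤-trans (n<2^n n) (2^≤4^ n)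

  -- The construction has `τ` a power of `4`, so it fits a given `k` only up to a factor `4`.
  between-powers : ∀ C k m → 0 < C → C * 4 ^ m ≤ k → ∃ λ x → m ≤ x × C * 4 ^ x ≤ k × k < C * 4 ^ suc x
  between-powers C k m C>0 h = go k m ≤-refl h (≤-trans (<⇒≤ (n<4^n k)) (≤-trans (^-monoʳ-≤ 4 (≤-trans (m≤n+m k m) (n≤1+n (m + k)))) (m≤n*m _ C ⦃ >-nonZero C>0 ⦄)))
    where
    go : ∀ fuel x → m ≤ x → C * 4 ^ x ≤ k → k ≤ C * 4 ^ suc (x + fuel) → ∃ λ x → m ≤ x × C * 4 ^ x ≤ k × k < C * 4 ^ suc x
    go fuel x m≤x lo hi with k <? C * 4 ^ suc x
    ... | yes k< = x , m≤x , lo , k<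
    go zero x m≤x lo hi | no k≮ = suc x , ≤-trans m≤x (n≤1+n x) , ≮⇒≥ k≮ ,
      ≤-<-trans hi (*-monoʳ-< C ⦃ >-nonZero C>0 ⦄ (^-monoʳ-< 4 (s≤s (s≤s z≤n)) (s≤s (≤-trans (≤-reflexive (cong suc (+-identityʳ x))) ≤-refl))))
    go (suc fuel) x m≤x lo hi | no k≮ = go fuel (suc x) (≤-trans m≤x (n≤1+n x)) (≮⇒≥ k≮)
      (subst (λ z → k ≤ C * 4 ^ suc z) (+-suc x fuel) hi)

  module Asymptotic (r′ a′ b γ Θ g D′ S : ℕ) (r′>0 : 0 < r′) (g>0 : 0 < g) (γ>0 : 0 < γ) (D′>0 : 0 < D′) (b≤ : b ≤ 4 * a′)
    (Θ≡ : Θ ≡ g + r′) (D′-large : 8 * (suc r′ * suc r′) ≤ 2 ^ D′) (2^b≡ : 2 ^ b ≡ γ + 18)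
    (γ-large : 2 * (Θ * D′ + 1) * 18 ≤ γ)
    (g-large : 2 * (4 * (S * (Θ * D′))) * (r′ * r′) ≤ g * (g + 2 * r′))
    (full : Θ * D′ * (b + suc r′) ≤ 4 ^ a′)
    (S≡ : S ≡ 2 * (suc r′ * ((3 + 8 * suc r′) * 2 ^ (suc r′ + 2 + a′)))) where

    r D₀ y E H M C x₀ : ℕ
    r = suc r′
    D₀ = Θ * D′
    -- Since `n < 4 ^ n`, the quantity to be bounded in `fineness` can itself serve as the exponent.
    y = 24 * (r * r) * 2 ^ b * D₀
    E = r * 2 ^ b
    H = 4 * (S * D₀)
    M = 4 * H * E
    C = S * D₀ * 4 ^ (1 + a′)
    -- Makes `x` at least each of `y`, `r` and `E`.
    x₀ = y + (r + E)

    D₀>0 : 0 < D₀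
    D₀>0 = *-mono-≤ {1} {Θ} (subst (1 ≤_) (sym Θ≡) (≤-trans g>0 (m≤m+n g r′))) D′>0

    S>0 : 0 < S
    S>0 = subst (0 <_) (sym S≡) (*-mono-≤ {1} {2} (s≤s z≤n) (*-mono-≤ {1} {r} (s≤s z≤n)
      (*-mono-≤ {1} {3 + 8 * r} (s≤s z≤n) (pow>0 (suc r′ + 2 + a′) (s≤s z≤n)))))

    E>0 : 0 < E
    E>0 = *-mono-≤ {1} {r} (s≤s z≤n) (pow>0 b (s≤s z≤n))

    H>0 : 0 < H
    H>0 = *-mono-≤ {1} {4} (s≤s z≤n) (*-mono-≤ S>0 D₀>0)

    M>0 : 0 < M
    M>0 = *-mono-≤ (*-mono-≤ {1} {4} (s≤s z≤n) H>0) E>0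

    C>0 : 0 < C
    C>0 = *-mono-≤ (*-mono-≤ S>0 D₀>0) (pow>0 (1 + a′) (s≤s z≤n))

    -- `(1 + 1/M)^(2H) ≤ 1 + 4H/M`, and `M = 4 * H * E` makes the right side `1 + 1/E`.
    ratio : E ^ 1 * suc M ^ (2 * H) ≤ suc E ^ 1 * M ^ (2 * H)
    ratio = *-cancelˡ-≤ M ⦃ >-nonZero M>0 ⦄ (begin
      M * (E ^ 1 * suc M ^ (2 * H)) ≡⟨ eq₁ M E (suc M ^ (2 * H)) ⟩
      E * (M * suc M ^ (2 * H)) ≡⟨ cong (λ z → E * (M * z ^ (2 * H))) (+-comm 1 M) ⟩
      E * (M * (M + 1) ^ (2 * H)) ≤⟨ *-monoʳ-≤ E (pow-upper M 1 (2 * H)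
          (≤-trans (≤-reflexive (eq₂ H)) (m≤m*n (4 * H) E ⦃ >-nonZero E>0 ⦄))) ⟩
      E * ((M + 2 * (2 * H) * 1) * M ^ (2 * H)) ≡⟨ eq₃ E H (M ^ (2 * H)) ⟩
      M * (suc E ^ 1 * M ^ (2 * H)) ∎)
      where
      open ≤-Reasoning
      eq₁ : ∀ M E z → M * (E * 1 * z) ≡ E * (M * z)
      eq₁ = solve-∀
      eq₂ : ∀ H → 2 * (2 * H) * 1 ≡ 4 * H
      eq₂ = solve-∀
      eq₃ : ∀ E H z → E * ((4 * H * E + 2 * (2 * H) * 1) * z) ≡ 4 * H * E * (suc E * 1 * z)
      eq₃ = solve-∀

    ratio-^ : ∀ j k → k ≤ 2 * H * j → E ^ j * suc M ^ k ≤ suc E ^ j * M ^ k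
    ratio-^ j k k≤ = *-cancelʳ-≤ _ _ (M ^ z) ⦃ m^n≢0 M z ⦃ >-nonZero M>0 ⦄ ⦄ (begin
      E ^ j * suc M ^ k * M ^ z ≤⟨ *-monoʳ-≤ (E ^ j * suc M ^ k) (^-monoˡ-≤ z (n≤1+n M)) ⟩
      E ^ j * suc M ^ k * suc M ^ z ≡⟨ collect E (suc M) ⟩
      (E ^ 1 * suc M ^ (2 * H)) ^ j ≤⟨ ^-monoˡ-≤ j ratio ⟩
      (suc E ^ 1 * M ^ (2 * H)) ^ j ≡⟨ sym (collect (suc E) M) ⟩
      suc E ^ j * M ^ k * M ^ z ∎)
      where
      open ≤-Reasoning
      z = 2 * H * j ∸ k
      collect : ∀ e m → e ^ j * m ^ k * m ^ z ≡ (e ^ 1 * m ^ (2 * H)) ^ j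
      collect e m = begin-equality
        e ^ j * m ^ k * m ^ z ≡⟨ *-assoc (e ^ j) (m ^ k) (m ^ z) ⟩
        e ^ j * (m ^ k * m ^ z) ≡⟨ cong (e ^ j *_) (sym (^-distribˡ-+-* m k z)) ⟩
        e ^ j * m ^ (k + z) ≡⟨ cong (λ w → e ^ j * m ^ w) (m+[n∸m]≡n k≤) ⟩
        e ^ j * m ^ (2 * H * j) ≡⟨ cong₂ _*_ (cong (_^ j) (sym (*-identityʳ e))) (sym (^-*-assoc m (2 * H) j)) ⟩
        (e ^ 1) ^ j * (m ^ (2 * H)) ^ j ≡⟨ sym (^-distribʳ-* (e ^ 1) (m ^ (2 * H)) j) ⟩
        (e ^ 1 * m ^ (2 * H)) ^ j ∎

    double-ratio : ∀ j → E ≤ j → 2 * E ^ j ≤ suc E ^ j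
    double-ratio j E≤j = begin
      2 * E ^ j ≡⟨ cong (λ z → 2 * E ^ z) (sym (m+[n∸m]≡n E≤j)) ⟩
      2 * E ^ (E + z) ≡⟨ cong (2 *_) (^-distribˡ-+-* E E z) ⟩
      2 * (E ^ E * E ^ z) ≡⟨ sym (*-assoc 2 (E ^ E) (E ^ z)) ⟩
      2 * E ^ E * E ^ z ≤⟨ *-mono-≤ (doubling E E>0) (^-monoˡ-≤ z (n≤1+n E)) ⟩
      suc E ^ E * suc E ^ z ≡⟨ sym (^-distribˡ-+-* (suc E) E z) ⟩
      suc E ^ (E + z) ≡⟨ cong (suc E ^_) (m+[n∸m]≡n E≤j) ⟩
      suc E ^ j ∎
      where
      open ≤-Reasoning
      z = j ∸ E

    module Scale (x k : ℕ) (x₀≤x : x₀ ≤ x) (k-lower : C * 4 ^ x ≤ k) (k-upper : k < C * 4 ^ suc x) where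

      T τ t : ℕ
      T = 1 + a′ + x
      τ = 4 ^ T
      t = D₀ * τ

      St≤k : S * t ≤ k
      St≤k = ≤-trans (≤-reflexive (trans (cong (λ z → S * (D₀ * z)) (^-distribˡ-+-* 4 (1 + a′) x)) (eq S D₀ (4 ^ (1 + a′)) (4 ^ x)))) k-lower
        where
        eq : ∀ s d u v → s * (d * (u * v)) ≡ s * d * u * v
        eq = solve-∀

      t≤k : t ≤ k
      t≤k = ≤-trans (m≤n*m t S ⦃ >-nonZero S>0 ⦄) St≤k

      τ≤k : τ ≤ k
      τ≤k = ≤-trans (m≤n*m τ D₀ ⦃ >-nonZero D₀>0 ⦄) t≤k

      k≤Hτ : k ≤ H * τ
      k≤Hτ = ≤-trans (<⇒≤ k-upper) (≤-reflexive (trans (eq (S * D₀) (4 ^ (1 + a′)) (4 ^ x)) (cong (λ z → 4 * (S * D₀) * z) (sym (^-distribˡ-+-* 4 (1 + a′) x)))))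
        where
        eq : ∀ s u v → s * u * (4 * v) ≡ 4 * s * (u * v)
        eq = solve-∀

      r+b≤k : r + b ≤ k
      r+b≤k = begin
        r + b ≤⟨ +-mono-≤ (≤-trans (m≤m+n r E) (≤-trans (m≤n+m (r + E) y) x₀≤x)) b≤ ⟩
        x + 4 * a′ ≤⟨ +-monoˡ-≤ (4 * a′) (m≤m+n x (3 * x)) ⟩
        4 * x + 4 * a′ ≡⟨ eq x a′ ⟩
        4 * (a′ + x) ≤⟨ *-monoʳ-≤ 4 (<⇒≤ (n<4^n (a′ + x))) ⟩
        τ ≤⟨ τ≤k ⟩
        k ∎
        where
        open ≤-Reasoning
        eq : ∀ x a → 4 * x + 4 * a ≡ 4 * (a + x)
        eq = solve-∀

      clique : ∀ {n} (c : EdgeColouring r n) → r ^ (r * k) * E ^ τ ≤ n * suc E ^ τ → MonoClique c k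
      clique {n} c h = subst (MonoClique c) t+l≡k
        (Endgame.mono-clique c r′>0 a′ x y b γ Θ g D′ S l g>0 γ>0 D′>0 Θ≡ D′-large 2^b≡ γ-large g-large full
          (<⇒≤ (n<4^n y)) (≤-trans (m≤m+n y (r + E)) x₀≤x) S≡
          (subst (S * t ≤_) (sym t+l≡k) St≤k) (≤-trans (m∸n≤m k t) k≤Hτ) (subst (r + b ≤_) (sym t+l≡k) r+b≤k)
          (subst (λ z → r ^ (r * z) * E ^ τ ≤ n * suc E ^ τ) (sym t+l≡k) h))
        where
        l = k ∸ t
        t+l≡k : t + l ≡ k
        t+l≡k = m+[n∸m]≡n t≤k

      instance
        suc-E^τ≢0 : NonZero (suc E ^ τ)
        suc-E^τ≢0 = m^n≢0 (suc E) τ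

      R n : ℕ
      R = r ^ (r * k)
      n = suc (R * E ^ τ / suc E ^ τ)

      n-large : R * E ^ τ ≤ n * suc E ^ τ
      n-large = ≤-trans (≤-reflexive (m≡m%n+[m/n]*n (R * E ^ τ) (suc E ^ τ)))
        (+-monoˡ-≤ (R * E ^ τ / suc E ^ τ * suc E ^ τ) (<⇒≤ (m%n<n (R * E ^ τ) (suc E ^ τ))))

      n-small : n * suc E ^ τ ≤ 2 * (R * E ^ τ)
      n-small = begin
        suc E ^ τ + R * E ^ τ / suc E ^ τ * suc E ^ τ ≤⟨ +-mono-≤ enough (m/n*n≤m (R * E ^ τ) (suc E ^ τ)) ⟩
        R * E ^ τ + R * E ^ τ ≡⟨ cong (R * E ^ τ +_) (sym (+-identityʳ (R * E ^ τ))) ⟩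
        2 * (R * E ^ τ) ∎
        where
        open ≤-Reasoning
        enough : suc E ^ τ ≤ R * E ^ τ
        enough = begin
          suc E ^ τ ≤⟨ ^-monoˡ-≤ τ (≤-trans (+-monoˡ-≤ E E>0) (≤-reflexive (cong (E +_) (sym (+-identityʳ E))))) ⟩
          (2 * E) ^ τ ≡⟨ ^-distribʳ-* 2 E τ ⟩
          2 ^ τ * E ^ τ ≤⟨ *-monoˡ-≤ (E ^ τ) (≤-trans (^-monoˡ-≤ τ (s≤s r′>0)) (^-monoʳ-≤ r (≤-trans τ≤k (m≤n*m k r)))) ⟩
          R * E ^ τ ∎

      τ′ : ℕ
      τ′ = 4 ^ (a′ + x)

      E≤ : E ≤ 2 * τ′
      E≤ = begin
        E ≤⟨ ≤-trans (m≤n+m E r) (≤-trans (m≤n+m (r + E) y) x₀≤x) ⟩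
        x ≤⟨ m≤n+m x a′ ⟩
        a′ + x ≤⟨ <⇒≤ (n<4^n (a′ + x)) ⟩
        τ′ ≤⟨ m≤n*m τ′ 2 ⟩
        2 * τ′ ∎
        where open ≤-Reasoning

      -- One half of the `τ` factors `1 + 1/E` yields `(1 + 1/M)^k`, the other half pays the factor
      -- `2` for rounding `n` up.
      saving : 2 * E ^ τ * suc M ^ k ≤ suc E ^ τ * M ^ k
      saving = begin
        2 * E ^ τ * suc M ^ k ≡⟨ cong (λ z → 2 * z * suc M ^ k) (split E) ⟩
        2 * (E ^ j * E ^ j) * suc M ^ k ≡⟨ eq₁ (E ^ j) (suc M ^ k) ⟩
        2 * E ^ j * (E ^ j * suc M ^ k) ≤⟨ *-mono-≤ (double-ratio j E≤) (ratio-^ j k (≤-trans k≤Hτ (≤-reflexive (eq₂ H τ′)))) ⟩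
        suc E ^ j * (suc E ^ j * M ^ k) ≡⟨ sym (*-assoc (suc E ^ j) (suc E ^ j) (M ^ k)) ⟩
        suc E ^ j * suc E ^ j * M ^ k ≡⟨ cong (_* M ^ k) (sym (split (suc E))) ⟩
        suc E ^ τ * M ^ k ∎
        where
        open ≤-Reasoning
        j = 2 * τ′
        eq₁ : ∀ u v → 2 * (u * u) * v ≡ 2 * u * (u * v)
        eq₁ = solve-∀
        eq₂ : ∀ h τ → h * (4 * τ) ≡ 2 * h * (2 * τ)
        eq₂ = solve-∀
        eq₃ : ∀ τ → 4 * τ ≡ 2 * τ + 2 * τ
        eq₃ = solve-∀
        split : ∀ e → e ^ τ ≡ e ^ j * e ^ j
        split e = trans (cong (e ^_) (eq₃ τ′)) (^-distribˡ-+-* e j j)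

      n-bound : suc M ^ k * n ≤ M ^ k * R
      n-bound = *-cancelʳ-≤ _ _ (suc E ^ τ) (begin
        suc M ^ k * n * suc E ^ τ ≡⟨ *-assoc (suc M ^ k) n (suc E ^ τ) ⟩
        suc M ^ k * (n * suc E ^ τ) ≤⟨ *-monoʳ-≤ (suc M ^ k) n-small ⟩
        suc M ^ k * (2 * (R * E ^ τ)) ≡⟨ eq₁ (suc M ^ k) R (E ^ τ) ⟩
        2 * E ^ τ * suc M ^ k * R ≤⟨ *-monoˡ-≤ R saving ⟩
        suc E ^ τ * M ^ k * R ≡⟨ eq₂ (suc E ^ τ) (M ^ k) R ⟩
        M ^ k * R * suc E ^ τ ∎)
        where
        open ≤-Reasoning
        eq₁ : ∀ m R e → m * (2 * (R * e)) ≡ 2 * e * m * R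
        eq₁ = solve-∀
        eq₂ : ∀ e m R → e * m * R ≡ m * R * e
        eq₂ = solve-∀

    ramsey-bound : ∀ k → C * 4 ^ x₀ ≤ k → RamseyAtMostScaled r k M (suc M) (r ^ (r * k))
    ramsey-bound k K≤k =
      let (x , x₀≤x , lower , upper) = between-powers C k x₀ C>0 K≤k
          module Sc = Scale x k x₀≤x lower upper
      in Sc.n , Sc.n-bound , λ c → Sc.clique c Sc.n-large

-- Constants that close the circle of requirements.

module Conclusion where

  open PowerBounds
  open Asymptotics
  open import Data.Nat
  open import Data.Nat.Properties
  open import Data.Nat.Tactic.RingSolver using (solve-∀)

  linear≤exponential : ∀ C e → ∃ λ a → C * (2 * a + e) ≤ 2 ^ a
  linear≤exponential C e = 4 * z , (begin
    C * (2 * (4 * z) + e) ≤⟨ *-mono-≤ (≤-trans (m≤m+n C e) (m≤m+n (C + e) 2)) (+-monoʳ-≤ (2 * (4 * z)) (≤-trans (m≤n+m e C) (m≤m+n (C + e) 2))) ⟩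
    z * (2 * (4 * z) + z) ≡⟨ eq₁ z ⟩
    3 * z * (3 * z) ≤⟨ *-mono-≤ 3z≤ 3z≤ ⟩
    2 ^ z * 2 ^ z * (2 ^ z * 2 ^ z) ≡⟨ eq₂ (2 ^ z) ⟩
    (2 ^ z) ^ 4 ≡⟨ ^-*-assoc 2 z 4 ⟩
    2 ^ (z * 4) ≡⟨ cong (2 ^_) (*-comm z 4) ⟩
    2 ^ (4 * z) ∎)
    where
    open ≤-Reasoning
    z = C + e + 2
    eq₁ : ∀ z → z * (2 * (4 * z) + z) ≡ 3 * z * (3 * z)
    eq₁ = solve-∀
    eq₂ : ∀ u → u * u * (u * u) ≡ u * (u * (u * (u * 1)))
    eq₂ = solve-∀
    eq₃ : ∀ z → suc z * suc z ≡ z * z + z + (z + 1)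
    eq₃ = solve-∀
    eq₄ : ∀ z → z + z + z ≡ 3 * z
    eq₄ = solve-∀
    3z≤ : 3 * z ≤ 2 ^ z * 2 ^ z
    3z≤ = begin
      3 * z ≡⟨ sym (eq₄ z) ⟩
      z + z + z ≤⟨ +-mono-≤ (+-monoˡ-≤ z (m≤m*n z z ⦃ ≢-nonZero (λ e → 1+n≢0 (trans (sym (+-comm (C + _) 2)) e)) ⦄)) (m≤m+n z 1) ⟩
      z * z + z + (z + 1) ≡⟨ sym (eq₃ z) ⟩
      suc z * suc z ≤⟨ *-mono-≤ (n<2^n z) (n<2^n z) ⟩
      2 ^ z * 2 ^ z ∎

  module Constants (r′ : ℕ) (r′>0 : 0 < r′) where

    r D′ s C₁ a′ p S D₀ Θ b : ℕ
    r = suc r′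
    D′ = 3 + (r + r)
    s = 2 * (r * ((3 + 8 * r) * 2 ^ (r + 2)))
    -- Makes `D₀` equal to `C₁ * p`, linear in `p = 2 ^ a′`, whereas `full` allows `D₀ * (b + r)` to
    -- reach `p * p`.
    C₁ = 16 * s * D′ * (r * r) * D′
    -- The `r` serves `full`; the `90` serves `γ-large′`, where `90 * D₀` has to fit into `2 ^ b`.
    a′ = proj₁ (linear≤exponential C₁ (r + 90))
    p = 2 ^ a′
    S = s * p
    -- The solution of `16 * S * (Θ * D′) * r² = Θ²`, up to which `g-large` is a completed square;
    -- `S` depends on `a′` but not on `Θ`.
    Θ = 16 * S * D′ * (r * r)
    D₀ = Θ * D′
    b = a′ + a′

    D₀≡ : D₀ ≡ C₁ * p
    D₀≡ = eq s p D′ (r * r)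
      where
      eq : ∀ s p d q → 16 * (s * p) * d * q * d ≡ 16 * s * d * q * d * p
      eq = solve-∀

    large : C₁ * (2 * a′ + (r + 90)) ≤ p
    large = proj₂ (linear≤exponential C₁ (r + 90))

    2^b≡p² : 2 ^ b ≡ p * p
    2^b≡p² = ^-distribˡ-+-* 2 a′ a′

    full : D₀ * (b + r) ≤ 4 ^ a′
    full = begin
      D₀ * (b + r) ≡⟨ cong (_* (b + r)) D₀≡ ⟩
      C₁ * p * (b + r) ≡⟨ eq C₁ p a′ r ⟩
      C₁ * (2 * a′ + r) * p ≤⟨ *-monoˡ-≤ p (≤-trans (*-monoʳ-≤ C₁ (+-monoʳ-≤ (2 * a′) (m≤m+n r 90))) large) ⟩
      p * p ≡⟨ sym (4^≡2^*2^ a′) ⟩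
      4 ^ a′ ∎
      where
      open ≤-Reasoning
      eq : ∀ c p a r → c * p * (a + a + r) ≡ c * (2 * a + r) * p
      eq = solve-∀

    s>0 : 0 < s
    s>0 = *-mono-≤ {1} {2} (s≤s z≤n) (*-mono-≤ {1} {r} (s≤s z≤n) (*-mono-≤ {1} {3 + 8 * r} (s≤s z≤n) (pow>0 (r + 2) (s≤s z≤n))))

    S>0 : 0 < S
    S>0 = *-mono-≤ s>0 (pow>0 a′ (s≤s z≤n))

    Θ>r : r < Θ
    Θ>r = <-≤-trans (m<m*n r 2 (s≤s (s≤s z≤n))) (begin
      r * 2 ≤⟨ *-monoʳ-≤ r (s≤s r′>0) ⟩
      r * r ≤⟨ m≤n*m (r * r) (16 * S * D′) ⦃ >-nonZero (*-mono-≤ (*-mono-≤ {1} {16} (s≤s z≤n) S>0) (s≤s z≤n)) ⦄ ⟩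
      Θ ∎)
      where open ≤-Reasoning

    D₀>0 : 0 < D₀
    D₀>0 = *-mono-≤ {1} {Θ} (≤-trans (s≤s z≤n) Θ>r) (s≤s z≤n)

    γ-large′ : 2 * (D₀ + 1) * 18 + 18 ≤ 2 ^ b
    γ-large′ = begin
      2 * (D₀ + 1) * 18 + 18 ≤⟨ ≤-trans (≤-reflexive (eq₁ D₀)) (+-monoʳ-≤ (36 * D₀) (m≤m*n 54 D₀ ⦃ >-nonZero D₀>0 ⦄)) ⟩
      36 * D₀ + 54 * D₀ ≡⟨ trans (eq₂ D₀) (cong (90 *_) D₀≡) ⟩
      90 * (C₁ * p) ≡⟨ eq₃ C₁ p ⟩
      C₁ * 90 * p ≤⟨ *-monoˡ-≤ p (≤-trans (*-monoʳ-≤ C₁ (≤-trans (m≤n+m 90 r) (m≤n+m (r + 90) (2 * a′)))) large) ⟩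
      p * p ≡⟨ sym 2^b≡p² ⟩
      2 ^ b ∎
      where
      open ≤-Reasoning
      eq₁ : ∀ d → 2 * (d + 1) * 18 + 18 ≡ 36 * d + 54
      eq₁ = solve-∀
      eq₂ : ∀ d → 36 * d + 54 * d ≡ 90 * d
      eq₂ = solve-∀
      eq₃ : ∀ c p → 90 * (c * p) ≡ c * 90 * p
      eq₃ = solve-∀

    γ : ℕ
    γ = 2 ^ b ∸ 18

    2^b≡ : 2 ^ b ≡ γ + 18
    2^b≡ = sym (m∸n+n≡m (≤-trans (m≤n+m 18 (2 * (D₀ + 1) * 18)) γ-large′))

    γ-large : 2 * (D₀ + 1) * 18 ≤ γ
    γ-large = m+n≤o⇒m≤o∸n (2 * (D₀ + 1) * 18) γ-large′

    γ>0 : 0 < γ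
    γ>0 = ≤-trans (*-mono-≤ {1} {2 * (D₀ + 1)} (*-mono-≤ {1} {2} (s≤s z≤n) (m≤n+m 1 D₀)) (s≤s z≤n)) γ-large

    g : ℕ
    g = Θ ∸ r′

    Θ≡ : Θ ≡ g + r′
    Θ≡ = sym (m∸n+n≡m (≤-trans (n≤1+n r′) (<⇒≤ Θ>r)))

    g>0 : 0 < g
    g>0 = m<n⇒0<n∸m (≤-trans (n≤1+n (suc r′)) Θ>r)

    D′-large : 8 * (r * r) ≤ 2 ^ D′
    D′-large = begin
      8 * (r * r) ≤⟨ *-monoʳ-≤ 8 (*-mono-≤ (<⇒≤ (n<2^n r)) (<⇒≤ (n<2^n r))) ⟩
      8 * (2 ^ r * 2 ^ r) ≡⟨ cong (8 *_) (sym (^-distribˡ-+-* 2 r r)) ⟩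
      8 * 2 ^ (r + r) ≡⟨ sym (^-distribˡ-+-* 2 3 (r + r)) ⟩
      2 ^ D′ ∎
      where open ≤-Reasoning

    g-large : 2 * (4 * (S * D₀)) * (r′ * r′) ≤ g * (g + 2 * r′)
    g-large = +-cancelʳ-≤ (r′ * r′) _ _ (begin
      2 * (4 * (S * D₀)) * (r′ * r′) + r′ * r′ ≤⟨ +-monoʳ-≤ (2 * (4 * (S * D₀)) * (r′ * r′)) (m≤n*m (r′ * r′) (2 * (4 * (S * D₀)))
          ⦃ >-nonZero (*-mono-≤ {1} {2} (s≤s z≤n) (*-mono-≤ {1} {4} (s≤s z≤n) (*-mono-≤ S>0 D₀>0))) ⦄) ⟩
      2 * (4 * (S * D₀)) * (r′ * r′) + 2 * (4 * (S * D₀)) * (r′ * r′) ≡⟨ eq₁ (S * D₀) (r′ * r′) ⟩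
      16 * (S * D₀) * (r′ * r′) ≤⟨ *-monoʳ-≤ (16 * (S * D₀)) (*-mono-≤ (n≤1+n r′) (n≤1+n r′)) ⟩
      16 * (S * D₀) * (r * r) ≡⟨ eq₂ S Θ D′ (r * r) ⟩
      Θ * Θ ≡⟨ cong (λ z → z * z) Θ≡ ⟩
      (g + r′) * (g + r′) ≡⟨ eq₃ g r′ ⟩
      g * (g + 2 * r′) + r′ * r′ ∎)
      where
      open ≤-Reasoning
      eq₁ : ∀ x q → 2 * (4 * x) * q + 2 * (4 * x) * q ≡ 16 * x * q
      eq₁ = solve-∀
      eq₂ : ∀ s θ d q → 16 * (s * (θ * d)) * q ≡ θ * (16 * s * d * q)
      eq₂ = solve-∀
      eq₃ : ∀ g r → (g + r) * (g + r) ≡ g * (g + 2 * r) + r * r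
      eq₃ = solve-∀

    S≡ : S ≡ 2 * (r * ((3 + 8 * r) * 2 ^ (r + 2 + a′)))
    S≡ = trans (eq r (3 + 8 * r) (2 ^ (r + 2)) p) (cong (λ z → 2 * (r * ((3 + 8 * r) * z))) (sym (^-distribˡ-+-* 2 (r + 2) a′)))
      where
      eq : ∀ r c u p → 2 * (r * (c * u)) * p ≡ 2 * (r * (c * (u * p)))
      eq = solve-∀

    b≤ : b ≤ 4 * a′
    b≤ = ≤-trans (≤-reflexive (cong (a′ +_) (sym (+-identityʳ a′)))) (*-monoˡ-≤ a′ {2} {4} (s≤s (s≤s z≤n)))

    open Asymptotic r′ a′ b γ Θ g D′ S r′>0 g>0 γ>0 (s≤s z≤n) b≤ Θ≡ D′-large 2^b≡ γ-large g-large full S≡ public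
      using (M; C; x₀; M>0; ramsey-bound)

open import Data.Nat using (ℕ; suc; s≤s; _≤_; _<_; _^_; _*_)
open import Data.Nat.Properties using (≤-refl)

theorem1p1 : (r : ℕ) → 2 ≤ r →
    Σ ℕ λ p → Σ ℕ λ q → 0 < p × p < q ×
    Σ ℕ λ K → (k : ℕ) → K ≤ k → RamseyAtMostScaled r k p q (r ^ (r * k))
-- The ratio `M / (M + 1)` stands for `e^(-δ)`, so `δ = log (1 + 1/M)`.
theorem1p1 (suc r′) (s≤s r′>0) = M , suc M , M>0 , ≤-refl , C * 4 ^ x₀ , ramsey-bound
  where open Conclusion.Constants r′ r′>0
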